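{- Let $C_n(2)$ be the number of $2$-colored partitions $\Lambda$ of $[n]$ with $\mathrm{cr}(\Lambda)<2$ (with $C_0(2)=1$). If $n$ is a positive integer then $C_n(2)$ equals the constant coefficient of the Laurent polynomial \[\bigl(1-x^2y^{ -1}+x^3-x^2y^2+y^3-x^{ -1}y^2\bigr)\bigl(3+x+y+x^{ -1}+y^{ -1}+xy^{ -1}+x^{ -1}y\bigr)^{n-1},\] and for all nonnegative integers $n$, \[9n(n+3)\,C_n(2)-2(5n^2+26n+30)\,C_{n+1}(2)+(n+4)(n+5)\,C_{n+2}(2)=0.\] Consequently the generating function $\sum_{n\ge0}C_n(2)x^n$ is D-finite.
   Context: For a partition $P$ of $[n]=\{1,\dots,n\}$ (a set of disjoint nonempty blocks with union $[n]$), $\mathrm{Arc}(P)$ is the set of pairs $(i,j)$ with $i,j$ in the same block and $j$ the least element of that block greater than $i$. A $2$-crossing is a pair of arcs $(i_1,j_1),(i_2,j_2)$ with $i_1<i_2<j_1<j_2$. A $2$-colored partition is $\Lambda=(P,\varphi)$ with $\varphi:\mathrm{Arc}(P)\to\{1,2\}$; $\mathrm{cr}(\Lambda)<2$ means $P$ has no $2$-crossing whose two arcs have the same color. A power series $y\in\mathbb{Q}[[x]]$ is D-finite if $y,y',y'',\dots$ span a finite-dimensional vector space over $\mathbb{Q}(x)$. -}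

module Defs where

open import Data.Bool using (Bool; true; false; _∧_; _∨_; not)
open import Data.Nat as ℕ using (ℕ; zero; suc; _<ᵇ_)
open import Data.Fin using (Fin; toℕ)
open import Data.Fin.Subset using (Subset)
open import Data.Vec using (Vec; []; _∷_; lookup)
open import Data.List using (List; []; _∷_; _++_; map; length; filterᵇ; concatMap; allFin; zip)
open import Data.Bool.ListAction using (all; any)
open import Data.List.Relation.Unary.Any using (Any)
open import Data.Product using (_×_; _,_; Σ; Σ-syntax; proj₁; proj₂)
open import Data.Integer as ℤ using (ℤ; +_; -[1+_])
open import Data.Integer.Properties as ℤP using ()
open import Data.Rational as ℚ using (ℚ; 0ℚ)
open import Relation.Nullary using (¬_; does)
open import Relation.Binary.PropositionalEquality using (_≡_)

allVecs : {A : Set} → List A → (k : ℕ) → List (Vec A k)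
allVecs xs zero    = [] ∷ []
allVecs xs (suc k) = concatMap (λ x → map (x ∷_) (allVecs xs k)) xs

-- all sublists (sub-collections) of a list; for a duplicate-free list
-- these correspond bijectively to the subsets of its set of elements
sublists : {A : Set} → List A → List (List A)
sublists []       = [] ∷ []
sublists (x ∷ xs) = map (x ∷_) (sublists xs) ++ sublists xs

pairwiseᵇ : {A : Set} → (A → A → Bool) → List A → Bool
pairwiseᵇ r []       = true
pairwiseᵇ r (x ∷ xs) = all (r x) xs ∧ pairwiseᵇ r xs

-- Set partitions of [n].  The element k+1 of [n] = {1,…,n} is represented
-- by (k : Fin n); this preserves the order.  A block is a subset of [n]
-- (Data.Fin.Subset), a collection of blocks is a set of subsets of [n],
-- represented as a sublist of the (duplicate-free) list of all subsets.

_∈ᵇ_ : {n : ℕ} → Fin n → Subset n → Bool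
i ∈ᵇ B = lookup B i

allSubsets : (n : ℕ) → List (Subset n)
allSubsets n = allVecs (true ∷ false ∷ []) n

nonemptyᵇ : {n : ℕ} → Subset n → Bool
nonemptyᵇ {n} B = any (λ i → i ∈ᵇ B) (allFin n)

disjointᵇ : {n : ℕ} → Subset n → Subset n → Bool
disjointᵇ {n} B C = all (λ i → not (i ∈ᵇ B ∧ i ∈ᵇ C)) (allFin n)

isPartitionᵇ : {n : ℕ} → List (Subset n) → Bool
isPartitionᵇ {n} P =
  all nonemptyᵇ P ∧ pairwiseᵇ disjointᵇ P ∧ all (λ i → any (λ B → i ∈ᵇ B) P) (allFin n)

partitions : (n : ℕ) → List (List (Subset n))
partitions n = filterᵇ isPartitionᵇ (sublists (allSubsets n))

_<ꟳ_ : {n : ℕ} → Fin n → Fin n → Bool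
i <ꟳ j = toℕ i <ᵇ toℕ j

isArcᵇ : {n : ℕ} → List (Subset n) → Fin n × Fin n → Bool
isArcᵇ {n} P (i , j) =
  any (λ B → i ∈ᵇ B ∧ j ∈ᵇ B ∧ i <ꟳ j
             ∧ all (λ k → not (k ∈ᵇ B ∧ i <ꟳ k ∧ k <ꟳ j)) (allFin n)) P

allPairs : (n : ℕ) → List (Fin n × Fin n)
allPairs n = concatMap (λ i → map (i ,_) (allFin n)) (allFin n)

Arc : {n : ℕ} → List (Subset n) → List (Fin n × Fin n)
Arc {n} P = filterᵇ (isArcᵇ P) (allPairs n)

-- 2-colored partitions Λ = (P , φ) with φ : Arc(P) → {1,2}; φ is given by
-- the list of colours of the arcs of Arc P (in the order of that list).

TwoColoredPartition : ℕ → Set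
TwoColoredPartition n = Σ[ P ∈ List (Subset n) ] Vec ℕ (length (Arc P))

twoColoredPartitions : (n : ℕ) → List (TwoColoredPartition n)
twoColoredPartitions n =
  concatMap (λ P → map (P ,_) (allVecs (1 ∷ 2 ∷ []) (length (Arc P)))) (partitions n)

vecToList : {A : Set} {k : ℕ} → Vec A k → List A
vecToList []       = []
vecToList (x ∷ xs) = x ∷ vecToList xs

coloredArcs : {n : ℕ} → (Λ : TwoColoredPartition n) → List ((Fin n × Fin n) × ℕ)
coloredArcs (P , φ) = zip (Arc P) (vecToList φ)

crossingᵇ : {n : ℕ} → Fin n × Fin n → Fin n × Fin n → Bool
crossingᵇ (i₁ , j₁) (i₂ , j₂) = i₁ <ꟳ i₂ ∧ i₂ <ꟳ j₁ ∧ j₁ <ꟳ j₂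

crLessThan2ᵇ : {n : ℕ} → TwoColoredPartition n → Bool
crLessThan2ᵇ Λ =
  all (λ a → all (λ b → not (crossingᵇ (proj₁ a) (proj₁ b) ∧ (proj₂ a ℕ.≡ᵇ proj₂ b)))
                 (coloredArcs Λ))
      (coloredArcs Λ)

C : ℕ → ℕ
C n = length (filterᵇ crLessThan2ᵇ (twoColoredPartitions n))

-- Laurent polynomials in x, y over ℤ: finite lists of terms
-- (c , a , b) standing for c · x^a · y^b  (a, b ∈ ℤ).

Laurent : Set
Laurent = List (ℤ × ℤ × ℤ)

_·L_ : Laurent → Laurent → Laurent
p ·L q = concatMap (λ { (c , a , b) → map (λ { (d , e , f) → (c ℤ.* d , a ℤ.+ e , b ℤ.+ f) }) q }) p

oneL : Laurent
oneL = (+ 1 , + 0 , + 0) ∷ []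

_^L_ : Laurent → ℕ → Laurent
p ^L zero  = oneL
p ^L suc k = p ·L (p ^L k)

constTerm : Laurent → ℤ
constTerm []                = + 0
constTerm ((c , a , b) ∷ p) =
  (if_then_else_ (does (a ℤP.≟ + 0) ∧ does (b ℤP.≟ + 0)) c (+ 0)) ℤ.+ constTerm p
  where
  if_then_else_ : Bool → ℤ → ℤ → ℤ
  if_then_else_ true  u v = u
  if_then_else_ false u v = v

laurentA : Laurent
laurentA = (+ 1 , + 0 , + 0) ∷ (-[1+ 0 ] , + 2 , -[1+ 0 ]) ∷ (+ 1 , + 3 , + 0)
         ∷ (-[1+ 0 ] , + 2 , + 2) ∷ (+ 1 , + 0 , + 3) ∷ (-[1+ 0 ] , -[1+ 0 ] , + 2) ∷ []

laurentB : Laurent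
laurentB = (+ 3 , + 0 , + 0) ∷ (+ 1 , + 1 , + 0) ∷ (+ 1 , + 0 , + 1)
         ∷ (+ 1 , -[1+ 0 ] , + 0) ∷ (+ 1 , + 0 , -[1+ 0 ])
         ∷ (+ 1 , + 1 , -[1+ 0 ]) ∷ (+ 1 , -[1+ 0 ] , + 1) ∷ []

PowerSeries : Set
PowerSeries = ℕ → ℚ

-- polynomials in ℚ[x] as coefficient lists (constant term first)
Poly : Set
Poly = List ℚ

NonZeroPoly : Poly → Set
NonZeroPoly q = Any (λ c → ¬ (c ≡ 0ℚ)) q

fromℕℚ : ℕ → ℚ
fromℕℚ k = + k ℚ./ 1

deriv : PowerSeries → PowerSeries
deriv f m = fromℕℚ (suc m) ℚ.* f (suc m)

deriv^ : ℕ → PowerSeries → PowerSeries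
deriv^ zero    f = f
deriv^ (suc k) f = deriv^ k (deriv f)

_⋆_ : Poly → PowerSeries → PowerSeries
([]     ⋆ f) m       = 0ℚ
((c ∷ p) ⋆ f) zero    = c ℚ.* f zero
((c ∷ p) ⋆ f) (suc m) = c ℚ.* f (suc m) ℚ.+ (p ⋆ f) m

linComb : {r : ℕ} → Vec Poly r → PowerSeries → PowerSeries
linComb []       y m = 0ℚ
linComb (p ∷ ps) y m = (p ⋆ y) m ℚ.+ linComb ps (deriv y) m

-- y^(k) lies in the ℚ(x)-span of y, y', …, y^(r): clearing denominators,
-- q · y^(k) = p₀ y + … + p_r y^(r) for polynomials pᵢ and a nonzero q
InRatSpan : PowerSeries → ℕ → ℕ → Set
InRatSpan y r k =
  Σ[ q ∈ Poly ] NonZeroPoly q ×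
  Σ[ ps ∈ Vec Poly (suc r) ] (∀ m → (q ⋆ deriv^ k y) m ≡ linComb ps y m)

-- y is D-finite: the ℚ(x)-span of y, y', y'', … is finite-dimensional,
-- i.e. spanned by finitely many of the y^(k) (equivalently: some y,…,y^(r))
DFinite : PowerSeries → Set
DFinite y = Σ[ r ∈ ℕ ] (∀ k → InRatSpan y r k)

genC : PowerSeries
genC n = fromℕℚ (C n)

{-# OPTIONS --safe #-}

-- Counting. Scan [n] from right to left, adding a new least element: it is
-- either a singleton or gets joined, by a coloured arc, to the minimum of an
-- earlier block.  Whether that creates a crossing depends only on which minima
-- are covered by an arc of which colour.  Postponing the choice of the colours
-- turns this process into walks in the quarter plane from the origin to itself,
-- each step being x^{±1}, y^{±1}, (x/y)^{±1} or one of three null steps, i.e. a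
-- term of B = laurentB.
--
-- Constant term. B is invariant under (a , b) ↦ (- a , a + b) and
-- (a , b) ↦ (a + b , - b), which generate a group S₃ whose walls bound the
-- quadrant; A = laurentA is the alternating orbit sum of the reflection principle.
--
-- Recurrence. The coefficients of Bᵐ satisfy the linear relations that come from
-- x ∂/∂x Bᵐ⁺¹ = (m + 1) Bᵐ (x ∂B/∂x); modulo the symmetries of B, the recurrence
-- is an explicit combination of eight of them.
--
-- D-finiteness. Multiplied by (n + 1)(n + 2), the recurrence is a homogeneous
-- differential equation of order 4, so every derivative of the generating
-- function, times a power of the leading coefficient, is a polynomial
-- combination of the first four.

module Submission where

-- Why postponing works: within one colour the minima chosen to be joined later must be joined from
-- left to right, since an arc to a later one would cover the earlier ones. So two counters, the
-- outstanding arcs of each colour, describe the state. An element makes two half-steps: it uses up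
-- an outstanding arc or none (`dn`), then announces an arc to itself or none (`up`). In this order
-- some null steps are missing on the walls, so the steps there are not those of B and reflection
-- fails. But the first half-step and the last are forced to be trivial. Dropping them regroups n
-- elements into n - 1 pairs "announce, then use up", with step polynomial (1 + x + y)(1 + x⁻¹ +
-- y⁻¹) = B and all three null steps present everywhere. This is the origin of the exponent n - 1
-- and of the restriction to positive n.

open import Defs

-- Coefficients of powers of B.

module LaurentCoefficients where

  open import Data.Nat using (ℕ; zero; suc)
  open import Data.Integer using (ℤ; +_; -[1+_]; _+_; _-_; _*_; -_)
  import Data.Integer.Properties as ℤP
  open import Data.Integer.Tactic.RingSolver using (solve-∀)
  open import Data.List using ([]; _∷_; _++_; map)
  open import Data.Product using (_×_; _,_)
  open import Relation.Binary.PropositionalEquality using (_≡_; refl; sym; trans; cong; cong₂; module ≡-Reasoning)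

  Field : Set
  Field = ℤ → ℤ → ℤ

  _≐_ : Field → Field → Set
  f ≐ g = ∀ a b → f a b ≡ g a b

  -- Multiplication by `p`, seen on coefficients: if `f a b` is the coefficient of x⁻ᵃ y⁻ᵇ in a
  -- series, then `act p f a b` is that of its product with `p`. The negative exponents turn the
  -- convolution into a sum of translates by the exponents themselves.
  act : Laurent → Field → Field
  act []                f a b = + 0
  act ((w , x , y) ∷ p) f a b = w * f (a + x) (b + y) + act p f a b

  δ : Field
  δ (+ 0) (+ 0) = + 1
  δ _     _     = + 0

  act-cong : ∀ p {f g} → f ≐ g → act p f ≐ act p g
  act-cong []                f≐g a b = refl
  act-cong ((w , x , y) ∷ p) f≐g a b =
    cong₂ (λ u v → w * u + v) (f≐g (a + x) (b + y)) (act-cong p f≐g a b)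

  act-zero : ∀ p → act p (λ _ _ → + 0) ≐ (λ _ _ → + 0)
  act-zero []                a b = refl
  act-zero ((w , x , y) ∷ p) a b rewrite act-zero p a b = cong (_+ + 0) (ℤP.*-zeroʳ w)

  act-+ : ∀ p f g → act p (λ a b → f a b + g a b) ≐ (λ a b → act p f a b + act p g a b)
  act-+ []                f g a b = refl
  act-+ ((w , x , y) ∷ p) f g a b rewrite act-+ p f g a b =
    distribute w (f (a + x) (b + y)) (g (a + x) (b + y)) (act p f a b) (act p g a b)
    where
    distribute : ∀ w u v s t → w * (u + v) + (s + t) ≡ (w * u + s) + (w * v + t)
    distribute = solve-∀

  act-* : ∀ p k f → act p (λ a b → k * f a b) ≐ (λ a b → k * act p f a b)
  act-* []                k f a b = sym (ℤP.*-zeroʳ k)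
  act-* ((w , x , y) ∷ p) k f a b rewrite act-* p k f a b =
    pull w k (f (a + x) (b + y)) (act p f a b)
    where
    pull : ∀ w k u s → w * (k * u) + k * s ≡ k * (w * u + s)
    pull = solve-∀

  translate : ℤ → ℤ → Field → Field
  translate x y f a b = f (a + x) (b + y)

  act-translate : ∀ p x y f → act p (translate x y f) ≐ translate x y (act p f)
  act-translate []                x y f a b = refl
  act-translate ((w , s , t) ∷ p) x y f a b =
    cong₂ (λ u v → w * u + v)
      (cong₂ f (swapʳ a s x) (swapʳ b t y))
      (act-translate p x y f a b)
    where
    swapʳ : ∀ a s x → a + s + x ≡ a + x + s
    swapʳ = solve-∀

  -- Monomials act by scaled translations, which commute. The lists `p ·L q` and `q ·L p` may
  -- differ, so commutativity is stated on coefficients.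
  act-comm : ∀ p q f → act p (act q f) ≐ act q (act p f)
  act-comm p []                f a b = act-zero p a b
  act-comm p ((w , x , y) ∷ q) f a b = begin
    act p (λ c d → w * f (c + x) (d + y) + act q f c d) a b
      ≡⟨ act-+ p (λ c d → w * f (c + x) (d + y)) (act q f) a b ⟩
    act p (λ c d → w * f (c + x) (d + y)) a b + act p (act q f) a b
      ≡⟨ cong₂ _+_ (trans (act-* p w (translate x y f) a b)
                          (cong (w *_) (act-translate p x y f a b)))
                   (act-comm p q f a b) ⟩
    w * act p f (a + x) (b + y) + act q (act p f) a b ∎
    where open ≡-Reasoning

  act-++ : ∀ p q f a b → act (p ++ q) f a b ≡ act p f a b + act q f a b
  act-++ []                q f a b = sym (ℤP.+-identityˡ _)
  act-++ ((w , x , y) ∷ p) q f a b rewrite act-++ p q f a b =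
    sym (ℤP.+-assoc (w * f (a + x) (b + y)) (act p f a b) (act q f a b))

  act-map-monomial : ∀ w x y (h : ℤ × ℤ × ℤ → ℤ × ℤ × ℤ) →
    (∀ v s t → h (v , s , t) ≡ (w * v , x + s , y + t)) →
    ∀ q f a b → act (map h q) f a b ≡ w * act q f (a + x) (b + y)
  act-map-monomial w x y h h≡ []                f a b = sym (ℤP.*-zeroʳ w)
  act-map-monomial w x y h h≡ ((v , s , t) ∷ q) f a b
    rewrite h≡ v s t | act-map-monomial w x y h h≡ q f a b
          | sym (ℤP.+-assoc a x s) | sym (ℤP.+-assoc b y t) =
    factor w v (f (a + x + s) (b + y + t)) (act q f (a + x) (b + y))
    where
    factor : ∀ w v u r → w * v * u + w * r ≡ w * (v * u + r)
    factor = solve-∀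

  act-·L : ∀ p q f → act (p ·L q) f ≐ act p (act q f)
  act-·L []                q f a b = refl
  act-·L ((w , x , y) ∷ p) q f a b =
    trans (act-++ (map _ q) (p ·L q) f a b)
          (cong₂ _+_ (act-map-monomial w x y _ (λ _ _ _ → refl) q f a b) (act-·L p q f a b))

  constTerm≡act : ∀ p → constTerm p ≡ act p δ (+ 0) (+ 0)
  constTerm≡act [] = refl
  constTerm≡act ((w , x , y) ∷ p)
    rewrite ℤP.+-identityˡ x | ℤP.+-identityˡ y | constTerm≡act p
    with x | y
  ... | + 0       | + 0       = cong (_+ act p δ (+ 0) (+ 0)) (sym (ℤP.*-identityʳ w))
  ... | + 0       | + suc _   = cong (_+ act p δ (+ 0) (+ 0)) (sym (ℤP.*-zeroʳ w))
  ... | + 0       | -[1+ _ ]  = cong (_+ act p δ (+ 0) (+ 0)) (sym (ℤP.*-zeroʳ w))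
  ... | + suc _   | _         = cong (_+ act p δ (+ 0) (+ 0)) (sym (ℤP.*-zeroʳ w))
  ... | -[1+ _ ]  | _         = cong (_+ act p δ (+ 0) (+ 0)) (sym (ℤP.*-zeroʳ w))

  κ : ℕ → Field
  κ m = act (laurentB ^L m) δ

  κ-zero : κ 0 ≐ δ
  κ-zero a b rewrite ℤP.+-identityʳ a | ℤP.+-identityʳ b =
    trans (ℤP.+-identityʳ _) (ℤP.*-identityˡ (δ a b))

  κ-suc : ∀ m → κ (suc m) ≐ act laurentB (κ m)
  κ-suc m = act-·L laurentB (laurentB ^L m) δ

  ∂x : Laurent → Laurent
  ∂x = map (λ { (w , x , y) → (w * x , x , y) })

  x·act : ∀ p f a b → a * act p f a b ≡ act p (λ a b → a * f a b) a b - act (∂x p) f a b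
  x·act []                f a b = ℤP.*-zeroʳ a
  x·act ((w , x , y) ∷ p) f a b = begin
    a * (w * u + act p f a b)                          ≡⟨ ℤP.*-distribˡ-+ a (w * u) _ ⟩
    a * (w * u) + a * act p f a b                      ≡⟨ cong (λ z → a * (w * u) + z) (x·act p f a b) ⟩
    a * (w * u) + (act p (λ a b → a * f a b) a b - act (∂x p) f a b)
      ≡⟨ regroup a w x u (act p (λ a b → a * f a b) a b) (act (∂x p) f a b) ⟩
    (w * ((a + x) * u) + act p (λ a b → a * f a b) a b) - (w * x * u + act (∂x p) f a b) ∎
    where
    open ≡-Reasoning
    u = f (a + x) (b + y)
    regroup : ∀ a w x u s t → a * (w * u) + (s - t) ≡ (w * ((a + x) * u) + s) - (w * x * u + t)
    regroup = solve-∀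

  -- The coefficient form of x ∂/∂x Bᵐ⁺¹ = (m + 1) Bᵐ · x ∂B/∂x; the sign comes
  -- from κ m a b being the coefficient of x⁻ᵃ y⁻ᵇ.
  κ-deriv : ∀ m a b → a * κ (suc m) a b ≡ - (+ suc m * act (∂x laurentB) (κ m) a b)
  κ-deriv m a b = begin
    a * κ (suc m) a b                                         ≡⟨ cong (a *_) (κ-suc m a b) ⟩
    a * act laurentB (κ m) a b                                ≡⟨ x·act laurentB (κ m) a b ⟩
    act laurentB (λ a b → a * κ m a b) a b - D                ≡⟨ cong (_- D) (inner m) ⟩
    - (+ m * D) - D                                           ≡⟨ collect (+ m) D ⟩
    - ((+ 1 + + m) * D)                                       ∎
    where
    open ≡-Reasoning
    D = act (∂x laurentB) (κ m) a b
    collect : ∀ m D → - (m * D) - D ≡ - ((+ 1 + m) * D)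
    collect = solve-∀
    a·δ : (λ a b → a * κ 0 a b) ≐ (λ _ _ → + 0)
    a·δ (+ 0)     b = refl
    a·δ (+ suc n) b rewrite κ-zero (+ suc n) b = ℤP.*-zeroʳ (+ suc n)
    a·δ -[1+ n ]  b rewrite κ-zero -[1+ n ] b = ℤP.*-zeroʳ -[1+ n ]
    -- Mutual induction with `κ-deriv`: at a positive power the factor `a` is traded for
    -- `∂x laurentB` at the previous power, and `laurentB`, commuted past it, restores the power. At
    -- power 0 the only nonzero coefficient has a = 0.
    inner : ∀ m → act laurentB (λ a b → a * κ m a b) a b ≡ - (+ m * act (∂x laurentB) (κ m) a b)
    inner zero    = trans (act-cong laurentB a·δ a b) (act-zero laurentB a b)
    inner (suc m) = begin
      act laurentB (λ a b → a * κ (suc m) a b) a b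
        ≡⟨ act-cong laurentB (λ a b → trans (κ-deriv m a b) (ℤP.neg-distribˡ-* (+ suc m) _)) a b ⟩
      act laurentB (λ a b → - + suc m * act (∂x laurentB) (κ m) a b) a b
        ≡⟨ act-* laurentB (- + suc m) (act (∂x laurentB) (κ m)) a b ⟩
      - + suc m * act laurentB (act (∂x laurentB) (κ m)) a b
        ≡⟨ cong (- + suc m *_) (act-comm laurentB (∂x laurentB) (κ m) a b) ⟩
      - + suc m * act (∂x laurentB) (act laurentB (κ m)) a b
        ≡⟨ cong (- + suc m *_) (act-cong (∂x laurentB) (λ a b → sym (κ-suc m a b)) a b) ⟩
      - + suc m * act (∂x laurentB) (κ (suc m)) a b
        ≡⟨ sym (ℤP.neg-distribˡ-* (+ suc m) _) ⟩
      - (+ suc m * act (∂x laurentB) (κ (suc m)) a b) ∎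

-- Reflection principle in the quadrant.

module Reflection where

  open LaurentCoefficients
  open import Data.Nat as ℕ using (ℕ; zero; suc)
  import Data.Nat.Properties as ℕP
  open import Data.Integer using (+_; -[1+_]; _+_; _-_; _*_; -_)
  import Data.Integer.Properties as ℤP
  open import Data.Integer.Tactic.RingSolver using (solve-∀)
  open import Relation.Binary.PropositionalEquality using (_≡_; refl; sym; trans; cong; cong₂; module ≡-Reasoning)

  SwapSymmetric ShearSymmetric : Field → Set
  SwapSymmetric  f = ∀ a b → f a b ≡ f b a
  ShearSymmetric f = ∀ a b → f a b ≡ f (- a) (a + b)

  act-B-swap : ∀ {f} → SwapSymmetric f → SwapSymmetric (act laurentB f)
  act-B-swap {f} σ a b
    rewrite σ (a + + 0) (b + + 0) | σ (a + + 1) (b + + 0) | σ (a + + 0) (b + + 1)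
          | σ (a + -[1+ 0 ]) (b + + 0) | σ (a + + 0) (b + -[1+ 0 ])
          | σ (a + + 1) (b + -[1+ 0 ]) | σ (a + -[1+ 0 ]) (b + + 1) =
    reorder (f (b + + 0) (a + + 0)) (f (b + + 0) (a + + 1)) (f (b + + 1) (a + + 0))
      (f (b + + 0) (a + -[1+ 0 ])) (f (b + -[1+ 0 ]) (a + + 0))
      (f (b + -[1+ 0 ]) (a + + 1)) (f (b + + 1) (a + -[1+ 0 ]))
    where
    reorder : ∀ t₀ t₁ t₂ t₃ t₄ t₅ t₆ →
      + 3 * t₀ + (+ 1 * t₁ + (+ 1 * t₂ + (+ 1 * t₃ + (+ 1 * t₄ + (+ 1 * t₅ + (+ 1 * t₆ + + 0))))))
      ≡ + 3 * t₀ + (+ 1 * t₂ + (+ 1 * t₁ + (+ 1 * t₄ + (+ 1 * t₃ + (+ 1 * t₆ + (+ 1 * t₅ + + 0))))))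
    reorder = solve-∀

  module _ {f : Field} (σ : ShearSymmetric f) where

    shear-translate : ∀ a b x y → f (a + x) (b + y) ≡ f (- a + - x) (a + b + (x + y))
    shear-translate a b x y = trans (σ (a + x) (b + y)) (cong₂ f (ℤP.neg-distrib-+ a x) (image a b x y))
      where
      image : ∀ a b x y → a + x + (b + y) ≡ a + b + (x + y)
      image = solve-∀

    act-B-shear : ShearSymmetric (act laurentB f)
    act-B-shear a b
      rewrite shear-translate a b (+ 0) (+ 0) | shear-translate a b (+ 1) (+ 0)
            | shear-translate a b (+ 0) (+ 1) | shear-translate a b -[1+ 0 ] (+ 0)
            | shear-translate a b (+ 0) -[1+ 0 ] | shear-translate a b (+ 1) -[1+ 0 ]
            | shear-translate a b -[1+ 0 ] (+ 1) =
      reorder (f (- a + + 0) (a + b + + 0))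
        (f (- a + -[1+ 0 ]) (a + b + + 1)) (f (- a + + 0) (a + b + + 1)) (f (- a + + 1) (a + b + -[1+ 0 ]))
        (f (- a + + 0) (a + b + -[1+ 0 ])) (f (- a + -[1+ 0 ]) (a + b + + 0)) (f (- a + + 1) (a + b + + 0))
      where
      reorder : ∀ t₀ t₁ t₂ t₃ t₄ t₅ t₆ →
        + 3 * t₀ + (+ 1 * t₁ + (+ 1 * t₂ + (+ 1 * t₃ + (+ 1 * t₄ + (+ 1 * t₅ + (+ 1 * t₆ + + 0))))))
        ≡ + 3 * t₀ + (+ 1 * t₆ + (+ 1 * t₂ + (+ 1 * t₅ + (+ 1 * t₄ + (+ 1 * t₃ + (+ 1 * t₁ + + 0))))))
      reorder = solve-∀

  δ-swap : SwapSymmetric δ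
  δ-swap (+ 0)     (+ 0)     = refl
  δ-swap (+ 0)     (+ suc _) = refl
  δ-swap (+ 0)     -[1+ _ ]  = refl
  δ-swap (+ suc _) (+ 0)     = refl
  δ-swap (+ suc _) (+ suc _) = refl
  δ-swap (+ suc _) -[1+ _ ]  = refl
  δ-swap -[1+ _ ]  (+ 0)     = refl
  δ-swap -[1+ _ ]  (+ suc _) = refl
  δ-swap -[1+ _ ]  -[1+ _ ]  = refl

  δ-shear : ShearSymmetric δ
  δ-shear (+ 0)     b = cong (δ (+ 0)) (sym (ℤP.+-identityˡ b))
  δ-shear (+ suc _) b = refl
  δ-shear -[1+ _ ]  b = refl

  κ-swap : ∀ m → SwapSymmetric (κ m)
  κ-swap zero    a b = trans (κ-zero a b) (trans (δ-swap a b) (sym (κ-zero b a)))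
  κ-swap (suc m) a b = trans (κ-suc m a b) (trans (act-B-swap (κ-swap m) a b) (sym (κ-suc m b a)))

  κ-shear : ∀ m → ShearSymmetric (κ m)
  κ-shear zero    a b = trans (κ-zero a b) (trans (δ-shear a b) (sym (κ-zero _ _)))
  κ-shear (suc m) a b = trans (κ-suc m a b) (trans (act-B-shear (κ-shear m) a b) (sym (κ-suc m _ _)))

  -- The signed count of walks to (a , b) from the images of the origin under S₃ centred at (-1 ,
  -- -1). In fundamental-weight coordinates of type A₂, with ρ = (1 , 1), `laurentA` is the Weyl
  -- denominator: its exponents are ρ - wρ with signs sgn w, and the walks start at the negated
  -- exponents.
  V : ℕ → Field
  V m = act laurentA (κ m)

  V-suc : ∀ m → V (suc m) ≐ act laurentB (V m)
  V-suc m a b = trans (act-cong laurentA (κ-suc m) a b) (act-comm laurentA laurentB (κ m) a b)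

  V-swap : ∀ m → SwapSymmetric (V m)
  V-swap m a b
    rewrite κ-swap m (a + + 0) (b + + 0) | κ-swap m (a + + 2) (b + -[1+ 0 ]) | κ-swap m (a + + 3) (b + + 0)
          | κ-swap m (a + + 2) (b + + 2) | κ-swap m (a + + 0) (b + + 3) | κ-swap m (a + -[1+ 0 ]) (b + + 2) =
    reorder (κ m (b + + 0) (a + + 0)) (κ m (b + -[1+ 0 ]) (a + + 2)) (κ m (b + + 0) (a + + 3))
      (κ m (b + + 2) (a + + 2)) (κ m (b + + 3) (a + + 0)) (κ m (b + + 2) (a + -[1+ 0 ]))
    where
    reorder : ∀ t₀ t₁ t₂ t₃ t₄ t₅ →
      + 1 * t₀ + (-[1+ 0 ] * t₁ + (+ 1 * t₂ + (-[1+ 0 ] * t₃ + (+ 1 * t₄ + (-[1+ 0 ] * t₅ + + 0)))))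
      ≡ + 1 * t₀ + (-[1+ 0 ] * t₅ + (+ 1 * t₄ + (-[1+ 0 ] * t₃ + (+ 1 * t₂ + (-[1+ 0 ] * t₁ + + 0)))))
    reorder = solve-∀

  κ-pair : ∀ m a b y → κ m a (b + y) ≡ κ m (- a) (b + (a + y))
  κ-pair m a b y = trans (κ-shear m a (b + y)) (cong (κ m (- a)) (shift a b y))
    where
    shift : ∀ a b y → a + (b + y) ≡ b + (a + y)
    shift = solve-∀

  -- The reflection (a , b) ↦ (- a , a + b), centred at the wall a = -1, exchanges
  -- the positive and the negative terms of laurentA.
  V-wall₁ : ∀ m b → V m -[1+ 0 ] b ≡ + 0
  V-wall₁ m b
    rewrite κ-pair m -[1+ 0 ] b (+ 0) | κ-pair m (+ 2) b (+ 0) | κ-pair m -[1+ 0 ] b (+ 3) =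
    cancel (κ m (+ 1) (b + -[1+ 0 ])) (κ m -[1+ 1 ] (b + + 2)) (κ m (+ 1) (b + + 2))
    where
    cancel : ∀ u v w →
      + 1 * u + (-[1+ 0 ] * u + (+ 1 * v + (-[1+ 0 ] * w + (+ 1 * w + (-[1+ 0 ] * v + + 0))))) ≡ + 0
    cancel = solve-∀

  V-wall₂ : ∀ m a → V m a -[1+ 0 ] ≡ + 0
  V-wall₂ m a = trans (V-swap m a -[1+ 0 ]) (V-wall₁ m a)

  -- Every exponent of `laurentA` except (0 , 0) has a positive coordinate, so adding it to a point
  -- of the quadrant never gives the origin.
  V-zero : ∀ a b → V 0 (+ a) (+ b) ≡ δ (+ a) (+ b)
  V-zero a b = trans (act-cong laurentA κ-zero (+ a) (+ b)) (onlyFirst a b)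
    where
    onlyFirst : ∀ a b → act laurentA δ (+ a) (+ b) ≡ δ (+ a) (+ b)
    onlyFirst zero          zero    = refl
    onlyFirst zero          (suc b) = refl
    onlyFirst (suc zero)    zero    = refl
    onlyFirst (suc (suc a)) zero    = refl
    onlyFirst (suc zero)    (suc b) = refl
    onlyFirst (suc (suc a)) (suc b) = refl

  -- `up` and `dn` are the actions of 1 + x + y and 1 + x⁻¹ + y⁻¹, with value 0 outside the
  -- quadrant.
  pred₁ pred₂ up dn : (ℕ → ℕ → ℕ) → ℕ → ℕ → ℕ
  pred₁ h zero    b = 0
  pred₁ h (suc a) b = h a b
  pred₂ h a zero    = 0
  pred₂ h a (suc b) = h a b
  up h a b = h a b ℕ.+ h (suc a) b ℕ.+ h a (suc b)
  dn h a b = h a b ℕ.+ pred₁ h a b ℕ.+ pred₂ h a b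

  -- The outer `up` moves before the inner `dn`, so every point keeps three null steps; `dn (up h)`
  -- would leave only one at the origin.
  walks : ℕ → ℕ → ℕ → ℕ
  walks zero    zero zero = 1
  walks zero    _    _    = 0
  walks (suc m) a    b    = up (dn (walks m)) a b

  module _ {h : ℕ → ℕ → ℕ} {f : Field}
           (wall₁ : ∀ b → f -[1+ 0 ] b ≡ + 0) (wall₂ : ∀ a → f a -[1+ 0 ] ≡ + 0)
           (h≡f : ∀ a b → + h a b ≡ f (+ a) (+ b)) where

    pred₁≡ : ∀ a b → + pred₁ h a b ≡ f (+ a + -[1+ 0 ]) (+ b)
    pred₁≡ zero    b = sym (wall₁ (+ b))
    pred₁≡ (suc a) b = h≡f a b

    pred₂≡ : ∀ a b → + pred₂ h a b ≡ f (+ a) (+ b + -[1+ 0 ])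
    pred₂≡ a zero    = sym (wall₂ (+ a))
    pred₂≡ a (suc b) = h≡f a b

    dn≡ : ∀ a b → + dn h a b
          ≡ f (+ a) (+ b) + f (+ a + -[1+ 0 ]) (+ b) + f (+ a) (+ b + -[1+ 0 ])
    dn≡ a b = cong₂ _+_ (cong₂ _+_ (h≡f a b) (pred₁≡ a b)) (pred₂≡ a b)

    -- A step leaves the quadrant only to a = -1 or b = -1, where `f` vanishes just like the
    -- boundary value of `pred₁` and `pred₂`.
    up-dn≡act : ∀ a b → + up (dn h) a b ≡ act laurentB f (+ a) (+ b)
    up-dn≡act a b
      rewrite ℕP.+-identityʳ a | ℕP.+-identityʳ b | ℕP.+-comm a 1 | ℕP.+-comm b 1 =
      trans (cong₂ _+_ (cong₂ _+_ (dn≡ a b) (dn≡ (suc a) b)) (dn≡ a (suc b)))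
            (reorder (f (+ a) (+ b)) (f (+ suc a) (+ b)) (f (+ a) (+ suc b))
              (f (+ a + -[1+ 0 ]) (+ b)) (f (+ a) (+ b + -[1+ 0 ]))
              (f (+ suc a) (+ b + -[1+ 0 ])) (f (+ a + -[1+ 0 ]) (+ suc b)))
      where
      reorder : ∀ t₀ t₁ t₂ t₃ t₄ t₅ t₆ →
        (t₀ + t₃ + t₄) + (t₁ + t₀ + t₅) + (t₂ + t₆ + t₀)
        ≡ + 3 * t₀ + (+ 1 * t₁ + (+ 1 * t₂ + (+ 1 * t₃ + (+ 1 * t₄ + (+ 1 * t₅ + (+ 1 * t₆ + + 0))))))
      reorder = solve-∀

  walks≡V : ∀ m a b → + walks m a b ≡ V m (+ a) (+ b)
  walks≡V zero zero    zero    = sym (V-zero 0 0)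
  walks≡V zero zero    (suc b) = sym (V-zero 0 (suc b))
  walks≡V zero (suc a) zero    = sym (V-zero (suc a) 0)
  walks≡V zero (suc a) (suc b) = sym (V-zero (suc a) (suc b))
  walks≡V (suc m) a    b       =
    trans (up-dn≡act {f = V m} (V-wall₁ m) (V-wall₂ m) (walks≡V m) a b) (sym (V-suc m (+ a) (+ b)))

  walks≡constTerm : ∀ m → + walks m 0 0 ≡ constTerm (laurentA ·L (laurentB ^L m))
  walks≡constTerm m = sym (begin
    constTerm (laurentA ·L (laurentB ^L m))     ≡⟨ constTerm≡act (laurentA ·L (laurentB ^L m)) ⟩
    act (laurentA ·L (laurentB ^L m)) δ (+ 0) (+ 0) ≡⟨ act-·L laurentA (laurentB ^L m) δ (+ 0) (+ 0) ⟩
    V m (+ 0) (+ 0)                             ≡⟨ sym (walks≡V m 0 0) ⟩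
    + walks m 0 0 ∎)
    where open ≡-Reasoning

-- The three-term recurrence for walks.

module CoefficientRecurrence where

  open LaurentCoefficients
  open Reflection
  open import Data.Bool using (true; false; if_then_else_; T)
  open import Data.Nat as ℕ using (ℕ; suc; _≤ᵇ_; _∸_)
  import Data.Nat.Properties as ℕP
  import Data.Nat.Tactic.RingSolver as ℕSolver
  open import Data.Integer using (ℤ; +_; -[1+_]; _+_; _-_; _*_; -_; _⊖_)
  import Data.Integer.Properties as ℤP
  open import Data.Integer.Tactic.RingSolver using (solve-∀)
  open import Data.Product using (_×_; _,_; uncurry)
  open import Relation.Binary.PropositionalEquality using (_≡_; refl; sym; trans; cong; cong₂; subst; module ≡-Reasoning)

  sortPair : ℕ → ℕ → ℤ × ℤ
  sortPair a b = if b ≤ᵇ a then (+ a , + b) else (+ b , + a)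

  -- The representative (a , b) with a ≥ b ≥ 0 of an orbit of the dihedral group of
  -- order 12 generated by (a , b) ↦ (b , a) and (a , b) ↦ (- a , a + b).
  canon : ℤ → ℤ → ℤ × ℤ
  canonMixed : ℕ → ℕ → ℤ × ℤ
  canonMixed a b = if a ≤ᵇ b then sortPair a (b ∸ a) else sortPair (a ∸ b) b
  canon (+ a)    (+ b)    = sortPair a b
  canon -[1+ a ] -[1+ b ] = sortPair (suc a) (suc b)
  canon -[1+ a ] (+ b)    = canonMixed (suc a) b
  canon (+ b)    -[1+ a ] = canonMixed (suc a) b

  module _ {f : Field} (swap : SwapSymmetric f) (shear : ShearSymmetric f) where

    hexagon : ∀ a b → f a b ≡ f (- (a + b)) b
    hexagon a b = trans (shear a b) (trans (swap (- a) (a + b))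
      (trans (shear (a + b) (- a)) (cong (f (- (a + b))) (cancel a b))))
      where
      cancel : ∀ a b → a + b + - a ≡ b
      cancel = solve-∀

    -- The half-turn lies outside the S₃ of the reflections, so the swap is needed besides them.
    negation : ∀ a b → f a b ≡ f (- a) (- b)
    negation a b = trans (hexagon a b) (trans (swap (- (a + b)) b) (trans (shear b (- (a + b)))
      (trans (cong (f (- b)) (cancel a b)) (swap (- b) (- a)))))
      where
      cancel : ∀ a b → b + - (a + b) ≡ - a
      cancel = solve-∀

    sortPair≡ : ∀ a b → f (+ a) (+ b) ≡ uncurry f (sortPair a b)
    sortPair≡ a b with b ≤ᵇ a
    ... | true  = refl
    ... | false = swap (+ a) (+ b)

    canonMixed≡ : ∀ a b → f (- + a) (+ b) ≡ uncurry f (canonMixed a b)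
    canonMixed≡ a b with a ≤ᵇ b in eq
    ... | true  = begin
      f (- + a) (+ b)                    ≡⟨ shear (- + a) (+ b) ⟩
      f (- - + a) (- + a + + b)          ≡⟨ cong₂ f (ℤP.neg-involutive (+ a)) (ℤP.-m+n≡n⊖m a b) ⟩
      f (+ a) (b ⊖ a)                    ≡⟨ cong (f (+ a)) (ℤP.⊖-≥ (ℕP.≤ᵇ⇒≤ a b (subst T (sym eq) _))) ⟩
      f (+ a) (+ (b ∸ a))                ≡⟨ sortPair≡ a (b ∸ a) ⟩
      uncurry f (sortPair a (b ∸ a))     ∎
      where open ≡-Reasoning
    ... | false = begin
      f (- + a) (+ b)                    ≡⟨ hexagon (- + a) (+ b) ⟩
      f (- (- + a + + b)) (+ b)          ≡⟨ cong (λ z → f (- z) (+ b)) (ℤP.-m+n≡n⊖m a b) ⟩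
      f (- (b ⊖ a)) (+ b)                ≡⟨ cong (λ z → f z (+ b)) (sym (ℤP.⊖-swap a b)) ⟩
      f (a ⊖ b) (+ b)                    ≡⟨ cong (λ z → f z (+ b)) (ℤP.⊖-≥ (ℕP.≰⇒≥ a≰b)) ⟩
      f (+ (a ∸ b)) (+ b)                ≡⟨ sortPair≡ (a ∸ b) b ⟩
      uncurry f (sortPair (a ∸ b) b)     ∎
      where
      open ≡-Reasoning
      a≰b : a ℕ.≰ b
      a≰b a≤b = subst T eq (ℕP.≤⇒≤ᵇ a≤b)

    canon≡ : ∀ a b → f a b ≡ uncurry f (canon a b)
    canon≡ (+ a)    (+ b)    = sortPair≡ a b
    canon≡ -[1+ a ] -[1+ b ] = trans (negation -[1+ a ] -[1+ b ]) (sortPair≡ (suc a) (suc b))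
    canon≡ -[1+ a ] (+ b)    = canonMixed≡ (suc a) b
    canon≡ (+ b)    -[1+ a ] = trans (swap (+ b) -[1+ a ]) (canonMixed≡ (suc a) b)

  -- Found by linear algebra over ℚ(ν), where ν = m + 1: each bracketed factor on
  -- the right is the relation expressing x ∂/∂x Bᵐ⁺¹ at one exponent, in terms of the
  -- coefficients of Bᵐ at orbit representatives; each bracket on the left is a
  -- value of V m.
  certificate : ∀ ν k₀₀ k₁₀ k₁₁ k₂₀ k₂₁ k₂₂ k₃₀ k₃₁ k₃₂ k₃₃ k₄₀ k₄₁ k₄₂ k₅₀ →
      (+ 9 * ν * (ν + + 3)) * (k₀₀ - k₁₁ + k₃₀ - k₂₂ + k₃₀ - k₁₁)
      - (+ 2 * (+ 5 * ν * ν + + 26 * ν + + 30)) * (+ 3 * (k₀₀ - k₁₁ + k₃₀ - k₂₂ + k₃₀ - k₁₁) + + 2 * (k₁₀ - k₂₁ + k₄₀ - k₃₂ + k₃₁ - k₂₀))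
      + ((ν + + 4) * (ν + + 5)) * (+ 11 * (k₀₀ - k₁₁ + k₃₀ - k₂₂ + k₃₀ - k₁₁) + + 14 * (k₁₀ - k₂₁ + k₄₀ - k₃₂ + k₃₁ - k₂₀) + + 2 * (k₂₀ - k₃₁ + k₅₀ - k₄₂ + k₃₂ - k₂₁) + + 2 * (k₁₁ - k₃₀ + k₄₁ - k₃₃ + k₄₁ - k₃₀))
      ≡ (+ 8 + + 2 * ν) * (-[1+ 4 ] * (+ 3 * k₃₂ + k₂₂ + k₃₂ + k₄₂ + k₄₁ + k₃₁ + k₃₃) + ν * (k₂₂ - k₄₂ + k₃₁ - k₃₃))
        + (-[1+ 5 ] + -[1+ 1 ] * ν) * (-[1+ 3 ] * (+ 3 * k₃₁ + k₂₁ + k₂₂ + k₄₁ + k₄₀ + k₃₀ + k₃₂) + ν * (k₂₁ - k₄₁ + k₃₀ - k₃₂))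
        + (-[1+ 15 ] + -[1+ 1 ] * ν) * (-[1+ 2 ] * (+ 3 * k₂₁ + k₁₁ + k₂₁ + k₃₁ + k₃₀ + k₂₀ + k₂₂) + ν * (k₁₁ - k₃₁ + k₂₀ - k₂₂))
        + (+ 40 + + 10 * ν) * (+ 1 * (+ 3 * k₁₀ + k₂₀ + k₁₁ + k₀₀ + k₁₀ + k₁₁ + k₁₀) + ν * (k₂₀ - k₀₀ + k₁₁ - k₁₀))
        + (+ 16 + + 6 * ν) * (+ 1 * (+ 3 * k₃₁ + k₃₂ + k₄₁ + k₃₀ + k₂₁ + k₂₂ + k₄₀) + ν * (k₃₂ - k₃₀ + k₂₂ - k₄₀))
        + (-[1+ 19 ] + -[1+ 3 ] * ν) * (+ 2 * (+ 3 * k₂₀ + k₃₀ + k₂₁ + k₁₀ + k₁₁ + k₂₁ + k₁₁) + ν * (k₃₀ - k₁₀ + k₂₁ - k₁₁))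
        + (-[1+ 43 ] + -[1+ 9 ] * ν) * (+ 2 * (+ 3 * k₂₁ + k₃₁ + k₂₂ + k₁₁ + k₂₀ + k₃₀ + k₂₁) + ν * (k₃₁ - k₁₁ + k₃₀ - k₂₁))
        + (+ 10 + + 2 * ν) * (+ 4 * (+ 3 * k₄₀ + k₅₀ + k₄₁ + k₃₀ + k₃₁ + k₄₁ + k₃₁) + ν * (k₅₀ - k₃₀ + k₄₁ - k₃₁))
  certificate = solve-∀

  module Recurrence {f : Field} (swap : SwapSymmetric f) (shear : ShearSymmetric f) (ν : ℤ)
    (f-deriv : ∀ a b → a * act laurentB f a b ≡ - (ν * act (∂x laurentB) f a b)) where

    -- At literal exponents `canon` evaluates, so `F` there is literally one of the fourteen values
    -- on which `certificate` is stated; symmetric coefficients become the same term.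
    F : Field
    F a b = uncurry f (canon a b)

    f≐F : f ≐ F
    f≐F = canon≡ swap shear

    v : Field
    v a b = F a b - F (a + + 2) (b + -[1+ 0 ]) + F (a + + 3) b - F (a + + 2) (b + + 2)
          + F a (b + + 3) - F (a + -[1+ 0 ]) (b + + 2)

    act-A≡v : ∀ a b → act laurentA f a b ≡ v a b
    act-A≡v a b = trans (act-cong laurentA f≐F a b)
      (trans (cong₂ (λ a' b' → act₀ a' b') (ℤP.+-identityʳ a) (ℤP.+-identityʳ b))
        (simplify (F a b) (F (a + + 2) (b + -[1+ 0 ])) (F (a + + 3) b) (F (a + + 2) (b + + 2))
          (F a (b + + 3)) (F (a + -[1+ 0 ]) (b + + 2))))
      where
      act₀ : ℤ → ℤ → ℤ
      act₀ a' b' = + 1 * F a' b' + (-[1+ 0 ] * F (a + + 2) (b + -[1+ 0 ]) + (+ 1 * F (a + + 3) b'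
        + (-[1+ 0 ] * F (a + + 2) (b + + 2) + (+ 1 * F a' (b + + 3)
        + (-[1+ 0 ] * F (a + -[1+ 0 ]) (b + + 2) + + 0)))))
      simplify : ∀ t₀ t₁ t₂ t₃ t₄ t₅ →
        + 1 * t₀ + (-[1+ 0 ] * t₁ + (+ 1 * t₂ + (-[1+ 0 ] * t₃ + (+ 1 * t₄ + (-[1+ 0 ] * t₅ + + 0)))))
        ≡ t₀ - t₁ + t₂ - t₃ + t₄ - t₅
      simplify = solve-∀

    relation : Field
    relation a b =
      a * (+ 3 * F a b + F (a + + 1) b + F a (b + + 1) + F (a + -[1+ 0 ]) b + F a (b + -[1+ 0 ])
           + F (a + + 1) (b + -[1+ 0 ]) + F (a + -[1+ 0 ]) (b + + 1))
      + ν * (F (a + + 1) b - F (a + -[1+ 0 ]) b + F (a + + 1) (b + -[1+ 0 ])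
                     - F (a + -[1+ 0 ]) (b + + 1))

    relation≡0 : ∀ a b → relation a b ≡ + 0
    relation≡0 a b = begin
      relation a b
        ≡⟨ expand a ν (F a b) (F (a + + 1) b) (F a (b + + 1)) (F (a + -[1+ 0 ]) b)
             (F a (b + -[1+ 0 ])) (F (a + + 1) (b + -[1+ 0 ])) (F (a + -[1+ 0 ]) (b + + 1)) ⟩
      raw a b
        ≡⟨ sym (cong₂ raw (ℤP.+-identityʳ a) (ℤP.+-identityʳ b)) ⟩
      a * act laurentB F a b + ν * act (∂x laurentB) F a b
        ≡⟨ cong₂ (λ s t → a * s + ν * t)
             (sym (act-cong laurentB f≐F a b)) (sym (act-cong (∂x laurentB) f≐F a b)) ⟩
      a * act laurentB f a b + ν * act (∂x laurentB) f a b
        ≡⟨ cong (_+ ν * act (∂x laurentB) f a b) (f-deriv a b) ⟩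
      - (ν * act (∂x laurentB) f a b) + ν * act (∂x laurentB) f a b
        ≡⟨ ℤP.+-inverseˡ (ν * act (∂x laurentB) f a b) ⟩
      + 0 ∎
      where
      open ≡-Reasoning
      raw : ℤ → ℤ → ℤ
      raw a' b' =
        a * (+ 3 * F a' b' + (+ 1 * F (a + + 1) b' + (+ 1 * F a' (b + + 1)
          + (+ 1 * F (a + -[1+ 0 ]) b' + (+ 1 * F a' (b + -[1+ 0 ])
          + (+ 1 * F (a + + 1) (b + -[1+ 0 ]) + (+ 1 * F (a + -[1+ 0 ]) (b + + 1) + + 0)))))))
        + ν * (+ 0 * F a' b' + (+ 1 * F (a + + 1) b' + (+ 0 * F a' (b + + 1)
          + (-[1+ 0 ] * F (a + -[1+ 0 ]) b' + (+ 0 * F a' (b + -[1+ 0 ])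
          + (+ 1 * F (a + + 1) (b + -[1+ 0 ]) + (-[1+ 0 ] * F (a + -[1+ 0 ]) (b + + 1) + + 0)))))))
      expand : ∀ a ν t₀ t₁ t₂ t₃ t₄ t₅ t₆ →
        a * (+ 3 * t₀ + t₁ + t₂ + t₃ + t₄ + t₅ + t₆) + ν * (t₁ - t₃ + t₅ - t₆)
        ≡ a * (+ 3 * t₀ + (+ 1 * t₁ + (+ 1 * t₂ + (+ 1 * t₃ + (+ 1 * t₄ + (+ 1 * t₅ + (+ 1 * t₆ + + 0)))))))
          + ν * (+ 0 * t₀ + (+ 1 * t₁ + (+ 0 * t₂ + (-[1+ 0 ] * t₃ + (+ 0 * t₄
            + (+ 1 * t₅ + (-[1+ 0 ] * t₆ + + 0)))))))
      expand = solve-∀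

    v-recurrence : ∀ {s t u w} →
      s ≡ v (+ 0) (+ 0) → t ≡ v (+ 1) (+ 0) → u ≡ v (+ 2) (+ 0) → w ≡ v (+ 1) (+ 1) →
      (+ 9 * ν * (ν + + 3)) * s
      - (+ 2 * (+ 5 * ν * ν + + 26 * ν + + 30)) * (+ 3 * s + + 2 * t)
      + ((ν + + 4) * (ν + + 5)) * (+ 11 * s + + 14 * t + + 2 * u + + 2 * w)
      ≡ + 0
    v-recurrence refl refl refl refl = trans
      (certificate ν (f (+ 0) (+ 0)) (f (+ 1) (+ 0)) (f (+ 1) (+ 1)) (f (+ 2) (+ 0)) (f (+ 2) (+ 1))
        (f (+ 2) (+ 2)) (f (+ 3) (+ 0)) (f (+ 3) (+ 1)) (f (+ 3) (+ 2)) (f (+ 3) (+ 3)) (f (+ 4) (+ 0))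
        (f (+ 4) (+ 1)) (f (+ 4) (+ 2)) (f (+ 5) (+ 0)))
      (combine
        (+ 8 + + 2 * ν)
        (-[1+ 5 ] + -[1+ 1 ] * ν)
        (-[1+ 15 ] + -[1+ 1 ] * ν)
        (+ 40 + + 10 * ν)
        (+ 16 + + 6 * ν)
        (-[1+ 19 ] + -[1+ 3 ] * ν)
        (-[1+ 43 ] + -[1+ 9 ] * ν)
        (+ 10 + + 2 * ν)
        -- The eight points at which `relation` evaluates to the bracketed factors of `certificate`,
        -- in the same order.
        (relation≡0 -[1+ 4 ] (+ 2)) (relation≡0 -[1+ 3 ] (+ 1)) (relation≡0 -[1+ 2 ] (+ 1))
        (relation≡0 (+ 1) (+ 0)) (relation≡0 (+ 1) (+ 3)) (relation≡0 (+ 2) (+ 0))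
        (relation≡0 (+ 2) (+ 1)) (relation≡0 (+ 4) (+ 0)))
      where
      annihilate : ∀ q₁ q₂ q₃ q₄ q₅ q₆ q₇ q₈ →
        q₁ * + 0 + q₂ * + 0 + q₃ * + 0 + q₄ * + 0 + q₅ * + 0 + q₆ * + 0 + q₇ * + 0 + q₈ * + 0 ≡ + 0
      annihilate = solve-∀
      combine : ∀ q₁ q₂ q₃ q₄ q₅ q₆ q₇ q₈ {r₁ r₂ r₃ r₄ r₅ r₆ r₇ r₈} →
        r₁ ≡ + 0 → r₂ ≡ + 0 → r₃ ≡ + 0 → r₄ ≡ + 0 → r₅ ≡ + 0 → r₆ ≡ + 0 → r₇ ≡ + 0 → r₈ ≡ + 0 →
        q₁ * r₁ + q₂ * r₂ + q₃ * r₃ + q₄ * r₄ + q₅ * r₅ + q₆ * r₆ + q₇ * r₇ + q₈ * r₈ ≡ + 0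
      combine q₁ q₂ q₃ q₄ q₅ q₆ q₇ q₈ refl refl refl refl refl refl refl refl =
        annihilate q₁ q₂ q₃ q₄ q₅ q₆ q₇ q₈

  walks-swap : ∀ m a b → walks m a b ≡ walks m b a
  walks-swap m a b =
    ℤP.+-injective (trans (walks≡V m a b) (trans (V-swap m (+ a) (+ b)) (sym (walks≡V m b a))))

  up-dn-00 : ∀ h → h 0 1 ≡ h 1 0 → up (dn h) 0 0 ≡ 3 ℕ.* h 0 0 ℕ.+ 2 ℕ.* h 1 0
  up-dn-00 h eq = trans (cong (λ s → h 0 0 ℕ.+ 0 ℕ.+ 0 ℕ.+ (h 1 0 ℕ.+ h 0 0 ℕ.+ 0) ℕ.+ (s ℕ.+ 0 ℕ.+ h 0 0)) eq)
    (collect (h 0 0) (h 1 0))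
    where
    collect : ∀ s t → s ℕ.+ 0 ℕ.+ 0 ℕ.+ (t ℕ.+ s ℕ.+ 0) ℕ.+ (t ℕ.+ 0 ℕ.+ s) ≡ 3 ℕ.* s ℕ.+ 2 ℕ.* t
    collect = ℕSolver.solve-∀

  up-dn-10 : ∀ h → h 0 1 ≡ h 1 0 →
    up (dn h) 1 0 ≡ h 0 0 ℕ.+ 4 ℕ.* h 1 0 ℕ.+ h 2 0 ℕ.+ h 1 1
  up-dn-10 h eq = trans
    (cong (λ s → h 1 0 ℕ.+ h 0 0 ℕ.+ 0 ℕ.+ (h 2 0 ℕ.+ h 1 0 ℕ.+ 0) ℕ.+ (h 1 1 ℕ.+ s ℕ.+ h 1 0)) eq)
    (collect (h 0 0) (h 1 0) (h 2 0) (h 1 1))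
    where
    collect : ∀ s t u w →
      t ℕ.+ s ℕ.+ 0 ℕ.+ (u ℕ.+ t ℕ.+ 0) ℕ.+ (w ℕ.+ t ℕ.+ t) ≡ s ℕ.+ 4 ℕ.* t ℕ.+ u ℕ.+ w
    collect = ℕSolver.solve-∀

  walks-suc : ∀ m → walks (suc m) 0 0 ≡ 3 ℕ.* walks m 0 0 ℕ.+ 2 ℕ.* walks m 1 0
  walks-suc m = up-dn-00 (walks m) (walks-swap m 0 1)

  walks-suc² : ∀ m → walks (suc (suc m)) 0 0
    ≡ 11 ℕ.* walks m 0 0 ℕ.+ 14 ℕ.* walks m 1 0 ℕ.+ 2 ℕ.* walks m 2 0 ℕ.+ 2 ℕ.* walks m 1 1
  walks-suc² m = trans (walks-suc (suc m)) (trans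
    (cong₂ (λ s t → 3 ℕ.* s ℕ.+ 2 ℕ.* t) (walks-suc m) (up-dn-10 (walks m) (walks-swap m 0 1)))
    (collect (walks m 0 0) (walks m 1 0) (walks m 2 0) (walks m 1 1)))
    where
    collect : ∀ s t u w →
      3 ℕ.* (3 ℕ.* s ℕ.+ 2 ℕ.* t) ℕ.+ 2 ℕ.* (s ℕ.+ 4 ℕ.* t ℕ.+ u ℕ.+ w)
      ≡ 11 ℕ.* s ℕ.+ 14 ℕ.* t ℕ.+ 2 ℕ.* u ℕ.+ 2 ℕ.* w
    collect = ℕSolver.solve-∀

  -- Up to the swap, two steps from the origin reach only (0 , 0), (1 , 0), (2 , 0) and (1 , 1). So
  -- all three terms are combinations of values for the same power m, and the relations for this
  -- single m suffice.
  walks-recurrence : ∀ m →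
    (+ 9 * + suc m * (+ suc m + + 3)) * + walks m 0 0
    - (+ 2 * (+ 5 * + suc m * + suc m + + 26 * + suc m + + 30)) * + walks (suc m) 0 0
    + ((+ suc m + + 4) * (+ suc m + + 5)) * + walks (suc (suc m)) 0 0
    ≡ + 0
  walks-recurrence m = trans (cong₂ (λ s t →
      (+ 9 * + suc m * (+ suc m + + 3)) * + walks m 0 0
      - (+ 2 * (+ 5 * + suc m * + suc m + + 26 * + suc m + + 30)) * s
      + ((+ suc m + + 4) * (+ suc m + + 5)) * t)
      (trans (cong +_ (walks-suc m)) cast₁) (trans (cong +_ (walks-suc² m)) cast₂))
    (v-recurrence (walks≡v 0 0) (walks≡v 1 0) (walks≡v 2 0) (walks≡v 1 1))
    where
    open Recurrence {κ m} (κ-swap m) (κ-shear m) (+ suc m)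
      (λ a b → trans (cong (a *_) (sym (κ-suc m a b))) (κ-deriv m a b))
    walks≡v : ∀ a b → + walks m a b ≡ v (+ a) (+ b)
    walks≡v a b = trans (walks≡V m a b) (act-A≡v (+ a) (+ b))
    cast₁ : + (3 ℕ.* walks m 0 0 ℕ.+ 2 ℕ.* walks m 1 0) ≡ + 3 * + walks m 0 0 + + 2 * + walks m 1 0
    cast₁ = cong₂ _+_ (ℤP.pos-* 3 (walks m 0 0)) (ℤP.pos-* 2 (walks m 1 0))
    cast₂ : + (11 ℕ.* walks m 0 0 ℕ.+ 14 ℕ.* walks m 1 0 ℕ.+ 2 ℕ.* walks m 2 0 ℕ.+ 2 ℕ.* walks m 1 1)
      ≡ + 11 * + walks m 0 0 + + 14 * + walks m 1 0 + + 2 * + walks m 2 0 + + 2 * + walks m 1 1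
    cast₂ = cong₂ _+_ (cong₂ _+_ (cong₂ _+_ (ℤP.pos-* 11 (walks m 0 0)) (ℤP.pos-* 14 (walks m 1 0)))
      (ℤP.pos-* 2 (walks m 2 0))) (ℤP.pos-* 2 (walks m 1 1))

-- From visible minima to quarter-plane walks.

module Words where

  open Reflection using (pred₁; pred₂; up; dn; walks)
  open import Data.Bool using (Bool; true; false; if_then_else_)
  open import Data.Nat using (ℕ; zero; suc; _+_)
  open import Data.Nat.Properties using (+-identityʳ; +-comm; +-assoc)
  open import Data.Nat.Tactic.RingSolver using (solve-∀)
  open import Data.List using (List; []; _∷_; _++_; map; length; filterᵇ; concatMap)
  open import Data.Product using (_×_; _,_; proj₁; proj₂)
  open import Function using (_∘_)
  open import Relation.Binary.PropositionalEquality using (_≡_; refl; sym; trans; cong; cong₂; _≗_; module ≡-Reasoning)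

  private variable
    A B : Set

  +-interchange : ∀ a b c d → (a + b) + (c + d) ≡ (a + c) + (b + d)
  +-interchange = solve-∀

  when : Bool → ℕ → ℕ
  when b n = if b then n else 0

  when-+ : ∀ b m n → when b (m + n) ≡ when b m + when b n
  when-+ true  m n = refl
  when-+ false m n = refl

  ∑ : List A → (A → ℕ) → ℕ
  ∑ []       h = 0
  ∑ (x ∷ xs) h = h x + ∑ xs h

  ∑-cong : (xs : List A) {g h : A → ℕ} → g ≗ h → ∑ xs g ≡ ∑ xs h
  ∑-cong []       g≗h = refl
  ∑-cong (x ∷ xs) g≗h = cong₂ _+_ (g≗h x) (∑-cong xs g≗h)

  ∑-zero : (xs : List A) {h : A → ℕ} → (∀ x → h x ≡ 0) → ∑ xs h ≡ 0
  ∑-zero []       h≡0 = refl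
  ∑-zero (x ∷ xs) h≡0 = cong₂ _+_ (h≡0 x) (∑-zero xs h≡0)

  ∑-+ : (xs : List A) (g h : A → ℕ) → ∑ xs (λ x → g x + h x) ≡ ∑ xs g + ∑ xs h
  ∑-+ []       g h = refl
  ∑-+ (x ∷ xs) g h = trans (cong (g x + h x +_) (∑-+ xs g h)) (+-interchange (g x) (h x) (∑ xs g) (∑ xs h))

  ∑-++ : (xs ys : List A) (h : A → ℕ) → ∑ (xs ++ ys) h ≡ ∑ xs h + ∑ ys h
  ∑-++ []       ys h = refl
  ∑-++ (x ∷ xs) ys h = trans (cong (h x +_) (∑-++ xs ys h)) (sym (+-assoc (h x) (∑ xs h) (∑ ys h)))

  ∑-map : (f : A → B) (xs : List A) (h : B → ℕ) → ∑ (map f xs) h ≡ ∑ xs (h ∘ f)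
  ∑-map f []       h = refl
  ∑-map f (x ∷ xs) h = cong (h (f x) +_) (∑-map f xs h)

  ∑-concatMap : (f : A → List B) (xs : List A) (h : B → ℕ) →
    ∑ (concatMap f xs) h ≡ ∑ xs (λ x → ∑ (f x) h)
  ∑-concatMap f []       h = refl
  ∑-concatMap f (x ∷ xs) h =
    trans (∑-++ (f x) (concatMap f xs) h) (cong (∑ (f x) h +_) (∑-concatMap f xs h))

  ∑-filter : (p : A → Bool) (xs : List A) (h : A → ℕ) →
    ∑ (filterᵇ p xs) h ≡ ∑ xs (λ x → when (p x) (h x))
  ∑-filter p []       h = refl
  ∑-filter p (x ∷ xs) h with p x
  ... | true  = cong (h x +_) (∑-filter p xs h)
  ... | false = ∑-filter p xs h

  length-filter : (p : A → Bool) (xs : List A) → length (filterᵇ p xs) ≡ ∑ xs (λ x → when (p x) 1)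
  length-filter p []       = refl
  length-filter p (x ∷ xs) with p x
  ... | true  = cong suc (length-filter p xs)
  ... | false = length-filter p xs

  ∑picks : List A → (List A → A → List A → ℕ) → ℕ
  ∑picks []       g = 0
  ∑picks (x ∷ xs) g = g [] x xs + ∑picks xs (λ p y q → g (x ∷ p) y q)

  ∑picks-cong : (xs : List A) {g h : List A → A → List A → ℕ} →
    (∀ p x q → p ++ x ∷ q ≡ xs → g p x q ≡ h p x q) → ∑picks xs g ≡ ∑picks xs h
  ∑picks-cong []       g≡h = refl
  ∑picks-cong (x ∷ xs) g≡h =
    cong₂ _+_ (g≡h [] x xs refl) (∑picks-cong xs (λ p y q eq → g≡h (x ∷ p) y q (cong (x ∷_) eq)))

  ∑picks-+ : (xs : List A) (g h : List A → A → List A → ℕ) →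
    ∑picks xs (λ p x q → g p x q + h p x q) ≡ ∑picks xs g + ∑picks xs h
  ∑picks-+ []       g h = refl
  ∑picks-+ (x ∷ xs) g h =
    trans (cong (g [] x xs + h [] x xs +_) (∑picks-+ xs (λ p y q → g (x ∷ p) y q) (λ p y q → h (x ∷ p) y q)))
          (+-interchange (g [] x xs) (h [] x xs) _ _)

  ∑picks-map : (f : A → B) (xs : List A) (g : List B → B → List B → ℕ) →
    ∑picks (map f xs) g ≡ ∑picks xs (λ p x q → g (map f p) (f x) (map f q))
  ∑picks-map f []       g = refl
  ∑picks-map f (x ∷ xs) g = cong (g [] (f x) (map f xs) +_) (∑picks-map f xs (λ p y q → g (f x ∷ p) y q))

  ∑picks-zero : (xs : List A) → ∑picks xs (λ _ _ _ → 0) ≡ 0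
  ∑picks-zero []       = refl
  ∑picks-zero (x ∷ xs) = ∑picks-zero xs

  -- An entry of a word belongs to a block minimum; its two flags say in which
  -- colours that minimum can still be joined to a new element on the left.
  Word : Set
  Word = List (Bool × Bool)

  hide₁ hide₂ : Bool × Bool → Bool × Bool
  hide₁ (_ , v) = (false , v)
  hide₂ (u , _) = (u , false)

  -- Counts the crossing-free ways to add `n` more elements on the left. A picked entry disappears,
  -- because its element is no longer a block minimum. The entries before it lie under the new arc
  -- and lose its colour; the new element is visible in both colours.
  extensions : ℕ → Word → ℕ
  extensions zero    w = 1
  extensions (suc n) w =
    extensions n ((true , true) ∷ w) +
    ∑picks w (λ p v q → when (proj₁ v) (extensions n ((true , true) ∷ map hide₁ p ++ q))
                      + when (proj₂ v) (extensions n ((true , true) ∷ map hide₂ p ++ q)))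

  -- The sum of h a b over all ways of assigning to each entry of the word one of
  -- its allowed colours or no colour, a and b counting the uses of each colour.
  colourSum : Word → (ℕ → ℕ → ℕ) → ℕ
  colourSum []            h = h 0 0
  colourSum ((u , v) ∷ w) h =
    colourSum w h + when u (colourSum w (λ a b → h (suc a) b)) + when v (colourSum w (λ a b → h a (suc b)))

  _≗₂_ : (ℕ → ℕ → ℕ) → (ℕ → ℕ → ℕ) → Set
  g ≗₂ h = ∀ a b → g a b ≡ h a b

  colourSum-cong : ∀ w {g h} → g ≗₂ h → colourSum w g ≡ colourSum w h
  colourSum-cong []            g≗h = g≗h 0 0
  colourSum-cong ((u , v) ∷ w) g≗h =
    cong₂ _+_ (cong₂ _+_ (colourSum-cong w g≗h) (cong (when u) (colourSum-cong w (λ a b → g≗h (suc a) b))))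
              (cong (when v) (colourSum-cong w (λ a b → g≗h a (suc b))))

  colourSum-+ : ∀ w g h → colourSum w (λ a b → g a b + h a b) ≡ colourSum w g + colourSum w h
  colourSum-+ []            g h = refl
  colourSum-+ ((u , v) ∷ w) g h
    rewrite colourSum-+ w g h
          | colourSum-+ w (λ a b → g (suc a) b) (λ a b → h (suc a) b)
          | colourSum-+ w (λ a b → g a (suc b)) (λ a b → h a (suc b))
          | when-+ u (colourSum w (λ a b → g (suc a) b)) (colourSum w (λ a b → h (suc a) b))
          | when-+ v (colourSum w (λ a b → g a (suc b))) (colourSum w (λ a b → h a (suc b))) =
    regroup (colourSum w g) (colourSum w h) (when u (colourSum w (λ a b → g (suc a) b)))
      (when u (colourSum w (λ a b → h (suc a) b))) (when v (colourSum w (λ a b → g a (suc b))))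
      (when v (colourSum w (λ a b → h a (suc b))))
    where
    regroup : ∀ a b c d e f → a + b + (c + d) + (e + f) ≡ a + c + e + (b + d + f)
    regroup = solve-∀

  colourSum-zero : ∀ w → colourSum w (λ _ _ → 0) ≡ 0
  colourSum-zero []            = refl
  colourSum-zero ((u , v) ∷ w) rewrite colourSum-zero w with u | v
  ... | true  | true  = refl
  ... | true  | false = refl
  ... | false | true  = refl
  ... | false | false = refl

  pick₁ pick₂ : (ℕ → ℕ → ℕ) → Word → Bool × Bool → Word → ℕ
  pick₁ h p v q = when (proj₁ v) (colourSum (map hide₁ p ++ q) h)
  pick₂ h p v q = when (proj₂ v) (colourSum (map hide₂ p ++ q) h)

  -- The picked entry is the first one that uses the colour, so the entries before
  -- it must not use it.
  colourSum-pred₁ : ∀ w h → colourSum w (pred₁ h) ≡ ∑picks w (pick₁ h)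
  colourSum-pred₁ []            h = refl
  colourSum-pred₁ ((u , v) ∷ w) h = begin
    colourSum w (pred₁ h) + when u (colourSum w h) + when v (colourSum w (λ a b → pred₁ h a (suc b)))
      ≡⟨ cong₂ (λ s t → s + when u (colourSum w h) + when v t) (colourSum-pred₁ w h)
           (trans (colourSum-cong w pred-shift) (colourSum-pred₁ w h⁺)) ⟩
    ∑picks w (pick₁ h) + when u (colourSum w h) + when v (∑picks w (pick₁ h⁺))
      ≡⟨ rotate (∑picks w (pick₁ h)) (when u (colourSum w h)) _ ⟩
    when u (colourSum w h) + (∑picks w (pick₁ h) + when v (∑picks w (pick₁ h⁺)))
      ≡⟨ cong (when u (colourSum w h) +_) (sym (skip v)) ⟩
    when u (colourSum w h) + ∑picks w (λ p x q → pick₁ h ((u , v) ∷ p) x q) ∎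
    where
    open ≡-Reasoning
    h⁺ : ℕ → ℕ → ℕ
    h⁺ a b = h a (suc b)
    pred-shift : (λ a b → pred₁ h a (suc b)) ≗₂ pred₁ h⁺
    pred-shift zero    b = refl
    pred-shift (suc a) b = refl
    rotate : ∀ a b c → a + b + c ≡ b + (a + c)
    rotate = solve-∀
    distribute : ∀ t v a b → when t (a + 0 + when v b) ≡ when t a + when v (when t b)
    distribute true  true  a b = cong (_+ b) (+-identityʳ a)
    distribute true  false a b = cong (_+ 0) (+-identityʳ a)
    distribute false true  a b = refl
    distribute false false a b = refl
    ∑picks-when : ∀ v → ∑picks w (λ p x q → when v (pick₁ h⁺ p x q)) ≡ when v (∑picks w (pick₁ h⁺))
    ∑picks-when true  = refl
    ∑picks-when false = ∑picks-zero w
    skip : ∀ v → ∑picks w (λ p x q → pick₁ h ((u , v) ∷ p) x q)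
                 ≡ ∑picks w (pick₁ h) + when v (∑picks w (pick₁ h⁺))
    skip v = trans
      (∑picks-cong w (λ p x q _ → distribute (proj₁ x) v _ (colourSum (map hide₁ p ++ q) h⁺)))
      (trans (∑picks-+ w (pick₁ h) (λ p x q → when v (pick₁ h⁺ p x q)))
             (cong (∑picks w (pick₁ h) +_) (∑picks-when v)))

  colourSum-pred₂ : ∀ w h → colourSum w (pred₂ h) ≡ ∑picks w (pick₂ h)
  colourSum-pred₂ []            h = refl
  colourSum-pred₂ ((u , v) ∷ w) h = begin
    colourSum w (pred₂ h) + when u (colourSum w (λ a b → pred₂ h (suc a) b)) + when v (colourSum w h)
      ≡⟨ cong₂ (λ s t → s + when u t + when v (colourSum w h)) (colourSum-pred₂ w h)
           (trans (colourSum-cong w pred-shift) (colourSum-pred₂ w h⁺)) ⟩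
    ∑picks w (pick₂ h) + when u (∑picks w (pick₂ h⁺)) + when v (colourSum w h)
      ≡⟨ +-comm (∑picks w (pick₂ h) + _) (when v (colourSum w h)) ⟩
    when v (colourSum w h) + (∑picks w (pick₂ h) + when u (∑picks w (pick₂ h⁺)))
      ≡⟨ cong (when v (colourSum w h) +_) (sym (skip u)) ⟩
    when v (colourSum w h) + ∑picks w (λ p x q → pick₂ h ((u , v) ∷ p) x q) ∎
    where
    open ≡-Reasoning
    h⁺ : ℕ → ℕ → ℕ
    h⁺ a b = h (suc a) b
    pred-shift : (λ a b → pred₂ h (suc a) b) ≗₂ pred₂ h⁺
    pred-shift a zero    = refl
    pred-shift a (suc b) = refl
    distribute : ∀ t u a b → when t (a + when u b + 0) ≡ when t a + when u (when t b)
    distribute true  true  a b = +-identityʳ (a + b)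
    distribute true  false a b = +-identityʳ (a + 0)
    distribute false true  a b = refl
    distribute false false a b = refl
    ∑picks-when : ∀ u → ∑picks w (λ p x q → when u (pick₂ h⁺ p x q)) ≡ when u (∑picks w (pick₂ h⁺))
    ∑picks-when true  = refl
    ∑picks-when false = ∑picks-zero w
    skip : ∀ u → ∑picks w (λ p x q → pick₂ h ((u , v) ∷ p) x q)
                 ≡ ∑picks w (pick₂ h) + when u (∑picks w (pick₂ h⁺))
    skip u = trans
      (∑picks-cong w (λ p x q _ → distribute (proj₂ x) u _ (colourSum (map hide₂ p ++ q) h⁺)))
      (trans (∑picks-+ w (pick₂ h) (λ p x q → when u (pick₂ h⁺ p x q)))
             (cong (∑picks w (pick₂ h) +_) (∑picks-when u)))

  -- The outer `dn` acts first: an element uses up an outstanding arc or none, then announces one to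
  -- itself or none. After the last element nothing may be outstanding.
  returns : ℕ → ℕ → ℕ → ℕ
  returns zero    zero zero = 1
  returns zero    _    _    = 0
  returns (suc n) a    b    = dn (up (returns n)) a b

  colourSum-up : ∀ w h → colourSum ((true , true) ∷ w) h ≡ colourSum w (up h)
  colourSum-up w h = sym (trans (colourSum-+ w (λ a b → h a b + h (suc a) b) (λ a b → h a (suc b)))
    (cong (_+ colourSum w (λ a b → h a (suc b))) (colourSum-+ w h (λ a b → h (suc a) b))))

  colourSum-returns-0 : ∀ w → colourSum w (returns 0) ≡ 1
  colourSum-returns-0 []            = refl
  colourSum-returns-0 ((u , v) ∷ w)
    rewrite colourSum-returns-0 w | colourSum-zero w
          | colourSum-cong w {λ a b → returns 0 a (suc b)} {λ _ _ → 0} (λ { zero b → refl ; (suc a) b → refl })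
          | colourSum-zero w with u | v
  ... | true  | true  = refl
  ... | true  | false = refl
  ... | false | true  = refl
  ... | false | false = refl

  -- Each entry decides in advance whether, and in which colour, it will be joined. A fresh entry,
  -- being free to choose, contributes `up`. Joining the first entry that has chosen a colour lowers
  -- the count of that colour, so the picks contribute `pred₁` and `pred₂`; together with the case
  -- of no join they form `dn`.
  extensions≡colourSum : ∀ n w → extensions n w ≡ colourSum w (returns n)
  extensions≡colourSum zero    w = sym (colourSum-returns-0 w)
  extensions≡colourSum (suc n) w = begin
    extensions n ((true , true) ∷ w) +
      ∑picks w (λ p v q → when (proj₁ v) (extensions n ((true , true) ∷ map hide₁ p ++ q))
                        + when (proj₂ v) (extensions n ((true , true) ∷ map hide₂ p ++ q)))
      ≡⟨ cong₂ _+_ (open-top w) (∑picks-cong w (λ p v q _ →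
           cong₂ _+_ (cong (when (proj₁ v)) (open-top (map hide₁ p ++ q)))
                     (cong (when (proj₂ v)) (open-top (map hide₂ p ++ q))))) ⟩
    colourSum w h + ∑picks w (λ p v q → pick₁ h p v q + pick₂ h p v q)
      ≡⟨ cong (colourSum w h +_) (∑picks-+ w (pick₁ h) (pick₂ h)) ⟩
    colourSum w h + (∑picks w (pick₁ h) + ∑picks w (pick₂ h))
      ≡⟨ cong (colourSum w h +_) (sym (cong₂ _+_ (colourSum-pred₁ w h) (colourSum-pred₂ w h))) ⟩
    colourSum w h + (colourSum w (pred₁ h) + colourSum w (pred₂ h))
      ≡⟨ sym (+-assoc (colourSum w h) _ _) ⟩
    colourSum w h + colourSum w (pred₁ h) + colourSum w (pred₂ h)
      ≡⟨ cong (_+ colourSum w (pred₂ h)) (sym (colourSum-+ w h (pred₁ h))) ⟩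
    colourSum w (λ a b → h a b + pred₁ h a b) + colourSum w (pred₂ h)
      ≡⟨ sym (colourSum-+ w (λ a b → h a b + pred₁ h a b) (pred₂ h)) ⟩
    colourSum w (dn h) ∎
    where
    open ≡-Reasoning
    h = up (returns n)
    open-top : ∀ w → extensions n ((true , true) ∷ w) ≡ colourSum w h
    open-top w = trans (extensions≡colourSum n ((true , true) ∷ w)) (colourSum-up w (returns n))

  up-cong : ∀ {g h} → g ≗₂ h → up g ≗₂ up h
  up-cong g≗h a b = cong₂ _+_ (cong₂ _+_ (g≗h a b) (g≗h (suc a) b)) (g≗h a (suc b))

  dn-cong : ∀ {g h} → g ≗₂ h → dn g ≗₂ dn h
  dn-cong g≗h zero    zero    = cong (λ x → x + 0 + 0) (g≗h 0 0)
  dn-cong g≗h zero    (suc b) = cong₂ (λ x y → x + 0 + y) (g≗h 0 (suc b)) (g≗h 0 b)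
  dn-cong g≗h (suc a) zero    = cong₂ (λ x y → x + y + 0) (g≗h (suc a) 0) (g≗h a 0)
  dn-cong g≗h (suc a) (suc b) = cong₂ _+_ (cong₂ _+_ (g≗h (suc a) (suc b)) (g≗h a (suc b))) (g≗h (suc a) b)

  -- Moves the grouping by half an element: `up` after m rounds of `dn` and `up` is m rounds of `up`
  -- and `dn`, because an announcement after the last element could never be honoured.
  up-returns : ∀ m → up (returns m) ≗₂ walks m
  up-returns zero zero    zero    = refl
  up-returns zero zero    (suc b) = refl
  up-returns zero (suc a) zero    = refl
  up-returns zero (suc a) (suc b) = refl
  up-returns (suc m) = up-cong (dn-cong (up-returns m))

  -- The first element finds nothing outstanding, so its `dn` is trivial and `suc m` elements make
  -- only `m` steps.
  extensions-suc : ∀ m → extensions (suc m) [] ≡ walks m 0 0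
  extensions-suc m = trans (extensions≡colourSum (suc m) [])
    (trans (trans (+-identityʳ _) (+-identityʳ _)) (up-returns m 0 0))

-- Crossings of coloured arcs when a least element is added.

module ColoredArcs where

  open Words
  open import Data.Bool using (Bool; true; false; _∧_; not; T)
  open import Data.Bool.Properties using (T-≡)
  open import Data.Bool.ListAction using (all)
  open import Data.Nat using (ℕ; zero; suc; _+_; _<_; _<ᵇ_; _≡ᵇ_; s≤s; z≤n)
  open import Data.Nat.Properties using (+-identityʳ; +-suc; <⇒<ᵇ; <ᵇ⇒<; <-asym)
  open import Data.List using (List; []; _∷_; _++_; map)
  open import Data.List.Properties using (map-++; map-∘; map-cong; map-cong-local)
  open import Data.List.Relation.Unary.All as All using (All; []; _∷_)
  import Data.List.Relation.Unary.All.Properties as AllP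
  open import Data.List.Relation.Unary.AllPairs as AllPairs using (AllPairs; []; _∷_)
  import Data.List.Relation.Unary.AllPairs.Properties as AllPairsP
  open import Data.Product using (_×_; _,_; proj₁; proj₂)
  open import Data.Unit using (tt)
  open import Function using (_∘_; Equivalence)
  open import Relation.Binary.PropositionalEquality using (_≡_; refl; sym; trans; cong; cong₂; subst; _≗_; module ≡-Reasoning)

  private variable
    A B : Set

  all-cong : {p q : A → Bool} → p ≗ q → (xs : List A) → all p xs ≡ all q xs
  all-cong p≗q []       = refl
  all-cong p≗q (x ∷ xs) = cong₂ _∧_ (p≗q x) (all-cong p≗q xs)

  all-map : (p : B → Bool) (f : A → B) (xs : List A) → all p (map f xs) ≡ all (p ∘ f) xs
  all-map p f []       = refl
  all-map p f (x ∷ xs) = cong (p (f x) ∧_) (all-map p f xs)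

  all-true : (xs : List A) → all (λ _ → true) xs ≡ true
  all-true []       = refl
  all-true (x ∷ xs) = all-true xs

  Arcℕ ColoredArc : Set
  Arcℕ       = ℕ × ℕ
  ColoredArc = Arcℕ × ℕ

  shift : Arcℕ → Arcℕ
  shift (i , j) = (suc i , suc j)

  shiftᶜ : ColoredArc → ColoredArc
  shiftᶜ (a , c) = (shift a , c)

  crosses : Arcℕ → Arcℕ → Bool
  crosses (i₁ , j₁) (i₂ , j₂) = (i₁ <ᵇ i₂) ∧ (i₂ <ᵇ j₁) ∧ (j₁ <ᵇ j₂)

  compatible : ColoredArc → ColoredArc → Bool
  compatible a b = not (crosses (proj₁ a) (proj₁ b) ∧ (proj₂ a ≡ᵇ proj₂ b))

  noncrossing : List ColoredArc → Bool
  noncrossing K = all (λ a → all (compatible a) K) K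

  -- An arc to `j` from a point left of everything crosses (i , k) exactly when i < j < k. The
  -- conjunction is bracketed as `compatible` evaluates on the new arc.
  covers : ℕ → ℕ → ColoredArc → Bool
  covers c j ((i , k) , c′) = ((i <ᵇ j) ∧ (j <ᵇ k)) ∧ (c ≡ᵇ c′)

  visible : List ColoredArc → ℕ → ℕ → Bool
  visible K c j = all (λ a → not (covers c j a)) K

  word : List ColoredArc → List ℕ → Word
  word K = map (λ j → visible K 1 j , visible K 2 j)

  noncrossing-shift : ∀ K → noncrossing (map shiftᶜ K) ≡ noncrossing K
  noncrossing-shift K = trans (all-map _ shiftᶜ K) (all-cong (λ a → all-map (compatible (shiftᶜ a)) shiftᶜ K) K)

  -- The new arc starts at the least element, so it can only be the left arc of a crossing; all
  -- tests with it in the other position, and against itself, evaluate to true.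
  noncrossing-∷ : ∀ K j c →
    noncrossing (((0 , suc j) , c) ∷ map shiftᶜ K) ≡ visible K c j ∧ noncrossing K
  noncrossing-∷ K j c = cong₂ _∧_ (all-map _ shiftᶜ K) (noncrossing-shift K)

  visible-shift : ∀ K c j → visible (map shiftᶜ K) c (suc j) ≡ visible K c j
  visible-shift K c j = all-map _ shiftᶜ K

  visible-zero : ∀ K c → visible (map shiftᶜ K) c 0 ≡ true
  visible-zero K c = trans (all-map _ shiftᶜ K) (all-true K)

  Increasing : List ℕ → Set
  Increasing = AllPairs _<_

  <ᵇ-true : ∀ {i j} → i < j → (i <ᵇ j) ≡ true
  <ᵇ-true i<j = Equivalence.to T-≡ (<⇒<ᵇ i<j)

  <ᵇ-false : ∀ {i j} → j < i → (i <ᵇ j) ≡ false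
  <ᵇ-false {i} {j} j<i with i <ᵇ j in eq
  ... | false = refl
  ... | true with () ← <-asym j<i (<ᵇ⇒< i j (subst T (sym eq) tt))

  word-singleton : ∀ K ms → word (map shiftᶜ K) (0 ∷ map suc ms) ≡ (true , true) ∷ word K ms
  word-singleton K ms = cong₂ _∷_ (cong₂ _,_ (visible-zero K 1) (visible-zero K 2))
    (trans (sym (map-∘ ms)) (map-cong (λ j → cong₂ _,_ (visible-shift K 1 j) (visible-shift K 2 j)) ms))

  module _ (K : List ColoredArc) (j c : ℕ) where

    joined : List ColoredArc
    joined = ((0 , suc j) , c) ∷ map shiftᶜ K

    visible-before : ∀ c′ {k} → k < j → visible joined c′ (suc k) ≡ not (c′ ≡ᵇ c) ∧ visible K c′ k
    visible-before c′ {k} k<j = cong₂ _∧_ (cong (λ b → not (b ∧ (c′ ≡ᵇ c))) (<ᵇ-true k<j)) (visible-shift K c′ k)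

    visible-after : ∀ c′ {k} → j < k → visible joined c′ (suc k) ≡ visible K c′ k
    visible-after c′ {k} j<k = cong₂ _∧_ (cong (λ b → not (b ∧ (c′ ≡ᵇ c))) (<ᵇ-false j<k)) (visible-shift K c′ k)

    hide : Bool × Bool → Bool × Bool
    hide (u , v) = (not (1 ≡ᵇ c) ∧ u , not (2 ≡ᵇ c) ∧ v)

    word-join : ∀ p q → All (_< j) p → All (j <_) q →
      word joined (0 ∷ map suc (p ++ q)) ≡ (true , true) ∷ map hide (word K p) ++ word K q
    word-join p q p<j j<q = cong₂ _∷_ (cong₂ _,_ (visible-zero K 1) (visible-zero K 2)) (begin
      map flags (map suc (p ++ q))                 ≡⟨ sym (map-∘ (p ++ q)) ⟩
      map (flags ∘ suc) (p ++ q)                   ≡⟨ map-++ (flags ∘ suc) p q ⟩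
      map (flags ∘ suc) p ++ map (flags ∘ suc) q
        ≡⟨ cong₂ _++_
             (trans (map-cong-local (All.map (λ k<j → cong₂ _,_ (visible-before 1 k<j) (visible-before 2 k<j)) p<j))
                    (map-∘ p))
             (map-cong-local (All.map (λ j<k → cong₂ _,_ (visible-after 1 j<k) (visible-after 2 j<k)) j<q)) ⟩
      map hide (word K p) ++ word K q              ∎)
      where
      open ≡-Reasoning
      flags : ℕ → Bool × Bool
      flags k = visible joined 1 k , visible joined 2 k

  Weight : Set
  Weight = List ColoredArc → List ℕ → ℕ

  -- Sums `H` over the ways to add a least element to a coloured partition. The coloured arcs and
  -- the block minima are the only data of the partition that this needs.
  addFirst : Weight → Weight
  addFirst H K ms =
    H (map shiftᶜ K) (0 ∷ map suc ms) +
    ∑picks ms (λ p j q → H (((0 , suc j) , 1) ∷ map shiftᶜ K) (0 ∷ map suc (p ++ q))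
                       + H (((0 , suc j) , 2) ∷ map shiftᶜ K) (0 ∷ map suc (p ++ q)))

  -- The sum of `H` over all 2-coloured partitions of [n], as `∑-partitions≡build` will show.
  -- Recursion acts on the weight, because the choices for the element added last form the inner
  -- sum.
  build : ℕ → Weight → ℕ
  build zero    H = H [] []
  build (suc n) H = build n (addFirst H)

  split-increasing : ∀ p j q → Increasing (p ++ j ∷ q) →
    Increasing (p ++ q) × All (_< j) p × All (j <_) q
  split-increasing []      j q (j<q ∷ inc) = inc , [] , j<q
  split-increasing (x ∷ p) j q (x< ∷ inc) with split-increasing p j q inc | AllP.++⁻ˡ p x< | AllP.++⁻ʳ p x<
  ... | inc′ , p<j , j<q | x<p | x<j ∷ x<q = AllP.++⁺ x<p x<q ∷ inc′ , x<j ∷ p<j , j<q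

  increasing-0∷suc : ∀ {ms} → Increasing ms → Increasing (0 ∷ map suc ms)
  increasing-0∷suc {ms} inc =
    AllP.map⁺ (All.universal (λ _ → s≤s z≤n) ms) ∷ AllPairsP.map⁺ (AllPairs.map s≤s inc)

  -- Starting from the empty list, `build` only meets increasing lists of minima. Agreement is
  -- required on these alone, which matters because the entries before a picked minimum are the
  -- covered ones only if the list is increasing.
  build-cong : ∀ n {G H : Weight} → (∀ K ms → Increasing ms → G K ms ≡ H K ms) → build n G ≡ build n H
  build-cong zero    G≡H = G≡H [] [] []
  build-cong (suc n) G≡H = build-cong n λ K ms inc →
    cong₂ _+_ (G≡H _ _ (increasing-0∷suc inc))
      (∑picks-cong ms λ { p j q refl →
        let inc′ = increasing-0∷suc (proj₁ (split-increasing p j q inc))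
        in cong₂ _+_ (G≡H _ _ inc′) (G≡H _ _ inc′) })

  -- The number of crossing-free completions by `n` further elements; this family is stable under
  -- `addFirst`.
  extensionWeight : ℕ → Weight
  extensionWeight n K ms = when (noncrossing K) (extensions n (word K ms))

  addFirst-extensionWeight : ∀ n K ms → Increasing ms →
    addFirst (extensionWeight n) K ms ≡ extensionWeight (suc n) K ms
  addFirst-extensionWeight n K ms inc = begin
    addFirst (extensionWeight n) K ms
      ≡⟨ cong₂ _+_
           (cong₂ (λ b w → when b (extensions n w)) (noncrossing-shift K) (word-singleton K ms))
           (∑picks-cong ms λ { p j q refl →
             let (_ , p<j , j<q) = split-increasing p j q inc in
             cong₂ _+_
               (cong₂ (λ b w → when b (extensions n w)) (noncrossing-∷ K j 1) (word-join K j 1 p q p<j j<q))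
               (cong₂ (λ b w → when b (extensions n w)) (noncrossing-∷ K j 2) (word-join K j 2 p q p<j j<q)) }) ⟩
    when (noncrossing K) (extensions n ((true , true) ∷ word K ms)) +
      ∑picks ms (λ p j q →
          when (visible K 1 j ∧ noncrossing K) (extensions n ((true , true) ∷ map hide₁ (word K p) ++ word K q))
        + when (visible K 2 j ∧ noncrossing K) (extensions n ((true , true) ∷ map hide₂ (word K p) ++ word K q)))
      ≡⟨ factor (noncrossing K) ⟩
    when (noncrossing K) (extensions n ((true , true) ∷ word K ms) + ∑picks ms (λ p j q → G (word K p) (flags j) (word K q)))
      ≡⟨ cong (λ s → when (noncrossing K) (extensions n ((true , true) ∷ word K ms) + s)) (sym (∑picks-map flags ms G)) ⟩
    extensionWeight (suc n) K ms ∎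
    where
    open ≡-Reasoning
    flags : ℕ → Bool × Bool
    flags j = visible K 1 j , visible K 2 j
    G : Word → Bool × Bool → Word → ℕ
    G p v q = when (proj₁ v) (extensions n ((true , true) ∷ map hide₁ p ++ q))
            + when (proj₂ v) (extensions n ((true , true) ∷ map hide₂ p ++ q))
    when-∧ : ∀ b n → when (b ∧ true) n ≡ when b n
    when-∧ true  n = refl
    when-∧ false n = refl
    when-∧false : ∀ b n → when (b ∧ false) n ≡ 0
    when-∧false true  n = refl
    when-∧false false n = refl
    factor : ∀ b →
      when b (extensions n ((true , true) ∷ word K ms)) +
        ∑picks ms (λ p j q →
            when (visible K 1 j ∧ b) (extensions n ((true , true) ∷ map hide₁ (word K p) ++ word K q))
          + when (visible K 2 j ∧ b) (extensions n ((true , true) ∷ map hide₂ (word K p) ++ word K q)))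
      ≡ when b (extensions n ((true , true) ∷ word K ms) + ∑picks ms (λ p j q → G (word K p) (flags j) (word K q)))
    factor true  = cong (extensions n ((true , true) ∷ word K ms) +_)
      (∑picks-cong ms λ p j q _ → cong₂ _+_ (when-∧ (visible K 1 j) _) (when-∧ (visible K 2 j) _))
    factor false = trans
      (∑picks-cong ms λ p j q _ → cong₂ _+_ (when-∧false (visible K 1 j) _) (when-∧false (visible K 2 j) _))
      (∑picks-zero ms)

  build-extensionWeight : ∀ n k → build n (extensionWeight k) ≡ extensions (n + k) []
  build-extensionWeight zero    k = refl
  build-extensionWeight (suc n) k = begin
    build n (addFirst (extensionWeight k)) ≡⟨ build-cong n (addFirst-extensionWeight k) ⟩
    build n (extensionWeight (suc k))      ≡⟨ build-extensionWeight n (suc k) ⟩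
    extensions (n + suc k) []              ≡⟨ cong (λ i → extensions i []) (+-suc n k) ⟩
    extensions (suc (n + k)) []            ∎
    where open ≡-Reasoning

  build-noncrossing : ∀ n → build n (λ K _ → when (noncrossing K) 1) ≡ extensions n []
  build-noncrossing n = trans (build-extensionWeight n 0) (cong (λ i → extensions i []) (+-identityʳ n))

-- Set partitions of [n + 1] from those of [n].

module Partitions where

  open Words
  open ColoredArcs
  open import Data.Bool using (Bool; true; false; _∧_; _∨_; not)
  open import Data.Bool.Properties using (∧-zeroʳ; ∧-comm)
  open import Data.Bool.ListAction using (all; any)
  open import Data.Fin using (Fin; zero; suc)
  open import Data.Fin.Subset using (Subset)
  open import Data.Nat using (ℕ; zero; suc; _+_)
  open import Data.Nat.Properties using (+-identityʳ; +-assoc)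
  open import Data.List using (List; []; _∷_; _++_; map; allFin; tabulate)
  open import Data.List.Properties using (map-tabulate; ++-identityʳ)
  open import Data.Vec using ([]; _∷_; replicate)
  open import Data.Vec.Properties using (lookup-replicate)
  open import Function using (_∘_; id)
  open import Relation.Binary.PropositionalEquality using (_≡_; refl; sym; trans; cong; cong₂; _≗_; module ≡-Reasoning)

  private variable
    A B : Set
    n : ℕ

  any-cong : {p q : A → Bool} → p ≗ q → (xs : List A) → any p xs ≡ any q xs
  any-cong p≗q []       = refl
  any-cong p≗q (x ∷ xs) = cong₂ _∨_ (p≗q x) (any-cong p≗q xs)

  any-map : (p : B → Bool) (f : A → B) (xs : List A) → any p (map f xs) ≡ any (p ∘ f) xs
  any-map p f []       = refl
  any-map p f (x ∷ xs) = cong (p (f x) ∨_) (any-map p f xs)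

  any-false : (xs : List A) → any (λ _ → false) xs ≡ false
  any-false []       = refl
  any-false (x ∷ xs) = any-false xs

  ∧-interchange : ∀ a b c d → (a ∧ b) ∧ (c ∧ d) ≡ (a ∧ c) ∧ (b ∧ d)
  ∧-interchange true  true  c     d = refl
  ∧-interchange true  false true  d = refl
  ∧-interchange true  false false d = refl
  ∧-interchange false b     c     d = refl

  ∧-swap : ∀ a b c → a ∧ (b ∧ c) ≡ b ∧ (a ∧ c)
  ∧-swap true  true  c = refl
  ∧-swap true  false c = refl
  ∧-swap false true  c = refl
  ∧-swap false false c = refl

  ∨-swap : ∀ a b c → a ∨ (b ∨ c) ≡ b ∨ (a ∨ c)
  ∨-swap true  true  c = refl
  ∨-swap true  false c = refl
  ∨-swap false true  c = refl
  ∨-swap false false c = refl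

  all-insert : (p : A → Bool) (xs : List A) (y : A) (ys : List A) →
    all p (xs ++ y ∷ ys) ≡ p y ∧ all p (xs ++ ys)
  all-insert p []       y ys = refl
  all-insert p (x ∷ xs) y ys = trans (cong (p x ∧_) (all-insert p xs y ys)) (∧-swap (p x) (p y) _)

  any-insert : (p : A → Bool) (xs : List A) (y : A) (ys : List A) →
    any p (xs ++ y ∷ ys) ≡ p y ∨ any p (xs ++ ys)
  any-insert p []       y ys = refl
  any-insert p (x ∷ xs) y ys = trans (cong (p x ∨_) (any-insert p xs y ys)) (∨-swap (p x) (p y) _)

  pairwise-insert : {r : A → A → Bool} → (∀ x y → r x y ≡ r y x) → (xs : List A) (y : A) (ys : List A) →
    pairwiseᵇ r (xs ++ y ∷ ys) ≡ all (r y) (xs ++ ys) ∧ pairwiseᵇ r (xs ++ ys)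
  pairwise-insert r-sym []       y ys = refl
  pairwise-insert {r = r} r-sym (x ∷ xs) y ys = begin
    all (r x) (xs ++ y ∷ ys) ∧ pairwiseᵇ r (xs ++ y ∷ ys)
      ≡⟨ cong₂ _∧_ (trans (all-insert (r x) xs y ys) (cong (_∧ all (r x) (xs ++ ys)) (r-sym x y)))
                   (pairwise-insert r-sym xs y ys) ⟩
    (r y x ∧ all (r x) (xs ++ ys)) ∧ (all (r y) (xs ++ ys) ∧ pairwiseᵇ r (xs ++ ys))
      ≡⟨ ∧-interchange (r y x) _ _ _ ⟩
    (r y x ∧ all (r y) (xs ++ ys)) ∧ (all (r x) (xs ++ ys) ∧ pairwiseᵇ r (xs ++ ys)) ∎
    where open ≡-Reasoning

  pairwise-map : (r : B → B → Bool) (f : A → B) (xs : List A) →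
    pairwiseᵇ r (map f xs) ≡ pairwiseᵇ (λ x y → r (f x) (f y)) xs
  pairwise-map r f []       = refl
  pairwise-map r f (x ∷ xs) = cong₂ _∧_ (all-map (r (f x)) f xs) (pairwise-map r f xs)

  pairwise-cong : {r s : A → A → Bool} → (∀ x y → r x y ≡ s x y) → (xs : List A) →
    pairwiseᵇ r xs ≡ pairwiseᵇ s xs
  pairwise-cong r≡s []       = refl
  pairwise-cong r≡s (x ∷ xs) = cong₂ _∧_ (all-cong (r≡s x) xs) (pairwise-cong r≡s xs)

  tabulate-suc : ∀ n → tabulate {A = Fin (suc n)} suc ≡ map suc (allFin n)
  tabulate-suc n = sym (map-tabulate id suc)

  all-allFin : (p : Fin (suc n) → Bool) → all p (allFin (suc n)) ≡ p zero ∧ all (p ∘ suc) (allFin n)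
  all-allFin {n} p = cong (p zero ∧_) (trans (cong (all p) (tabulate-suc n)) (all-map p suc (allFin n)))

  any-allFin : (p : Fin (suc n) → Bool) → any p (allFin (suc n)) ≡ p zero ∨ any (p ∘ suc) (allFin n)
  any-allFin {n} p = cong (p zero ∨_) (trans (cong (any p) (tabulate-suc n)) (any-map p suc (allFin n)))

  nonempty-∷ : ∀ b (X : Subset n) → nonemptyᵇ (b ∷ X) ≡ b ∨ nonemptyᵇ X
  nonempty-∷ b X = any-allFin (λ i → i ∈ᵇ (b ∷ X))

  disjoint-∷ : ∀ b c (X Y : Subset n) → disjointᵇ (b ∷ X) (c ∷ Y) ≡ not (b ∧ c) ∧ disjointᵇ X Y
  disjoint-∷ b c X Y = all-allFin (λ i → not (i ∈ᵇ (b ∷ X) ∧ i ∈ᵇ (c ∷ Y)))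

  disjoint-sym : (X Y : Subset n) → disjointᵇ X Y ≡ disjointᵇ Y X
  disjoint-sym {n} X Y = all-cong (λ i → cong not (∧-comm (i ∈ᵇ X) (i ∈ᵇ Y))) (allFin n)

  nonempty∧disjoint-self : (X : Subset n) → nonemptyᵇ X ∧ disjointᵇ X X ≡ false
  nonempty∧disjoint-self []      = refl
  nonempty∧disjoint-self (b ∷ X) rewrite nonempty-∷ b X | disjoint-∷ b b X X with b
  ... | true  = refl
  ... | false = nonempty∧disjoint-self X

  coverᵇ : List (Subset n) → Bool
  coverᵇ {n} P = all (λ i → any (λ X → i ∈ᵇ X) P) (allFin n)

  isPartition-insert : ∀ p (X : Subset n) q → isPartitionᵇ (p ++ X ∷ q) ≡ isPartitionᵇ (X ∷ p ++ q)
  isPartition-insert {n} p X q = cong₂ _∧_ (all-insert nonemptyᵇ p X q)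
    (cong₂ _∧_ (pairwise-insert disjoint-sym p X q)
               (all-cong (λ i → any-insert (λ Y → i ∈ᵇ Y) p X q) (allFin n)))

  -- A nonempty block is not disjoint from itself. This provides the vanishing hypothesis of
  -- `∑-sublists-picks`.
  isPartition-repeat : ∀ p (X : Subset n) q → isPartitionᵇ (X ∷ p ++ X ∷ q) ≡ false
  isPartition-repeat p X q rewrite all-insert (disjointᵇ X) p X q =
    absorb (nonemptyᵇ X) (disjointᵇ X X) (all nonemptyᵇ (p ++ X ∷ q)) (all (disjointᵇ X) (p ++ q))
      (pairwiseᵇ disjointᵇ (p ++ X ∷ q)) (coverᵇ (X ∷ p ++ X ∷ q)) (nonempty∧disjoint-self X)
    where
    absorb : ∀ a d x y z w → a ∧ d ≡ false → (a ∧ x) ∧ ((d ∧ y) ∧ z) ∧ w ≡ false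
    absorb false d     x y z w eq = refl
    absorb true  false x y z w eq = ∧-zeroʳ x

  -- The block of the new element stands first, as in `allSubsets`, where `true` precedes `false`.
  -- So blocks are listed by increasing minimum.
  extend : Subset n → List (Subset n) → List (Subset (suc n))
  extend X P = (true ∷ X) ∷ map (false ∷_) P

  isPartition-extend : ∀ (X : Subset n) P → isPartitionᵇ (extend X P)
    ≡ all nonemptyᵇ P ∧ (all (disjointᵇ X) P ∧ pairwiseᵇ disjointᵇ P) ∧ coverᵇ (X ∷ P)
  isPartition-extend {n} X P = cong₂ _∧_
    (trans (all-map nonemptyᵇ (false ∷_) P) (all-cong (nonempty-∷ false) P))
    (cong₂ _∧_
      (cong₂ _∧_
        (trans (all-map (disjointᵇ (true ∷ X)) (false ∷_) P) (all-cong (disjoint-∷ true false X) P))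
        (trans (pairwise-map disjointᵇ (false ∷_) P) (pairwise-cong (disjoint-∷ false false) P)))
      (trans (all-allFin (λ i → any (λ Y → i ∈ᵇ Y) (extend X P)))
             (all-cong (λ i → cong (i ∈ᵇ X ∨_) (any-map (λ Y → suc i ∈ᵇ Y) (false ∷_) P)) (allFin n))))

  ∅ : Subset n
  ∅ = replicate _ false

  disjoint-∅ : (X : Subset n) → disjointᵇ ∅ X ≡ true
  disjoint-∅ {n} X =
    trans (all-cong (λ i → cong (λ b → not (b ∧ i ∈ᵇ X)) (lookup-replicate i false)) (allFin n)) (all-true (allFin n))

  isPartition-extend-∅ : (P : List (Subset n)) → isPartitionᵇ (extend ∅ P) ≡ isPartitionᵇ P
  isPartition-extend-∅ {n} P = trans (isPartition-extend ∅ P) (cong (all nonemptyᵇ P ∧_) (cong₂ _∧_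
    (cong (_∧ pairwiseᵇ disjointᵇ P) (trans (all-cong disjoint-∅ P) (all-true P)))
    (all-cong (λ i → cong (_∨ any (λ X → i ∈ᵇ X) P) (lookup-replicate i false)) (allFin n))))

  isPartition-without-first : (P : List (Subset n)) → isPartitionᵇ (map (false ∷_) P) ≡ false
  isPartition-without-first {n} P =
    trans (cong (λ c → all nonemptyᵇ P′ ∧ (pairwiseᵇ disjointᵇ P′ ∧ c)) uncovered)
          (trans (cong (all nonemptyᵇ P′ ∧_) (∧-zeroʳ _)) (∧-zeroʳ _))
    where
    P′ = map (false ∷_) P
    uncovered : coverᵇ P′ ≡ false
    uncovered = trans (all-allFin (λ i → any (λ X → i ∈ᵇ X) P′))
      (cong (_∧ all (λ i → any (λ X → suc i ∈ᵇ X) P′) (allFin n)) (trans (any-map (λ X → zero ∈ᵇ X) (false ∷_) P) (any-false P)))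

  isPartition-two-firsts : ∀ (X Y : Subset n) P → isPartitionᵇ ((true ∷ X) ∷ (true ∷ Y) ∷ P) ≡ false
  isPartition-two-firsts X Y P rewrite disjoint-∷ true true X Y = ∧-zeroʳ (all nonemptyᵇ ((true ∷ Y) ∷ P))

  ∑-sublists-++ : (xs ys : List A) (h : List A → ℕ) →
    ∑ (sublists (xs ++ ys)) h ≡ ∑ (sublists xs) (λ X → ∑ (sublists ys) (λ Y → h (X ++ Y)))
  ∑-sublists-++ []       ys h = sym (+-identityʳ _)
  ∑-sublists-++ (x ∷ xs) ys h = begin
    ∑ (map (x ∷_) (sublists (xs ++ ys)) ++ sublists (xs ++ ys)) h
      ≡⟨ ∑-++ (map (x ∷_) (sublists (xs ++ ys))) _ h ⟩
    ∑ (map (x ∷_) (sublists (xs ++ ys))) h + ∑ (sublists (xs ++ ys)) h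
      ≡⟨ cong₂ _+_ (trans (∑-map (x ∷_) (sublists (xs ++ ys)) h) (∑-sublists-++ xs ys (h ∘ (x ∷_))))
                   (∑-sublists-++ xs ys h) ⟩
    ∑ (sublists xs) (λ X → ∑ (sublists ys) (λ Y → h (x ∷ X ++ Y)))
      + ∑ (sublists xs) (λ X → ∑ (sublists ys) (λ Y → h (X ++ Y)))
      ≡⟨ cong (_+ _) (sym (∑-map (x ∷_) (sublists xs) _)) ⟩
    ∑ (map (x ∷_) (sublists xs)) (λ X → ∑ (sublists ys) (λ Y → h (X ++ Y)))
      + ∑ (sublists xs) (λ X → ∑ (sublists ys) (λ Y → h (X ++ Y)))
      ≡⟨ sym (∑-++ (map (x ∷_) (sublists xs)) (sublists xs) _) ⟩
    ∑ (sublists (x ∷ xs)) (λ X → ∑ (sublists ys) (λ Y → h (X ++ Y))) ∎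
    where open ≡-Reasoning

  ∑-sublists-∷ : (x : A) (xs : List A) (h : List A → ℕ) →
    ∑ (sublists (x ∷ xs)) h ≡ ∑ (sublists xs) (λ X → h (x ∷ X)) + ∑ (sublists xs) h
  ∑-sublists-∷ x xs h = trans (∑-++ (map (x ∷_) (sublists xs)) (sublists xs) h)
    (cong (_+ ∑ (sublists xs) h) (∑-map (x ∷_) (sublists xs) h))

  ∑-sublists-map : (f : A → B) (xs : List A) (h : List B → ℕ) →
    ∑ (sublists (map f xs)) h ≡ ∑ (sublists xs) (h ∘ map f)
  ∑-sublists-map f []       h = refl
  ∑-sublists-map f (x ∷ xs) h = begin
    ∑ (sublists (f x ∷ map f xs)) h
      ≡⟨ ∑-sublists-∷ (f x) (map f xs) h ⟩
    ∑ (sublists (map f xs)) (h ∘ (f x ∷_)) + ∑ (sublists (map f xs)) h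
      ≡⟨ cong₂ _+_ (∑-sublists-map f xs (h ∘ (f x ∷_))) (∑-sublists-map f xs h) ⟩
    ∑ (sublists xs) (λ X → h (f x ∷ map f X)) + ∑ (sublists xs) (h ∘ map f)
      ≡⟨ sym (∑-sublists-∷ x xs (h ∘ map f)) ⟩
    ∑ (sublists (x ∷ xs)) (h ∘ map f) ∎
    where open ≡-Reasoning

  ∑-sublists-empty : (xs : List A) (h : List A → ℕ) → (∀ y Y → h (y ∷ Y) ≡ 0) → ∑ (sublists xs) h ≡ h []
  ∑-sublists-empty []       h h∷≡0 = +-identityʳ _
  ∑-sublists-empty (x ∷ xs) h h∷≡0 = trans (∑-sublists-∷ x xs h)
    (cong₂ _+_ (∑-zero (sublists xs) (h∷≡0 x)) (∑-sublists-empty xs h h∷≡0))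

  ∑-sublists-singleton : (xs : List A) (h : List A → ℕ) → h [] ≡ 0 → (∀ x y Y → h (x ∷ y ∷ Y) ≡ 0) →
    ∑ (sublists xs) h ≡ ∑ xs (λ x → h (x ∷ []))
  ∑-sublists-singleton []       h h[]≡0 h∷∷≡0 = cong (_+ 0) h[]≡0
  ∑-sublists-singleton (x ∷ xs) h h[]≡0 h∷∷≡0 = trans (∑-sublists-∷ x xs h)
    (cong₂ _+_ (∑-sublists-empty xs (h ∘ (x ∷_)) (h∷∷≡0 x)) (∑-sublists-singleton xs h h[]≡0 h∷∷≡0))

  -- Choosing an element and a set without it amounts to choosing a set and marking one of its
  -- elements. The hypothesis removes the sets that already contain the chosen element.
  ∑-sublists-picks : (xs : List A) (g : A → List A → ℕ) → (∀ p x q → g x (p ++ x ∷ q) ≡ 0) →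
    ∑ xs (λ x → ∑ (sublists xs) (g x)) ≡ ∑ (sublists xs) (λ P → ∑picks P (λ p x q → g x (p ++ q)))
  ∑-sublists-picks []       g g≡0 = refl
  ∑-sublists-picks (x ∷ xs) g g≡0 = begin
    ∑ (sublists (x ∷ xs)) (g x) + ∑ xs (λ y → ∑ (sublists (x ∷ xs)) (g y))
      ≡⟨ cong₂ _+_
           (trans (∑-sublists-∷ x xs (g x)) (cong (_+ ∑ S (g x)) (∑-zero S (λ Y → g≡0 [] x Y))))
           (trans (∑-cong xs (λ y → ∑-sublists-∷ x xs (g y))) (∑-+ xs _ _)) ⟩
    ∑ S (g x) + (∑ xs (λ y → ∑ S (λ Y → g y (x ∷ Y))) + ∑ xs (λ y → ∑ S (g y)))
      ≡⟨ cong (∑ S (g x) +_) (cong₂ _+_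
           (∑-sublists-picks xs (λ y Y → g y (x ∷ Y)) (λ p y q → g≡0 (x ∷ p) y q))
           (∑-sublists-picks xs g g≡0)) ⟩
    ∑ S (g x) + (∑ S (λ P → ∑picks P (λ p y q → g y (x ∷ p ++ q))) + ∑ S (λ P → ∑picks P (λ p y q → g y (p ++ q))))
      ≡⟨ sym (+-assoc (∑ S (g x)) _ _) ⟩
    ∑ S (g x) + ∑ S (λ P → ∑picks P (λ p y q → g y (x ∷ p ++ q))) + ∑ S (λ P → ∑picks P (λ p y q → g y (p ++ q)))
      ≡⟨ cong (_+ _) (sym (∑-+ S (g x) _)) ⟩
    ∑ S (λ P → ∑picks (x ∷ P) (λ p y q → g y (p ++ q))) + ∑ S (λ P → ∑picks P (λ p y q → g y (p ++ q)))
      ≡⟨ sym (∑-sublists-∷ x xs _) ⟩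
    ∑ (sublists (x ∷ xs)) (λ P → ∑picks P (λ p y q → g y (p ++ q))) ∎
    where
    open ≡-Reasoning
    S = sublists xs

  allSubsets-suc : ∀ n → allSubsets (suc n) ≡ map (true ∷_) (allSubsets n) ++ map (false ∷_) (allSubsets n)
  allSubsets-suc n = cong (map (true ∷_) (allSubsets n) ++_) (++-identityʳ _)

  ∑-empty-subsets : ∀ n (k : Subset n → ℕ) → ∑ (allSubsets n) (λ X → when (not (nonemptyᵇ X)) (k X)) ≡ k ∅
  ∑-empty-subsets zero    k = +-identityʳ _
  ∑-empty-subsets (suc n) k = begin
    ∑ (allSubsets (suc n)) K
      ≡⟨ cong (λ xs → ∑ xs K) (allSubsets-suc n) ⟩
    ∑ (map (true ∷_) (allSubsets n) ++ map (false ∷_) (allSubsets n)) K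
      ≡⟨ ∑-++ (map (true ∷_) (allSubsets n)) _ K ⟩
    ∑ (map (true ∷_) (allSubsets n)) K + ∑ (map (false ∷_) (allSubsets n)) K
      ≡⟨ cong₂ _+_ (trans (∑-map (true ∷_) (allSubsets n) K) (∑-zero (allSubsets n) (λ _ → refl)))
           (trans (∑-map (false ∷_) (allSubsets n) K)
                  (∑-cong (allSubsets n) (λ X → cong (λ b → when (not b) (k (false ∷ X))) (nonempty-∷ false X)))) ⟩
    ∑ (allSubsets n) (λ X → when (not (nonemptyᵇ X)) (k (false ∷ X)))
      ≡⟨ ∑-empty-subsets n (k ∘ (false ∷_)) ⟩
    k ∅ ∎
    where
    open ≡-Reasoning
    K : Subset (suc n) → ℕ
    K X = when (not (nonemptyᵇ X)) (k X)

  when-false : ∀ {b m} → b ≡ false → when b m ≡ 0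
  when-false refl = refl

  ∑-when : ∀ b (xs : List A) (h : A → ℕ) → ∑ xs (λ x → when b (h x)) ≡ when b (∑ xs h)
  ∑-when true  xs h = refl
  ∑-when false xs h = ∑-zero xs (λ _ → refl)

  ∑picks-when : ∀ b (xs : List A) (g : List A → A → List A → ℕ) →
    ∑picks xs (λ p x q → when b (g p x q)) ≡ when b (∑picks xs g)
  ∑picks-when true  xs g = refl
  ∑picks-when false xs g = ∑picks-zero xs

  -- Exactly one block contains the new element; let X be the rest of it. If X is empty, the other
  -- blocks already partition [n]. Otherwise X and the other blocks do, and X is the marked block.
  ∑-partitions-suc : ∀ n (h : List (Subset (suc n)) → ℕ) →
    ∑ (partitions (suc n)) h
    ≡ ∑ (partitions n) (λ P → h (extend ∅ P) + ∑picks P (λ p X q → h (extend X (p ++ q))))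
  ∑-partitions-suc n h = begin
    ∑ (partitions (suc n)) h
      ≡⟨ ∑-filter isPartitionᵇ (sublists (allSubsets (suc n))) h ⟩
    ∑ (sublists (allSubsets (suc n))) G
      ≡⟨ cong (λ xs → ∑ (sublists xs) G) (allSubsets-suc n) ⟩
    ∑ (sublists (map (true ∷_) S ++ map (false ∷_) S)) G
      ≡⟨ ∑-sublists-++ (map (true ∷_) S) (map (false ∷_) S) G ⟩
    ∑ (sublists (map (true ∷_) S)) (λ X → ∑ (sublists (map (false ∷_) S)) (λ Y → G (X ++ Y)))
      ≡⟨ ∑-sublists-map (true ∷_) S _ ⟩
    ∑ (sublists S) (λ X → ∑ (sublists (map (false ∷_) S)) (λ Y → G (map (true ∷_) X ++ Y)))
      ≡⟨ ∑-cong (sublists S) (λ X → ∑-sublists-map (false ∷_) S (λ Y → G (map (true ∷_) X ++ Y))) ⟩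
    ∑ (sublists S) (λ X → ∑ (sublists S) (λ Y → G (map (true ∷_) X ++ map (false ∷_) Y)))
      ≡⟨ ∑-sublists-singleton S _
           (∑-zero (sublists S) (λ Y → when-false (isPartition-without-first Y)))
           (λ X Y Z → ∑-zero (sublists S) (λ P → when-false (isPartition-two-firsts X Y (map (true ∷_) Z ++ map (false ∷_) P)))) ⟩
    ∑ S (λ X → ∑ (sublists S) (λ Y → G (extend X Y)))
      ≡⟨ ∑-cong S (λ X → trans (∑-cong (sublists S) (λ Y → split X Y)) (∑-+ (sublists S) _ _)) ⟩
    ∑ S (λ X → ∑ (sublists S) (λ Y → when (not (nonemptyᵇ X)) (G (extend X Y))) + ∑ (sublists S) (g X))
      ≡⟨ ∑-+ S _ _ ⟩
    ∑ S (λ X → ∑ (sublists S) (λ Y → when (not (nonemptyᵇ X)) (G (extend X Y)))) + ∑ S (λ X → ∑ (sublists S) (g X))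
      ≡⟨ cong₂ _+_
           (trans (∑-cong S (λ X → ∑-when (not (nonemptyᵇ X)) (sublists S) (λ Y → G (extend X Y))))
                  (∑-empty-subsets n (λ X → ∑ (sublists S) (λ Y → G (extend X Y)))))
           (∑-sublists-picks S g (λ p X q → when-false (isPartition-repeat p X q))) ⟩
    ∑ (sublists S) (λ P → G (extend ∅ P)) + ∑ (sublists S) (λ P → ∑picks P (λ p X q → g X (p ++ q)))
      ≡⟨ sym (∑-+ (sublists S) _ _) ⟩
    ∑ (sublists S) (λ P → G (extend ∅ P) + ∑picks P (λ p X q → g X (p ++ q)))
      ≡⟨ ∑-cong (sublists S) collect ⟩
    ∑ (sublists S) (λ P → when (isPartitionᵇ P) (h (extend ∅ P) + ∑picks P (λ p X q → h (extend X (p ++ q)))))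
      ≡⟨ sym (∑-filter isPartitionᵇ (sublists S) _) ⟩
    ∑ (partitions n) (λ P → h (extend ∅ P) + ∑picks P (λ p X q → h (extend X (p ++ q)))) ∎
    where
    open ≡-Reasoning
    S = allSubsets n
    G : List (Subset (suc n)) → ℕ
    G P = when (isPartitionᵇ P) (h P)
    g : Subset n → List (Subset n) → ℕ
    g X P = when (isPartitionᵇ (X ∷ P)) (h (extend X P))
    -- The two summands separate empty from nonempty `X`: for an empty one, `X ∷ P` is not a
    -- partition and `g X P` is 0.
    split : ∀ X P → G (extend X P) ≡ when (not (nonemptyᵇ X)) (G (extend X P)) + g X P
    split X P with nonemptyᵇ X
    ... | true  = cong (λ b → when b (h (extend X P))) (isPartition-extend X P)
    ... | false = sym (+-identityʳ _)
    collect : ∀ P → G (extend ∅ P) + ∑picks P (λ p X q → g X (p ++ q))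
      ≡ when (isPartitionᵇ P) (h (extend ∅ P) + ∑picks P (λ p X q → h (extend X (p ++ q))))
    collect P = trans (cong₂ _+_
        (cong (λ b → when b (h (extend ∅ P))) (isPartition-extend-∅ P))
        (trans (∑picks-cong P (λ { p X q refl →
                  cong (λ b → when b (h (extend X (p ++ q)))) (sym (isPartition-insert p X q)) }))
               (∑picks-when (isPartitionᵇ P) P _)))
      (sym (when-+ (isPartitionᵇ P) _ _))

-- Arcs of an extended partition, and the count as a number of walks.

module Counting where

  open Reflection using (walks)
  open Words
  open ColoredArcs
  open Partitions
  open import Data.Bool using (Bool; true; false; _∧_; _∨_; not; if_then_else_)
  open import Data.Bool.Properties using (∧-identityʳ; ∧-zeroʳ; ∨-identityʳ; T?)
  open import Data.Bool.ListAction using (all; any)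
  open import Data.Fin using (Fin; zero; suc; toℕ)
  open import Data.Fin.Subset using (Subset)
  open import Data.Nat using (ℕ; zero; suc; _+_)
  open import Data.Nat.Properties using (+-identityʳ)
  open import Data.List using (List; []; _∷_; _++_; map; length; filterᵇ; concatMap; allFin; zip; tabulate)
  open import Data.List.Properties using (map-++; map-∘; filter-++; ++-identityʳ; concatMap-map; map-concatMap; concatMap-cong)
  open import Data.Product using (_×_; _,_)
  open import Data.Vec using (Vec; []; _∷_)
  open import Data.Vec.Properties using (lookup-replicate)
  open import Function using (_∘_)
  open import Relation.Binary.PropositionalEquality using (_≡_; refl; sym; trans; cong; cong₂; _≗_; module ≡-Reasoning)

  private variable
    A B : Set
    n : ℕ

  filterᵇ-map : (p : B → Bool) (f : A → B) (xs : List A) → filterᵇ p (map f xs) ≡ map f (filterᵇ (p ∘ f) xs)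
  filterᵇ-map p f []       = refl
  filterᵇ-map p f (x ∷ xs) with p (f x)
  ... | true  = cong (f x ∷_) (filterᵇ-map p f xs)
  ... | false = filterᵇ-map p f xs

  filterᵇ-cong : {p q : A → Bool} → p ≗ q → (xs : List A) → filterᵇ p xs ≡ filterᵇ q xs
  filterᵇ-cong p≗q [] = refl
  filterᵇ-cong {p = p} {q} p≗q (x ∷ xs) with p x | q x | p≗q x
  ... | true  | true  | refl = cong (x ∷_) (filterᵇ-cong p≗q xs)
  ... | false | false | refl = filterᵇ-cong p≗q xs

  filterᵇ-none : (xs : List A) → filterᵇ (λ _ → false) xs ≡ []
  filterᵇ-none []       = refl
  filterᵇ-none (x ∷ xs) = filterᵇ-none xs

  filterᵇ-concatMap : (p : B → Bool) (f : A → List B) (xs : List A) →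
    filterᵇ p (concatMap f xs) ≡ concatMap (filterᵇ p ∘ f) xs
  filterᵇ-concatMap p f []       = refl
  filterᵇ-concatMap p f (x ∷ xs) =
    trans (filter-++ (T? ∘ p) (f x) (concatMap f xs)) (cong (filterᵇ p (f x) ++_) (filterᵇ-concatMap p f xs))

  forget : Fin n × Fin n → Arcℕ
  forget (i , j) = (toℕ i , toℕ j)

  -- Natural numbers replace `Fin n`, so that arcs of partitions of different sizes can be compared
  -- by `shift`.
  arcs : List (Subset n) → List Arcℕ
  arcs P = map forget (Arc P)

  filter-allPairs-suc : (p : Fin (suc n) × Fin (suc n) → Bool) (p₀ : Fin n → Bool) (p₁ : Fin n × Fin n → Bool) →
    p (zero , zero) ≡ false → (∀ j → p (zero , suc j) ≡ p₀ j) →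
    (∀ i → p (suc i , zero) ≡ false) → (∀ i j → p (suc i , suc j) ≡ p₁ (i , j)) →
    map forget (filterᵇ p (allPairs (suc n)))
    ≡ map (λ j → (0 , suc (toℕ j))) (filterᵇ p₀ (allFin n)) ++ map shift (map forget (filterᵇ p₁ (allPairs n)))
  filter-allPairs-suc {n} p p₀ p₁ p00 p0s ps0 pss = begin
    map forget (filterᵇ p (map (zero ,_) (allFin (suc n)) ++ lower))
      ≡⟨ cong (map forget) (filter-++ (T? ∘ p) (map (zero ,_) (allFin (suc n))) lower) ⟩
    map forget (filterᵇ p (map (zero ,_) (allFin (suc n))) ++ filterᵇ p lower)
      ≡⟨ map-++ forget (filterᵇ p (map (zero ,_) (allFin (suc n)))) (filterᵇ p lower) ⟩
    map forget (filterᵇ p (map (zero ,_) (allFin (suc n)))) ++ map forget (filterᵇ p lower)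
      ≡⟨ cong₂ _++_ top-row (trans (cong (map forget) lower-rows)
           (trans (sym (map-∘ (filterᵇ p₁ (allPairs n)))) (map-∘ (filterᵇ p₁ (allPairs n))))) ⟩
    map (λ j → (0 , suc (toℕ j))) (filterᵇ p₀ (allFin n)) ++ map shift (map forget (filterᵇ p₁ (allPairs n))) ∎
    where
    open ≡-Reasoning
    up : Fin n × Fin n → Fin (suc n) × Fin (suc n)
    up (i , j) = (suc i , suc j)
    lower : List (Fin (suc n) × Fin (suc n))
    lower = concatMap (λ i → map (i ,_) (allFin (suc n))) (tabulate suc)
    row : ∀ i → p (i , zero) ≡ false →
      filterᵇ p (map (i ,_) (allFin (suc n))) ≡ map (λ j → (i , suc j)) (filterᵇ (λ j → p (i , suc j)) (allFin n))
    row i pi0 = begin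
      filterᵇ p ((i , zero) ∷ map (i ,_) (tabulate suc))
        ≡⟨ drop-first pi0 ⟩
      filterᵇ p (map (i ,_) (tabulate suc))
        ≡⟨ cong (λ xs → filterᵇ p (map (i ,_) xs)) (tabulate-suc n) ⟩
      filterᵇ p (map (i ,_) (map suc (allFin n)))
        ≡⟨ cong (filterᵇ p) (sym (map-∘ (allFin n))) ⟩
      filterᵇ p (map (λ j → (i , suc j)) (allFin n))
        ≡⟨ filterᵇ-map p (λ j → (i , suc j)) (allFin n) ⟩
      map (λ j → (i , suc j)) (filterᵇ (λ j → p (i , suc j)) (allFin n)) ∎
      where
      drop-first : ∀ {x xs} → p x ≡ false → filterᵇ p (x ∷ xs) ≡ filterᵇ p xs
      drop-first {x} px with p x
      ... | false = refl
    top-row : map forget (filterᵇ p (map (zero ,_) (allFin (suc n))))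
              ≡ map (λ j → (0 , suc (toℕ j))) (filterᵇ p₀ (allFin n))
    top-row = trans (cong (map forget) (row zero p00))
      (trans (sym (map-∘ (filterᵇ (λ j → p (zero , suc j)) (allFin n))))
             (cong (map (λ j → (0 , suc (toℕ j)))) (filterᵇ-cong p0s (allFin n))))
    lower-row : ∀ i → filterᵇ p (map (suc i ,_) (allFin (suc n))) ≡ map up (filterᵇ p₁ (map (i ,_) (allFin n)))
    lower-row i = begin
      filterᵇ p (map (suc i ,_) (allFin (suc n)))
        ≡⟨ row (suc i) (ps0 i) ⟩
      map (λ j → (suc i , suc j)) (filterᵇ (λ j → p (suc i , suc j)) (allFin n))
        ≡⟨ cong (map (λ j → (suc i , suc j))) (filterᵇ-cong (pss i) (allFin n)) ⟩
      map (λ j → (suc i , suc j)) (filterᵇ (λ j → p₁ (i , j)) (allFin n))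
        ≡⟨ map-∘ (filterᵇ (λ j → p₁ (i , j)) (allFin n)) ⟩
      map up (map (i ,_) (filterᵇ (λ j → p₁ (i , j)) (allFin n)))
        ≡⟨ cong (map up) (sym (filterᵇ-map p₁ (i ,_) (allFin n))) ⟩
      map up (filterᵇ p₁ (map (i ,_) (allFin n))) ∎
    lower-rows : filterᵇ p lower ≡ map up (filterᵇ p₁ (allPairs n))
    lower-rows = begin
      filterᵇ p (concatMap (λ i → map (i ,_) (allFin (suc n))) (tabulate suc))
        ≡⟨ cong (λ xs → filterᵇ p (concatMap (λ i → map (i ,_) (allFin (suc n))) xs)) (tabulate-suc n) ⟩
      filterᵇ p (concatMap (λ i → map (i ,_) (allFin (suc n))) (map suc (allFin n)))
        ≡⟨ cong (filterᵇ p) (concatMap-map (λ i → map (i ,_) (allFin (suc n))) suc (allFin n)) ⟩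
      filterᵇ p (concatMap (λ i → map (suc i ,_) (allFin (suc n))) (allFin n))
        ≡⟨ filterᵇ-concatMap p (λ i → map (suc i ,_) (allFin (suc n))) (allFin n) ⟩
      concatMap (λ i → filterᵇ p (map (suc i ,_) (allFin (suc n)))) (allFin n)
        ≡⟨ concatMap-cong lower-row (allFin n) ⟩
      concatMap (λ i → map up (filterᵇ p₁ (map (i ,_) (allFin n)))) (allFin n)
        ≡⟨ sym (map-concatMap up (λ i → filterᵇ p₁ (map (i ,_) (allFin n))) (allFin n)) ⟩
      map up (concatMap (λ i → filterᵇ p₁ (map (i ,_) (allFin n))) (allFin n))
        ≡⟨ cong (map up) (sym (filterᵇ-concatMap p₁ (λ i → map (i ,_) (allFin n)) (allFin n))) ⟩
      map up (filterᵇ p₁ (allPairs n)) ∎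

  isMinᵇ : Subset n → Fin n → Bool
  isMinᵇ {n} X j = j ∈ᵇ X ∧ all (λ k → not (k ∈ᵇ X ∧ k <ꟳ j)) (allFin n)

  -- Junk value n on the empty subset.
  minimum : Subset n → ℕ
  minimum []          = 0
  minimum (true  ∷ X) = 0
  minimum (false ∷ X) = suc (minimum X)

  isMin-zero : ∀ b (X : Subset n) → isMinᵇ (b ∷ X) zero ≡ b
  isMin-zero {n} b X = begin
    b ∧ all (λ k → not (k ∈ᵇ (b ∷ X) ∧ k <ꟳ zero {n})) (allFin (suc n))
      ≡⟨ cong (b ∧_) (all-cong (λ k → cong not (∧-zeroʳ (k ∈ᵇ (b ∷ X)))) (allFin (suc n))) ⟩
    b ∧ all (λ _ → true) (allFin (suc n))
      ≡⟨ cong (b ∧_) (all-true (allFin (suc n))) ⟩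
    b ∧ true
      ≡⟨ ∧-identityʳ b ⟩
    b ∎
    where open ≡-Reasoning

  isMin-suc-true : ∀ (X : Subset n) j → isMinᵇ (true ∷ X) (suc j) ≡ false
  isMin-suc-true X j = ∧-zeroʳ (j ∈ᵇ X)

  isMin-suc-false : ∀ (X : Subset n) j → isMinᵇ (false ∷ X) (suc j) ≡ isMinᵇ X j
  isMin-suc-false X j = cong (j ∈ᵇ X ∧_) (all-allFin (λ k → not (k ∈ᵇ (false ∷ X) ∧ k <ꟳ suc j)))

  filter-allFin-suc : (p : Fin (suc n) → Bool) →
    let rest = map suc (map toℕ (filterᵇ (p ∘ suc) (allFin n)))
    in map toℕ (filterᵇ p (allFin (suc n))) ≡ (if p zero then 0 ∷ rest else rest)
  filter-allFin-suc {n} p = head-case (p zero) refl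
    where
    open ≡-Reasoning
    rest = map suc (map toℕ (filterᵇ (p ∘ suc) (allFin n)))
    tail : map toℕ (filterᵇ p (tabulate suc)) ≡ rest
    tail = begin
      map toℕ (filterᵇ p (tabulate suc))                 ≡⟨ cong (λ xs → map toℕ (filterᵇ p xs)) (tabulate-suc n) ⟩
      map toℕ (filterᵇ p (map suc (allFin n)))           ≡⟨ cong (map toℕ) (filterᵇ-map p suc (allFin n)) ⟩
      map toℕ (map suc (filterᵇ (p ∘ suc) (allFin n)))   ≡⟨ sym (map-∘ (filterᵇ (p ∘ suc) (allFin n))) ⟩
      map (suc ∘ toℕ) (filterᵇ (p ∘ suc) (allFin n))     ≡⟨ map-∘ (filterᵇ (p ∘ suc) (allFin n)) ⟩
      rest                                               ∎
    head-case : ∀ b → p zero ≡ b → map toℕ (filterᵇ p (zero ∷ tabulate suc)) ≡ (if b then 0 ∷ rest else rest)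
    head-case b eq with p zero
    head-case true  refl | true  = cong (0 ∷_) tail
    head-case false refl | false = tail

  filter-isMin : (X : Subset n) →
    map toℕ (filterᵇ (isMinᵇ X) (allFin n)) ≡ (if nonemptyᵇ X then minimum X ∷ [] else [])
  filter-isMin [] = refl
  filter-isMin {suc n} (true ∷ X) = begin
    map toℕ (filterᵇ (isMinᵇ (true ∷ X)) (allFin (suc n)))
      ≡⟨ filter-allFin-suc (isMinᵇ (true ∷ X)) ⟩
    (if isMinᵇ (true ∷ X) zero then 0 ∷ rest else rest)
      ≡⟨ cong (λ b → if b then 0 ∷ rest else rest) (isMin-zero true X) ⟩
    0 ∷ rest
      ≡⟨ cong (λ xs → 0 ∷ map suc (map toℕ xs))
           (trans (filterᵇ-cong (isMin-suc-true X) (allFin n)) (filterᵇ-none (allFin n))) ⟩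
    0 ∷ [] ∎
    where
    open ≡-Reasoning
    rest = map suc (map toℕ (filterᵇ (isMinᵇ (true ∷ X) ∘ suc) (allFin n)))
  filter-isMin {suc n} (false ∷ X) = begin
    map toℕ (filterᵇ (isMinᵇ (false ∷ X)) (allFin (suc n)))
      ≡⟨ filter-allFin-suc (isMinᵇ (false ∷ X)) ⟩
    map suc (map toℕ (filterᵇ (isMinᵇ (false ∷ X) ∘ suc) (allFin n)))
      ≡⟨ cong (λ xs → map suc (map toℕ xs)) (filterᵇ-cong (isMin-suc-false X) (allFin n)) ⟩
    map suc (map toℕ (filterᵇ (isMinᵇ X) (allFin n)))
      ≡⟨ cong (map suc) (filter-isMin X) ⟩
    map suc (if nonemptyᵇ X then minimum X ∷ [] else [])
      ≡⟨ map-if (nonemptyᵇ X) ⟩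
    (if nonemptyᵇ X then suc (minimum X) ∷ [] else [])
      ≡⟨ cong (λ b → if b then suc (minimum X) ∷ [] else []) (sym (nonempty-∷ false X)) ⟩
    (if nonemptyᵇ (false ∷ X) then suc (minimum X) ∷ [] else []) ∎
    where
    open ≡-Reasoning
    map-if : ∀ c → map suc (if c then minimum X ∷ [] else []) ≡ (if c then suc (minimum X) ∷ [] else [])
    map-if true  = refl
    map-if false = refl

  linksᵇ : Fin n × Fin n → Subset n → Bool
  linksᵇ {n} (i , j) X =
    i ∈ᵇ X ∧ j ∈ᵇ X ∧ i <ꟳ j ∧ all (λ k → not (k ∈ᵇ X ∧ i <ꟳ k ∧ k <ꟳ j)) (allFin n)

  links-suc : ∀ b (X : Subset n) i j → linksᵇ (suc i , suc j) (b ∷ X) ≡ linksᵇ (i , j) X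
  links-suc b X i j = cong (λ c → i ∈ᵇ X ∧ j ∈ᵇ X ∧ i <ꟳ j ∧ c)
    (trans (all-allFin (λ k → not (k ∈ᵇ (b ∷ X) ∧ suc i <ꟳ k ∧ k <ꟳ suc j)))
           (cong (λ c → not c ∧ all (λ k → not (k ∈ᵇ X ∧ i <ꟳ k ∧ k <ꟳ j)) (allFin _)) (∧-zeroʳ b)))

  -- In its block the new element is followed by the minimum of `X`, and being least it lies
  -- strictly between no two others. Pairs starting at zero come first in `allPairs`, so the new arc
  -- heads the list, as in `addFirst`.
  arcs-extend : (X : Subset n) (P : List (Subset n)) → arcs (extend X P)
    ≡ map (λ j → (0 , suc j)) (if nonemptyᵇ X then minimum X ∷ [] else []) ++ map shift (arcs (X ∷ P))
  arcs-extend {n} X P = trans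
    (filter-allPairs-suc (isArcᵇ (extend X P)) (isMinᵇ X) (isArcᵇ (X ∷ P)) not-00 at-0s not-s0 at-ss)
    (cong (_++ map shift (arcs (X ∷ P)))
      (trans (map-∘ (filterᵇ (isMinᵇ X) (allFin n))) (cong (map (λ j → (0 , suc j))) (filter-isMin X))))
    where
    off-zero : ∀ (i : Fin (suc n)) → any (linksᵇ (zero , i)) (map (false ∷_) P) ≡ false
    off-zero i = trans (any-map (linksᵇ (zero , i)) (false ∷_) P) (any-false P)
    not-00 : isArcᵇ (extend X P) (zero , zero) ≡ false
    not-00 = off-zero zero
    at-0s : ∀ j → isArcᵇ (extend X P) (zero , suc j) ≡ isMinᵇ X j
    at-0s j = trans (cong (linksᵇ (zero , suc j) (true ∷ X) ∨_) (off-zero (suc j)))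
      (trans (∨-identityʳ _) (cong (j ∈ᵇ X ∧_)
        (all-allFin (λ k → not (k ∈ᵇ (true ∷ X) ∧ zero {n} <ꟳ k ∧ k <ꟳ suc j)))))
    links-s0 : ∀ i (Y : Subset (suc n)) → linksᵇ (suc i , zero) Y ≡ false
    links-s0 i Y = trans (cong (suc i ∈ᵇ Y ∧_) (∧-zeroʳ (zero ∈ᵇ Y))) (∧-zeroʳ (suc i ∈ᵇ Y))
    not-s0 : ∀ i → isArcᵇ (extend X P) (suc i , zero) ≡ false
    not-s0 i = trans (any-cong (links-s0 i) (extend X P)) (any-false (extend X P))
    at-ss : ∀ i j → isArcᵇ (extend X P) (suc i , suc j) ≡ isArcᵇ (X ∷ P) (i , j)
    at-ss i j = cong₂ _∨_ (links-suc true X i j)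
      (trans (any-map (linksᵇ (suc i , suc j)) (false ∷_) P) (any-cong (λ Y → links-suc false Y i j) P))

  arcs-cong : {P Q : List (Subset n)} → (∀ a → isArcᵇ P a ≡ isArcᵇ Q a) → arcs P ≡ arcs Q
  arcs-cong {n} eq = cong (map forget) (filterᵇ-cong eq (allPairs n))

  nonempty-∅ : ∀ n → nonemptyᵇ (∅ {n}) ≡ false
  nonempty-∅ n = trans (any-cong (λ i → lookup-replicate i false) (allFin n)) (any-false (allFin n))

  arcs-singleton : (P : List (Subset n)) → arcs (extend ∅ P) ≡ map shift (arcs P)
  arcs-singleton {n} P = trans (arcs-extend ∅ P) (cong₂ _++_
    (cong (λ b → map (λ j → (0 , suc j)) (if b then minimum (∅ {n}) ∷ [] else [])) (nonempty-∅ n))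
    (cong (map shift) (arcs-cong {P = ∅ ∷ P} {Q = P} (λ { (i , j) →
      cong (λ b → (b ∧ j ∈ᵇ ∅ ∧ i <ꟳ j ∧ all (λ k → not (k ∈ᵇ ∅ ∧ i <ꟳ k ∧ k <ꟳ j)) (allFin n)) ∨ isArcᵇ P (i , j))
           (lookup-replicate i false) }))))

  arcs-join : ∀ p (X : Subset n) q → nonemptyᵇ X ≡ true →
    arcs (extend X (p ++ q)) ≡ (0 , suc (minimum X)) ∷ map shift (arcs (p ++ X ∷ q))
  arcs-join p X q X≢∅ = trans (arcs-extend X (p ++ q)) (cong₂ _++_
    (cong (λ b → map (λ j → (0 , suc j)) (if b then minimum X ∷ [] else [])) X≢∅)
    (cong (map shift) (arcs-cong {P = X ∷ p ++ q} {Q = p ++ X ∷ q} (λ a → sym (any-insert (linksᵇ a) p X q)))))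

  -- Replaces the sum over colour vectors, whose type depends on `length (Arc P)`, by a recursion on
  -- the list of arcs. Equations between lists of arcs can then be used for rewriting.
  ∑colourings : List A → (List (A × ℕ) → ℕ) → ℕ
  ∑colourings []       H = H []
  ∑colourings (a ∷ as) H = ∑colourings as (λ K → H ((a , 1) ∷ K)) + ∑colourings as (λ K → H ((a , 2) ∷ K))

  ∑colourings-cong : (as : List A) {G H : List (A × ℕ) → ℕ} → G ≗ H → ∑colourings as G ≡ ∑colourings as H
  ∑colourings-cong []       G≗H = G≗H []
  ∑colourings-cong (a ∷ as) G≗H =
    cong₂ _+_ (∑colourings-cong as (λ K → G≗H _)) (∑colourings-cong as (λ K → G≗H _))

  ∑colourings-+ : (as : List A) (G H : List (A × ℕ) → ℕ) →
    ∑colourings as (λ K → G K + H K) ≡ ∑colourings as G + ∑colourings as H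
  ∑colourings-+ []       G H = refl
  ∑colourings-+ (a ∷ as) G H = trans
    (cong₂ _+_ (∑colourings-+ as (λ K → G ((a , 1) ∷ K)) (λ K → H ((a , 1) ∷ K)))
               (∑colourings-+ as (λ K → G ((a , 2) ∷ K)) (λ K → H ((a , 2) ∷ K))))
    (+-interchange (∑colourings as (λ K → G ((a , 1) ∷ K))) _ _ _)

  ∑colourings-zero : (as : List A) → ∑colourings as (λ _ → 0) ≡ 0
  ∑colourings-zero []       = refl
  ∑colourings-zero (a ∷ as) = cong₂ _+_ (∑colourings-zero as) (∑colourings-zero as)

  ∑colourings-∑picks : (as : List A) (xs : List B) (g : List B → B → List B → List (A × ℕ) → ℕ) →
    ∑picks xs (λ p x q → ∑colourings as (g p x q)) ≡ ∑colourings as (λ K → ∑picks xs (λ p x q → g p x q K))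
  ∑colourings-∑picks as []       g = sym (∑colourings-zero as)
  ∑colourings-∑picks as (x ∷ xs) g = trans
    (cong (∑colourings as (g [] x xs) +_) (∑colourings-∑picks as xs (λ p y q → g (x ∷ p) y q)))
    (sym (∑colourings-+ as (g [] x xs) _))

  ∑colourings-shift : (as : List Arcℕ) (H : List ColoredArc → ℕ) →
    ∑colourings (map shift as) H ≡ ∑colourings as (H ∘ map shiftᶜ)
  ∑colourings-shift []       H = refl
  ∑colourings-shift (a ∷ as) H =
    cong₂ _+_ (∑colourings-shift as (λ K → H ((shift a , 1) ∷ K)))
              (∑colourings-shift as (λ K → H ((shift a , 2) ∷ K)))

  forgetᶜ : (Fin n × Fin n) × ℕ → ColoredArc
  forgetᶜ (a , c) = (forget a , c)

  ∑-colour-vectors : (as : List (Fin n × Fin n)) (H : List ColoredArc → ℕ) →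
    ∑ (allVecs (1 ∷ 2 ∷ []) (length as)) (λ φ → H (map forgetᶜ (zip as (vecToList φ))))
    ≡ ∑colourings (map forget as) H
  ∑-colour-vectors []       H = +-identityʳ _
  ∑-colour-vectors (a ∷ as) H = begin
    ∑ (map (1 ∷_) V ++ (map (2 ∷_) V ++ [])) h
      ≡⟨ cong (λ xs → ∑ (map (1 ∷_) V ++ xs) h) (++-identityʳ (map (2 ∷_) V)) ⟩
    ∑ (map (1 ∷_) V ++ map (2 ∷_) V) h
      ≡⟨ ∑-++ (map (1 ∷_) V) (map (2 ∷_) V) h ⟩
    ∑ (map (1 ∷_) V) h + ∑ (map (2 ∷_) V) h
      ≡⟨ cong₂ _+_ (trans (∑-map (1 ∷_) V h) (∑-colour-vectors as (λ K → H ((forget a , 1) ∷ K))))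
                   (trans (∑-map (2 ∷_) V h) (∑-colour-vectors as (λ K → H ((forget a , 2) ∷ K)))) ⟩
    ∑colourings (forget a ∷ map forget as) H ∎
    where
    open ≡-Reasoning
    V = allVecs (1 ∷ 2 ∷ []) (length as)
    h : Vec ℕ (suc (length as)) → ℕ
    h φ = H (map forgetᶜ (zip (a ∷ as) (vecToList φ)))

  crLessThan2≡noncrossing : (Λ : TwoColoredPartition n) →
    crLessThan2ᵇ Λ ≡ noncrossing (map forgetᶜ (coloredArcs Λ))
  crLessThan2≡noncrossing Λ = sym (trans (all-map _ forgetᶜ (coloredArcs Λ))
    (all-cong (λ a → all-map (compatible (forgetᶜ a)) forgetᶜ (coloredArcs Λ)) (coloredArcs Λ)))

  C≡∑ : ∀ n → C n ≡ ∑ (partitions n) (λ P → ∑colourings (arcs P) (λ K → when (noncrossing K) 1))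
  C≡∑ n = begin
    C n
      ≡⟨ length-filter crLessThan2ᵇ (twoColoredPartitions n) ⟩
    ∑ (twoColoredPartitions n) valid
      ≡⟨ ∑-concatMap (λ P → map (P ,_) (allVecs (1 ∷ 2 ∷ []) (length (Arc P)))) (partitions n) valid ⟩
    ∑ (partitions n) (λ P → ∑ (map (P ,_) (allVecs (1 ∷ 2 ∷ []) (length (Arc P)))) valid)
      ≡⟨ ∑-cong (partitions n) (λ P →
           trans (∑-map (P ,_) (allVecs (1 ∷ 2 ∷ []) (length (Arc P))) valid)
          (trans (∑-cong (allVecs (1 ∷ 2 ∷ []) (length (Arc P)))
                    (λ φ → cong (λ b → when b 1) (crLessThan2≡noncrossing (P , φ))))
                 (∑-colour-vectors (Arc P) (λ K → when (noncrossing K) 1)))) ⟩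
    ∑ (partitions n) (λ P → ∑colourings (arcs P) (λ K → when (noncrossing K) 1)) ∎
    where
    open ≡-Reasoning
    valid : TwoColoredPartition n → ℕ
    valid Λ = when (crLessThan2ᵇ Λ) 1

  minima : List (Subset n) → List ℕ
  minima = map minimum

  ∑-partitions≡build : ∀ n (H : Weight) →
    ∑ (partitions n) (λ P → ∑colourings (arcs P) (λ K → H K (minima P))) ≡ build n H
  ∑-partitions≡build zero    H = +-identityʳ _
  ∑-partitions≡build (suc n) H = begin
    ∑ (partitions (suc n)) h
      ≡⟨ ∑-partitions-suc n h ⟩
    ∑ (partitions n) (λ P → h (extend ∅ P) + ∑picks P (λ p X q → h (extend X (p ++ q))))
      -- The filter is opened into a factor so that `child` can use that `P` is a partition:
      -- `arcs-join` needs its blocks to be nonempty.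
      ≡⟨ ∑-filter isPartitionᵇ (sublists (allSubsets n)) _ ⟩
    ∑ (sublists (allSubsets n)) (λ P → when (isPartitionᵇ P) (h (extend ∅ P) + ∑picks P (λ p X q → h (extend X (p ++ q)))))
      ≡⟨ ∑-cong (sublists (allSubsets n)) child ⟩
    ∑ (sublists (allSubsets n)) (λ P → when (isPartitionᵇ P) (∑colourings (arcs P) (λ K → addFirst H K (minima P))))
      ≡⟨ sym (∑-filter isPartitionᵇ (sublists (allSubsets n)) _) ⟩
    ∑ (partitions n) (λ P → ∑colourings (arcs P) (λ K → addFirst H K (minima P)))
      ≡⟨ ∑-partitions≡build n (addFirst H) ⟩
    build n (addFirst H) ∎
    where
    open ≡-Reasoning
    h : List (Subset (suc n)) → ℕ
    h P = ∑colourings (arcs P) (λ K → H K (minima P))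
    minima-extend : ∀ X P → minima (extend {n} X P) ≡ 0 ∷ map suc (minima P)
    minima-extend X P = cong (0 ∷_) (trans (sym (map-∘ P)) (map-∘ P))
    singleton : ∀ P → h (extend ∅ P) ≡ ∑colourings (arcs P) (λ K → H (map shiftᶜ K) (0 ∷ map suc (minima P)))
    singleton P rewrite arcs-singleton P | minima-extend ∅ P = ∑colourings-shift (arcs P) _
    joinWeight : List ℕ → ℕ → List ℕ → List ColoredArc → ℕ
    joinWeight p j q K = H (((0 , suc j) , 1) ∷ map shiftᶜ K) (0 ∷ map suc (p ++ q))
                       + H (((0 , suc j) , 2) ∷ map shiftᶜ K) (0 ∷ map suc (p ++ q))
    join : ∀ p X q → nonemptyᵇ X ≡ true →
      h (extend X (p ++ q)) ≡ ∑colourings (arcs (p ++ X ∷ q)) (joinWeight (minima p) (minimum X) (minima q))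
    join p X q X≢∅
      rewrite arcs-join p X q X≢∅ | minima-extend X (p ++ q) | map-++ minimum p q =
      trans (cong₂ _+_ (∑colourings-shift (arcs (p ++ X ∷ q)) _) (∑colourings-shift (arcs (p ++ X ∷ q)) _))
            (sym (∑colourings-+ (arcs (p ++ X ∷ q)) _ _))
    block-nonempty : ∀ p X q → isPartitionᵇ {n} (p ++ X ∷ q) ≡ true → nonemptyᵇ X ≡ true
    block-nonempty p X q eq with nonemptyᵇ X | trans (sym (isPartition-insert p X q)) eq
    ... | true | _ = refl
    child : ∀ P → when (isPartitionᵇ P) (h (extend ∅ P) + ∑picks P (λ p X q → h (extend X (p ++ q))))
      ≡ when (isPartitionᵇ P) (∑colourings (arcs P) (λ K → addFirst H K (minima P)))
    child P with isPartitionᵇ P in isP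
    ... | false = refl
    ... | true  = begin
      h (extend ∅ P) + ∑picks P (λ p X q → h (extend X (p ++ q)))
        ≡⟨ cong₂ _+_ (singleton P) (∑picks-cong P (λ { p X q refl → join p X q (block-nonempty p X q isP) })) ⟩
      ∑colourings (arcs P) (λ K → H (map shiftᶜ K) (0 ∷ map suc (minima P)))
        + ∑picks P (λ p X q → ∑colourings (arcs P) (joinWeight (minima p) (minimum X) (minima q)))
        ≡⟨ cong (∑colourings (arcs P) (λ K → H (map shiftᶜ K) (0 ∷ map suc (minima P))) +_)
             (∑colourings-∑picks (arcs P) P (λ p X q → joinWeight (minima p) (minimum X) (minima q))) ⟩
      ∑colourings (arcs P) (λ K → H (map shiftᶜ K) (0 ∷ map suc (minima P)))
        + ∑colourings (arcs P) (λ K → ∑picks P (λ p X q → joinWeight (minima p) (minimum X) (minima q) K))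
        ≡⟨ sym (∑colourings-+ (arcs P) _ _) ⟩
      ∑colourings (arcs P) (λ K → H (map shiftᶜ K) (0 ∷ map suc (minima P))
        + ∑picks P (λ p X q → joinWeight (minima p) (minimum X) (minima q) K))
        ≡⟨ ∑colourings-cong (arcs P) (λ K → cong (H (map shiftᶜ K) (0 ∷ map suc (minima P)) +_)
             (sym (∑picks-map minimum P (λ p j q → joinWeight p j q K)))) ⟩
      ∑colourings (arcs P) (λ K → addFirst H K (minima P)) ∎

  C-suc≡walks : ∀ m → C (suc m) ≡ walks m 0 0
  C-suc≡walks m = begin
    C (suc m)                                           ≡⟨ C≡∑ (suc m) ⟩
    ∑ (partitions (suc m)) (λ P → ∑colourings (arcs P) (λ K → when (noncrossing K) 1))
                                                        ≡⟨ ∑-partitions≡build (suc m) (λ K _ → when (noncrossing K) 1) ⟩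
    build (suc m) (λ K _ → when (noncrossing K) 1)      ≡⟨ build-noncrossing (suc m) ⟩
    extensions (suc m) []                               ≡⟨ extensions-suc m ⟩
    walks m 0 0                                         ∎
    where open ≡-Reasoning

-- From the recurrence to a differential equation and D-finiteness.

module DFiniteness where

  open import Data.Nat using (ℕ; zero; suc)
  open import Data.Integer as ℤ using (ℤ)
  import Data.Integer.Properties as ℤP
  open import Data.Rational using (ℚ; 0ℚ; 1ℚ; _+_; _-_; _*_; -_; _/_; toℚᵘ)
  import Data.Rational.Properties as ℚP
  open import Data.Rational.Unnormalised as ℚᵘ using (mkℚᵘ; *≡*)
  import Data.Rational.Unnormalised.Properties as ℚᵘP
  open import Data.List using ([]; _∷_; map)
  open import Data.List.Relation.Unary.Any using (here; there)
  open import Data.Product using (_,_; Σ-syntax)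
  open import Data.Vec as Vec using (Vec; []; _∷_)
  open import Level using (0ℓ)
  open import Relation.Nullary using (yes; no)
  open import Relation.Nullary.Decidable using (dec⇒maybe)
  open import Relation.Binary.PropositionalEquality using (_≡_; refl; sym; trans; cong; cong₂; _≗_; module ≡-Reasoning)
  open import Tactic.RingSolver using (solve-∀)
  open import Tactic.RingSolver.Core.AlmostCommutativeRing using (AlmostCommutativeRing; fromCommutativeRing)

  ℚ-ring : AlmostCommutativeRing 0ℓ 0ℓ
  ℚ-ring = fromCommutativeRing ℚP.+-*-commutativeRing (λ x → dec⇒maybe (0ℚ ℚP.≟ x))

  fromℤ : ℤ → ℚ
  fromℤ i = i / 1

  -- Arithmetic in `ℚ` normalises by a gcd, which is stuck on open terms; the homomorphism laws
  -- below are therefore proved in the unnormalised rationals.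
  toℚᵘ-fromℤ : ∀ i → toℚᵘ (fromℤ i) ℚᵘ.≃ mkℚᵘ i 0
  toℚᵘ-fromℤ i = ℚP.toℚᵘ-fromℚᵘ (mkℚᵘ i 0)

  fromℤ-+ : ∀ i j → fromℤ (i ℤ.+ j) ≡ fromℤ i + fromℤ j
  fromℤ-+ i j = ℚP.toℚᵘ-injective (ℚᵘP.≃-trans (toℚᵘ-fromℤ (i ℤ.+ j)) (ℚᵘP.≃-trans
    (*≡* (cong (ℤ._* ℤ.+ 1) (cong₂ ℤ._+_ (sym (ℤP.*-identityʳ i)) (sym (ℤP.*-identityʳ j)))))
    (ℚᵘP.≃-sym (ℚᵘP.≃-trans (ℚP.toℚᵘ-homo-+ (fromℤ i) (fromℤ j))
      (ℚᵘP.+-cong (toℚᵘ-fromℤ i) (toℚᵘ-fromℤ j))))))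

  fromℤ-* : ∀ i j → fromℤ (i ℤ.* j) ≡ fromℤ i * fromℤ j
  fromℤ-* i j = ℚP.toℚᵘ-injective (ℚᵘP.≃-trans (toℚᵘ-fromℤ (i ℤ.* j))
    (ℚᵘP.≃-sym (ℚᵘP.≃-trans (ℚP.toℚᵘ-homo-* (fromℤ i) (fromℤ j))
      (ℚᵘP.*-cong (toℚᵘ-fromℤ i) (toℚᵘ-fromℤ j)))))

  fromℕ-suc : ∀ m → fromℕℚ (suc m) ≡ 1ℚ + fromℕℚ m
  fromℕ-suc m = fromℤ-+ (ℤ.+ 1) (ℤ.+ m)

  X : PowerSeries → PowerSeries
  X f zero    = 0ℚ
  X f (suc m) = f m

  _⊞_ : PowerSeries → PowerSeries → PowerSeries
  (f ⊞ g) m = f m + g m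

  _·_ : ℚ → PowerSeries → PowerSeries
  (c · f) m = c * f m

  X-cong : ∀ {f g} → f ≗ g → X f ≗ X g
  X-cong f≗g zero    = refl
  X-cong f≗g (suc m) = f≗g m

  deriv-cong : ∀ {f g} → f ≗ g → deriv f ≗ deriv g
  deriv-cong f≗g m = cong (fromℕℚ (suc m) *_) (f≗g (suc m))

  ⋆-horner : ∀ c p f → ((c ∷ p) ⋆ f) ≗ ((c · f) ⊞ X (p ⋆ f))
  ⋆-horner c p f zero    = sym (ℚP.+-identityʳ _)
  ⋆-horner c p f (suc m) = refl

  ⋆-cong : ∀ p {f g} → f ≗ g → (p ⋆ f) ≗ (p ⋆ g)
  ⋆-cong []      f≗g m       = refl
  ⋆-cong (c ∷ p) f≗g zero    = cong (c *_) (f≗g 0)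
  ⋆-cong (c ∷ p) f≗g (suc m) = cong₂ _+_ (cong (c *_) (f≗g (suc m))) (⋆-cong p f≗g m)

  ⋆-⊞ : ∀ p f g → (p ⋆ (f ⊞ g)) ≗ ((p ⋆ f) ⊞ (p ⋆ g))
  ⋆-⊞ []      f g m       = refl
  ⋆-⊞ (c ∷ p) f g zero    = ℚP.*-distribˡ-+ c (f 0) (g 0)
  ⋆-⊞ (c ∷ p) f g (suc m) =
    trans (cong ((c * (f (suc m) + g (suc m))) +_) (⋆-⊞ p f g m)) (regroup c (f (suc m)) (g (suc m)) _ _)
    where
    regroup : ∀ c u v s t → c * (u + v) + (s + t) ≡ (c * u + s) + (c * v + t)
    regroup = solve-∀ ℚ-ring

  ⋆-· : ∀ p k f → (p ⋆ (k · f)) ≗ (k · (p ⋆ f))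
  ⋆-· []      k f m       = sym (ℚP.*-zeroʳ k)
  ⋆-· (c ∷ p) k f zero    = swap c k (f 0)
    where
    swap : ∀ c k u → c * (k * u) ≡ k * (c * u)
    swap = solve-∀ ℚ-ring
  ⋆-· (c ∷ p) k f (suc m) =
    trans (cong ((c * (k * f (suc m))) +_) (⋆-· p k f m)) (regroup c k (f (suc m)) _)
    where
    regroup : ∀ c k u s → c * (k * u) + k * s ≡ k * (c * u + s)
    regroup = solve-∀ ℚ-ring

  ⋆-X : ∀ p f → (p ⋆ X f) ≗ X (p ⋆ f)
  ⋆-X []      f zero    = refl
  ⋆-X []      f (suc m) = refl
  ⋆-X (c ∷ p) f zero    = ℚP.*-zeroʳ c
  ⋆-X (c ∷ p) f (suc m) = trans (cong ((c * f m) +_) (⋆-X p f m)) (sym (⋆-horner c p f m))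

  ⋆-comm : ∀ p q f → (p ⋆ (q ⋆ f)) ≗ (q ⋆ (p ⋆ f))
  ⋆-comm p []      f m = vanish p m
    where
    vanish : ∀ p m → (p ⋆ (λ _ → 0ℚ)) m ≡ 0ℚ
    vanish []      m       = refl
    vanish (c ∷ p) zero    = ℚP.*-zeroʳ c
    vanish (c ∷ p) (suc m) = trans (cong₂ _+_ (ℚP.*-zeroʳ c) (vanish p m)) refl
  ⋆-comm p (c ∷ q) f m = begin
    (p ⋆ ((c ∷ q) ⋆ f)) m                            ≡⟨ ⋆-cong p (⋆-horner c q f) m ⟩
    (p ⋆ ((c · f) ⊞ X (q ⋆ f))) m                    ≡⟨ ⋆-⊞ p (c · f) (X (q ⋆ f)) m ⟩
    (p ⋆ (c · f)) m + (p ⋆ X (q ⋆ f)) m              ≡⟨ cong₂ _+_ (⋆-· p c f m)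
                                                          (trans (⋆-X p (q ⋆ f) m) (X-cong (⋆-comm p q f) m)) ⟩
    c * (p ⋆ f) m + X (q ⋆ (p ⋆ f)) m                ≡⟨ sym (⋆-horner c q (p ⋆ f) m) ⟩
    ((c ∷ q) ⋆ (p ⋆ f)) m                            ∎
    where open ≡-Reasoning

  _⊕_ : Poly → Poly → Poly
  []      ⊕ q       = q
  (c ∷ p) ⊕ []      = c ∷ p
  (c ∷ p) ⊕ (d ∷ q) = (c + d) ∷ (p ⊕ q)

  ⊕-⋆ : ∀ p q f → ((p ⊕ q) ⋆ f) ≗ ((p ⋆ f) ⊞ (q ⋆ f))
  ⊕-⋆ []      q       f m       = sym (ℚP.+-identityˡ _)
  ⊕-⋆ (c ∷ p) []      f m       = sym (ℚP.+-identityʳ _)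
  ⊕-⋆ (c ∷ p) (d ∷ q) f zero    = ℚP.*-distribʳ-+ (f 0) c d
  ⊕-⋆ (c ∷ p) (d ∷ q) f (suc m) =
    trans (cong (((c + d) * f (suc m)) +_) (⊕-⋆ p q f m)) (regroup c d (f (suc m)) _ _)
    where
    regroup : ∀ c d u s t → (c + d) * u + (s + t) ≡ (c * u + s) + (d * u + t)
    regroup = solve-∀ ℚ-ring

  scale : ℚ → Poly → Poly
  scale k = map (k *_)

  scale-⋆ : ∀ k p f → (scale k p ⋆ f) ≗ (k · (p ⋆ f))
  scale-⋆ k []      f m       = sym (ℚP.*-zeroʳ k)
  scale-⋆ k (c ∷ p) f zero    = ℚP.*-assoc k c (f 0)
  scale-⋆ k (c ∷ p) f (suc m) = trans (cong ((k * c * f (suc m)) +_) (scale-⋆ k p f m)) (regroup k c (f (suc m)) _)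
    where
    regroup : ∀ k c u s → k * c * u + k * s ≡ k * (c * u + s)
    regroup = solve-∀ ℚ-ring

  x∷-⋆ : ∀ p f → ((0ℚ ∷ p) ⋆ f) ≗ X (p ⋆ f)
  x∷-⋆ p f zero    = ℚP.*-zeroˡ (f 0)
  x∷-⋆ p f (suc m) = trans (cong (_+ (p ⋆ f) m) (ℚP.*-zeroˡ (f (suc m)))) (ℚP.+-identityˡ _)

  deriv-X : ∀ f → deriv (X f) ≗ (f ⊞ X (deriv f))
  deriv-X f zero    = trans (ℚP.*-identityˡ (f 0)) (sym (ℚP.+-identityʳ (f 0)))
  deriv-X f (suc m) = trans (cong (_* f (suc m)) (fromℕ-suc (suc m))) (expand (fromℕℚ (suc m)) (f (suc m)))
    where
    expand : ∀ t u → (1ℚ + t) * u ≡ u + t * u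
    expand = solve-∀ ℚ-ring

  derivPoly : Poly → Poly
  derivPoly []      = []
  derivPoly (c ∷ p) = p ⊕ (0ℚ ∷ derivPoly p)

  deriv-⋆ : ∀ p f → deriv (p ⋆ f) ≗ ((derivPoly p ⋆ f) ⊞ (p ⋆ deriv f))
  deriv-⋆ []      f m = ℚP.*-zeroʳ (fromℕℚ (suc m))
  deriv-⋆ (c ∷ p) f m = begin
    fromℕℚ (suc m) * (c * f (suc m) + (p ⋆ f) m)
      ≡⟨ expand (fromℕℚ (suc m)) c (f (suc m)) ((p ⋆ f) m) ⟩
    c * deriv f m + deriv (X (p ⋆ f)) m
      ≡⟨ cong ((c * deriv f m) +_) (trans (deriv-X (p ⋆ f) m) (cong ((p ⋆ f) m +_)
           (trans (X-cong (deriv-⋆ p f) m) (X-⊞ (derivPoly p ⋆ f) (p ⋆ deriv f) m)))) ⟩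
    c * deriv f m + ((p ⋆ f) m + (X (derivPoly p ⋆ f) m + X (p ⋆ deriv f) m))
      ≡⟨ regroup (c * deriv f m) ((p ⋆ f) m) (X (derivPoly p ⋆ f) m) (X (p ⋆ deriv f) m) ⟩
    ((p ⋆ f) m + X (derivPoly p ⋆ f) m) + (c * deriv f m + X (p ⋆ deriv f) m)
      ≡⟨ sym (cong₂ _+_
           (trans (⊕-⋆ p (0ℚ ∷ derivPoly p) f m) (cong ((p ⋆ f) m +_) (x∷-⋆ (derivPoly p) f m)))
           (⋆-horner c p (deriv f) m)) ⟩
    ((p ⊕ (0ℚ ∷ derivPoly p)) ⋆ f) m + ((c ∷ p) ⋆ deriv f) m ∎
    where
    open ≡-Reasoning
    expand : ∀ t c u v → t * (c * u + v) ≡ c * (t * u) + t * v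
    expand = solve-∀ ℚ-ring
    regroup : ∀ a b c d → a + (b + (c + d)) ≡ (b + c) + (a + d)
    regroup = solve-∀ ℚ-ring
    X-⊞ : ∀ g h → X (g ⊞ h) ≗ (X g ⊞ X h)
    X-⊞ g h zero    = refl
    X-⊞ g h (suc m) = refl

  +-interchange : ∀ a b c d → (a + b) + (c + d) ≡ (a + c) + (b + d)
  +-interchange = solve-∀ ℚ-ring

  linComb-⊕ : ∀ {r} (ps qs : Vec Poly r) y →
    linComb (Vec.zipWith _⊕_ ps qs) y ≗ (linComb ps y ⊞ linComb qs y)
  linComb-⊕ []       []       y m = refl
  linComb-⊕ (p ∷ ps) (q ∷ qs) y m =
    trans (cong₂ _+_ (⊕-⋆ p q y m) (linComb-⊕ ps qs (deriv y) m))
          (+-interchange ((p ⋆ y) m) ((q ⋆ y) m) (linComb ps (deriv y) m) (linComb qs (deriv y) m))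

  linComb-scale : ∀ {r} k (ps : Vec Poly r) y → linComb (Vec.map (scale k) ps) y ≗ (k · linComb ps y)
  linComb-scale k []       y m = sym (ℚP.*-zeroʳ k)
  linComb-scale k (p ∷ ps) y m = trans (cong₂ _+_ (scale-⋆ k p y m) (linComb-scale k ps (deriv y) m))
    (sym (ℚP.*-distribˡ-+ k ((p ⋆ y) m) (linComb ps (deriv y) m)))

  linComb-X : ∀ {r} (ps : Vec Poly r) y → linComb (Vec.map (0ℚ ∷_) ps) y ≗ X (linComb ps y)
  linComb-X []       y zero    = refl
  linComb-X []       y (suc m) = refl
  linComb-X (p ∷ ps) y m = trans (cong₂ _+_ (x∷-⋆ p y m) (linComb-X ps (deriv y) m)) (X-+ m)
    where
    X-+ : ∀ m → X (p ⋆ y) m + X (linComb ps (deriv y)) m ≡ X (linComb (p ∷ ps) y) m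
    X-+ zero    = refl
    X-+ (suc m) = refl

  linComb-deriv : ∀ {r} (ps : Vec Poly r) y →
    deriv (linComb ps y) ≗ (linComb (Vec.map derivPoly ps) y ⊞ linComb ps (deriv y))
  linComb-deriv []       y m = ℚP.*-zeroʳ (fromℕℚ (suc m))
  linComb-deriv (p ∷ ps) y m = trans
    (ℚP.*-distribˡ-+ (fromℕℚ (suc m)) ((p ⋆ y) (suc m)) (linComb ps (deriv y) (suc m)))
    (trans (cong₂ _+_ (deriv-⋆ p y m) (linComb-deriv ps (deriv y) m))
           (+-interchange ((derivPoly p ⋆ y) m) ((p ⋆ deriv y) m)
             (linComb (Vec.map derivPoly ps) (deriv y) m) (linComb ps (deriv (deriv y)) m)))

  X^ : ℕ → PowerSeries → PowerSeries
  X^ zero    f = f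
  X^ (suc k) f = X (X^ k f)

  falling : ℕ → ℚ → ℚ
  falling zero    t = 1ℚ
  falling (suc k) t = t * falling k (t - 1ℚ)

  X^-deriv^ : ∀ k f m → X^ k (deriv^ k f) m ≡ falling k (fromℕℚ m) * f m
  X^-deriv^ zero    f m       = sym (ℚP.*-identityˡ (f m))
  X^-deriv^ (suc k) f zero    =
    sym (trans (cong (_* f 0) (ℚP.*-zeroˡ (falling k (0ℚ - 1ℚ)))) (ℚP.*-zeroˡ (f 0)))
  X^-deriv^ (suc k) f (suc m) = begin
    X^ k (deriv^ k (deriv f)) m
      ≡⟨ X^-deriv^ k (deriv f) m ⟩
    falling k (fromℕℚ m) * (fromℕℚ (suc m) * f (suc m))
      ≡⟨ regroup (falling k (fromℕℚ m)) (fromℕℚ (suc m)) (f (suc m)) ⟩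
    fromℕℚ (suc m) * falling k (fromℕℚ m) * f (suc m)
      ≡⟨ cong (λ t → fromℕℚ (suc m) * falling k t * f (suc m))
           (trans (pred (fromℕℚ m)) (cong (_- 1ℚ) (sym (fromℕ-suc m)))) ⟩
    fromℕℚ (suc m) * falling k (fromℕℚ (suc m) - 1ℚ) * f (suc m) ∎
    where
    open ≡-Reasoning
    regroup : ∀ a b c → a * (b * c) ≡ b * a * c
    regroup = solve-∀ ℚ-ring
    pred : ∀ t → t ≡ 1ℚ + t - 1ℚ
    pred = solve-∀ ℚ-ring

  -- Unlike `_⋆_` it does not split on the index, so for a literal polynomial it unfolds at an
  -- arbitrary `m`.
  monomialSum : Poly → PowerSeries → PowerSeries
  monomialSum []      f m = 0ℚ
  monomialSum (c ∷ p) f m = c * f m + monomialSum p (X f) m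

  ⋆≗monomialSum : ∀ p f → (p ⋆ f) ≗ monomialSum p f
  ⋆≗monomialSum []      f m = refl
  ⋆≗monomialSum (c ∷ p) f m = trans (⋆-horner c p f m)
    (cong ((c * f m) +_) (trans (sym (⋆-X p f m)) (⋆≗monomialSum p (X f) m)))

  -- x² (1 - 10 x + 9 x²) = x² (1 - x)(1 - 9 x).
  leading : Poly
  leading = 0ℚ ∷ 0ℚ ∷ 1ℚ ∷ (- fromℕℚ 10) ∷ fromℕℚ 9 ∷ []

  -- The entries are coefficients in falling factorials of t, in decreasing degree: 9 t (t + 1)(t +
  -- 2)(t + 3) gives 9, 108, 324, 216; (t + 4)(t + 5) gives 1, 10, 20; and 2 (5 t² + 26 t + 30)(t +
  -- 2) gives 10, 102, 246, 120. The missing factors (t + 1)(t + 2) and t + 1 turn the later terms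
  -- of the recurrence into coefficients of y″ and y′. The first of the three polynomials is
  -- divisible by t, so y itself gets coefficient 0.
  lower₁ lower₂ lower₃ : Poly
  lower₁ = fromℕℚ 120 ∷ (- fromℕℚ 216) ∷ []
  lower₂ = (- fromℕℚ 20) ∷ fromℕℚ 246 ∷ (- fromℕℚ 324) ∷ []
  lower₃ = 0ℚ ∷ (- fromℕℚ 10) ∷ fromℕℚ 102 ∷ (- fromℕℚ 108) ∷ []

  lower : Vec Poly 4
  lower = [] ∷ lower₁ ∷ lower₂ ∷ lower₃ ∷ []

  -- Multiplication by `leading`, nested so that `p` itself is the first summand after the factor
  -- x². As 1 - 10 x + 9 x² has constant term 1, the lowest nonzero coefficient of `p` stays
  -- visible.
  timesLeading : Poly → Poly
  timesLeading p = 0ℚ ∷ 0ℚ ∷ (p ⊕ (0ℚ ∷ (scale (- fromℕℚ 10) p ⊕ (0ℚ ∷ scale (fromℕℚ 9) p))))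

  timesLeading-⋆ : ∀ p f → (timesLeading p ⋆ f) ≗ (leading ⋆ (p ⋆ f))
  timesLeading-⋆ p f m = begin
    (timesLeading p ⋆ f) m
      ≡⟨ x∷-⋆ _ f m ⟩
    X ((0ℚ ∷ (p ⊕ (0ℚ ∷ r))) ⋆ f) m
      ≡⟨ X-cong (x∷-⋆ (p ⊕ (0ℚ ∷ r)) f) m ⟩
    X (X ((p ⊕ (0ℚ ∷ r)) ⋆ f)) m
      ≡⟨ X-cong (X-cong (λ i → trans (⊕-⋆ p (0ℚ ∷ r) f i) (cong (g i +_) (trans (x∷-⋆ r f i)
           (X-cong (λ i → trans (⊕-⋆ (scale (- fromℕℚ 10) p) (0ℚ ∷ scale (fromℕℚ 9) p) f i)
             (cong₂ _+_ (scale-⋆ (- fromℕℚ 10) p f i)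
               (trans (x∷-⋆ (scale (fromℕℚ 9) p) f i) (X-cong (scale-⋆ (fromℕℚ 9) p f) i)))) i))))) m ⟩
    X (X (g ⊞ X (((- fromℕℚ 10) · g) ⊞ X (fromℕℚ 9 · g)))) m
      ≡⟨ sym (X-cong (X-cong (λ i → trans (⋆-horner 1ℚ _ g i) (cong₂ _+_ (ℚP.*-identityˡ (g i))
           (X-cong (λ i → trans (⋆-horner (- fromℕℚ 10) _ g i) (cong (((- fromℕℚ 10) * g i) +_)
             (X-cong (λ i → trans (⋆-horner (fromℕℚ 9) [] g i) (trans (cong ((fromℕℚ 9 * g i) +_) (X-0 i)) (ℚP.+-identityʳ _))) i))) i)))) m) ⟩
    X (X ((1ℚ ∷ (- fromℕℚ 10) ∷ fromℕℚ 9 ∷ []) ⋆ g)) m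
      ≡⟨ sym (X-cong (x∷-⋆ _ g) m) ⟩
    X ((0ℚ ∷ 1ℚ ∷ (- fromℕℚ 10) ∷ fromℕℚ 9 ∷ []) ⋆ g) m
      ≡⟨ sym (x∷-⋆ _ g m) ⟩
    (leading ⋆ g) m ∎
    where
    open ≡-Reasoning
    g = p ⋆ f
    r = scale (- fromℕℚ 10) p ⊕ (0ℚ ∷ scale (fromℕℚ 9) p)
    X-0 : ∀ i → X ([] ⋆ g) i ≡ 0ℚ
    X-0 zero    = refl
    X-0 (suc i) = refl

  timesLeading-nonZero : ∀ p → NonZeroPoly p → NonZeroPoly (timesLeading p)
  timesLeading-nonZero p p≢0 = there (there (bracket p p≢0))
    where
    bracket : ∀ p → NonZeroPoly p →
      NonZeroPoly (p ⊕ (0ℚ ∷ (scale (- fromℕℚ 10) p ⊕ (0ℚ ∷ scale (fromℕℚ 9) p))))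
    bracket (c ∷ p) p≢0 with c ℚP.≟ 0ℚ
    bracket (c ∷ p) p≢0         | no  c≢0  = here (λ c+0≡0 → c≢0 (trans (sym (ℚP.+-identityʳ c)) c+0≡0))
    bracket (c ∷ p) (here c≢0)  | yes c≡0  with () ← c≢0 c≡0
    -- With c = 0 the products of constants evaluate to 0, so the tail is the same expression formed
    -- from the shorter `p`.
    bracket (c ∷ p) (there p≢0) | yes refl = there (bracket p p≢0)

  leadingForm : ℚ → ℚ → ℚ → ℚ → ℚ → ℚ
  leadingForm u₀ u₁ u₂ u₃ u₄ = 0ℚ * u₀ + (0ℚ * u₁ + (1ℚ * u₂ + ((- fromℕℚ 10) * u₃ + (fromℕℚ 9 * u₄ + 0ℚ))))

  lowerForm : ℚ → ℚ → ℚ → ℚ → ℚ → ℚ → ℚ → ℚ → ℚ → ℚ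
  lowerForm u₀ u₁ v₀ v₁ v₂ w₀ w₁ w₂ w₃ =
    0ℚ + ((fromℕℚ 120 * u₀ + ((- fromℕℚ 216) * u₁ + 0ℚ))
    + (((- fromℕℚ 20) * v₀ + (fromℕℚ 246 * v₁ + ((- fromℕℚ 324) * v₂ + 0ℚ)))
    + ((0ℚ * w₀ + ((- fromℕℚ 10) * w₁ + (fromℕℚ 102 * w₂ + ((- fromℕℚ 108) * w₃ + 0ℚ)))) + 0ℚ)))

  Recurrence : PowerSeries → Set
  Recurrence y = ∀ m → let t = fromℕℚ m in
    fromℕℚ 9 * t * (t + fromℕℚ 3) * y m + (t + fromℕℚ 4) * (t + fromℕℚ 5) * y (suc (suc m))
    ≡ fromℕℚ 2 * (fromℕℚ 5 * t * t + fromℕℚ 26 * t + fromℕℚ 30) * y (suc m)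

  module _ (y : PowerSeries) (recurrence : Recurrence y) where

    -- The recurrence times (m + 1)(m + 2), which absorbs its initial conditions:
    -- xᵏ y⁽ᵏ⁺ʲ⁾ has m-th coefficient m (m - 1) ⋯ (m - k + 1) times that of y⁽ʲ⁾.
    differential-equation : (leading ⋆ deriv^ 4 y) ≗ linComb lower y
    differential-equation m = begin
      (leading ⋆ deriv^ 4 y) m
        ≡⟨ ⋆≗monomialSum leading (deriv^ 4 y) m ⟩
      leadingForm d₄ d₄′ (X^ 2 (deriv^ 4 y) m) (X^ 3 (deriv^ 4 y) m) (X^ 4 (deriv^ 4 y) m)
        ≡⟨ leadingForm-cong (X^-deriv^ 2 (deriv^ 2 y) m) (X^-deriv^ 3 (deriv y) m) (X^-deriv^ 4 y m) ⟩
      leadingForm d₄ d₄′ (falling 2 t * y₂) (falling 3 t * y₁) (falling 4 t * y m)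
        ≡⟨ expand (fromℕ-suc m) (trans (fromℕ-suc (suc m)) (cong (1ℚ +_) (fromℕ-suc m))) ⟩
      lowerForm y₁ (falling 1 t * y m) y₂ (falling 1 t * y₁) (falling 2 t * y m)
        d₃ (falling 1 t * y₂) (falling 2 t * y₁) (falling 3 t * y m)
        ≡⟨ sym (lowerForm-cong (X^-deriv^ 1 y m) (X^-deriv^ 1 (deriv y) m) (X^-deriv^ 2 y m)
             (X^-deriv^ 1 (deriv (deriv y)) m) (X^-deriv^ 2 (deriv y) m) (X^-deriv^ 3 y m)) ⟩
      lowerForm y₁ (X (deriv y) m) y₂ (X (deriv^ 2 y) m) (X^ 2 (deriv^ 2 y) m)
        d₃ (X (deriv^ 3 y) m) (X^ 2 (deriv^ 3 y) m) (X^ 3 (deriv^ 3 y) m)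
        ≡⟨ cong (0ℚ +_) (sym (cong₂ _+_ (⋆≗monomialSum lower₁ (deriv y) m)
             (cong₂ _+_ (⋆≗monomialSum lower₂ (deriv^ 2 y) m)
               (cong (_+ 0ℚ) (⋆≗monomialSum lower₃ (deriv^ 3 y) m))))) ⟩
      linComb lower y m ∎
      where
      open ≡-Reasoning
      t = fromℕℚ m
      y₁ = deriv y m
      y₂ = deriv (deriv y) m
      d₃ = deriv^ 3 y m
      d₄ = deriv^ 4 y m
      d₄′ = X (deriv^ 4 y) m
      leadingForm-cong : ∀ {u₂ u₃ u₄ v₂ v₃ v₄} → u₂ ≡ v₂ → u₃ ≡ v₃ → u₄ ≡ v₄ →
        leadingForm d₄ d₄′ u₂ u₃ u₄ ≡ leadingForm d₄ d₄′ v₂ v₃ v₄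
      leadingForm-cong refl refl refl = refl
      lowerForm-cong : ∀ {u₁ v₁ v₂ w₁ w₂ w₃ u₁′ v₁′ v₂′ w₁′ w₂′ w₃′} →
        u₁ ≡ u₁′ → v₁ ≡ v₁′ → v₂ ≡ v₂′ → w₁ ≡ w₁′ → w₂ ≡ w₂′ → w₃ ≡ w₃′ →
        lowerForm y₁ u₁ y₂ v₁ v₂ d₃ w₁ w₂ w₃ ≡ lowerForm y₁ u₁′ y₂ v₁′ v₂′ d₃ w₁′ w₂′ w₃′
      lowerForm-cong refl refl refl refl refl refl = refl
      -- Here a, b, c are three consecutive coefficients of `y`, and z₀, z₁, z₂ are the values met
      -- by the zero coefficients of `leading` and `lower₃`. The last summand is (t + 1)(t + 2)
      -- times the defect of the recurrence.
      identity : ∀ t a b c z₀ z₁ z₂ →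
        0ℚ * z₀ + (0ℚ * z₁ + (1ℚ * ((t * ((t - 1ℚ) * 1ℚ)) * ((1ℚ + t) * ((1ℚ + (1ℚ + t)) * c)))
          + ((- fromℕℚ 10) * ((t * ((t - 1ℚ) * ((t - 1ℚ - 1ℚ) * 1ℚ))) * ((1ℚ + t) * b))
          + (fromℕℚ 9 * ((t * ((t - 1ℚ) * ((t - 1ℚ - 1ℚ) * ((t - 1ℚ - 1ℚ - 1ℚ) * 1ℚ)))) * a) + 0ℚ))))
        ≡ (0ℚ + ((fromℕℚ 120 * ((1ℚ + t) * b) + ((- fromℕℚ 216) * ((t * 1ℚ) * a) + 0ℚ))
          + (((- fromℕℚ 20) * ((1ℚ + t) * ((1ℚ + (1ℚ + t)) * c)) + (fromℕℚ 246 * ((t * 1ℚ) * ((1ℚ + t) * b))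
              + ((- fromℕℚ 324) * ((t * ((t - 1ℚ) * 1ℚ)) * a) + 0ℚ)))
          + ((0ℚ * z₂ + ((- fromℕℚ 10) * ((t * 1ℚ) * ((1ℚ + t) * ((1ℚ + (1ℚ + t)) * c)))
              + (fromℕℚ 102 * ((t * ((t - 1ℚ) * 1ℚ)) * ((1ℚ + t) * b))
              + ((- fromℕℚ 108) * ((t * ((t - 1ℚ) * ((t - 1ℚ - 1ℚ) * 1ℚ))) * a) + 0ℚ)))) + 0ℚ))))
          + (1ℚ + t) * (1ℚ + (1ℚ + t)) *
            ((fromℕℚ 9 * t * (t + fromℕℚ 3) * a + (t + fromℕℚ 4) * (t + fromℕℚ 5) * c)
             - fromℕℚ 2 * (fromℕℚ 5 * t * t + fromℕℚ 26 * t + fromℕℚ 30) * b)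
      identity = solve-∀ ℚ-ring
      drop : ∀ s k {u v} → u ≡ v → s + k * (u - v) ≡ s
      drop s k {u} refl = cancel s k u
        where
        cancel : ∀ s k u → s + k * (u - u) ≡ s
        cancel = solve-∀ ℚ-ring
      expand : ∀ {t₁ t₂} → t₁ ≡ 1ℚ + t → t₂ ≡ 1ℚ + (1ℚ + t) →
        let z₁ = t₁ * y (suc m) ; z₂ = t₁ * (t₂ * y (suc (suc m))) in
        leadingForm d₄ d₄′ (falling 2 t * z₂) (falling 3 t * z₁) (falling 4 t * y m)
        ≡ lowerForm z₁ (falling 1 t * y m) z₂ (falling 1 t * z₁) (falling 2 t * y m)
            d₃ (falling 1 t * z₂) (falling 2 t * z₁) (falling 3 t * y m)
      expand refl refl =
        trans (identity t (y m) (y (suc m)) (y (suc (suc m))) d₄ d₄′ d₃)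
              (drop (lowerForm z₁ (falling 1 t * y m) z₂ (falling 1 t * z₁) (falling 2 t * y m)
                       d₃ (falling 1 t * z₂) (falling 2 t * z₁) (falling 3 t * y m))
                    ((1ℚ + t) * (1ℚ + (1ℚ + t))) (recurrence m))
        where
        z₁ = (1ℚ + t) * y (suc m)
        z₂ = (1ℚ + t) * ((1ℚ + (1ℚ + t)) * y (suc (suc m)))

    Span : PowerSeries → Set
    Span f = Σ[ ps ∈ Vec Poly 4 ] (f ≗ linComb ps y)

    span-cong : ∀ {f g} → f ≗ g → Span f → Span g
    span-cong f≗g (ps , f≗) = ps , λ m → trans (sym (f≗g m)) (f≗ m)

    span-⊞ : ∀ {f g} → Span f → Span g → Span (f ⊞ g)
    span-⊞ (ps , f≗) (qs , g≗) =
      Vec.zipWith _⊕_ ps qs , λ m → trans (cong₂ _+_ (f≗ m) (g≗ m)) (sym (linComb-⊕ ps qs y m))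

    span-· : ∀ k {f} → Span f → Span (k · f)
    span-· k (ps , f≗) =
      Vec.map (scale k) ps , λ m → trans (cong (k *_) (f≗ m)) (sym (linComb-scale k ps y m))

    span-X : ∀ {f} → Span f → Span (X f)
    span-X (ps , f≗) = Vec.map (0ℚ ∷_) ps , λ m → trans (X-cong f≗ m) (sym (linComb-X ps y m))

    span-⋆ : ∀ p {f} → Span f → Span (p ⋆ f)
    span-⋆ []      {f} f∈ = span-cong (λ m → ℚP.*-zeroˡ (f m)) (span-· 0ℚ f∈)
    span-⋆ (c ∷ p) {f} f∈ =
      span-cong (λ m → sym (⋆-horner c p f m)) (span-⊞ (span-· c f∈) (span-X (span-⋆ p f∈)))

    span-cancel : ∀ {f g} → Span (f ⊞ g) → Span f → Span g
    span-cancel {f} {g} f⊞g∈ f∈ = span-cong (λ m → cancel (f m) (g m)) (span-⊞ f⊞g∈ (span-· (- 1ℚ) f∈))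
      where
      cancel : ∀ a b → a + b + - 1ℚ * a ≡ b
      cancel = solve-∀ ℚ-ring

    -- Differentiating a combination of y, ..., y‴ creates y⁗ only from the last term, with
    -- coefficient `p₃`; the factor `leading` lets the differential equation replace it.
    span-leading-deriv : ∀ {f} → Span f → Span (leading ⋆ deriv f)
    span-leading-deriv {f} (ps@(p₀ ∷ p₁ ∷ p₂ ∷ p₃ ∷ []) , f≗) =
      span-cong (λ m → sym (trans (⋆-cong leading f′≗ m) (⋆-⊞ leading (linComb qs y) (p₃ ⋆ deriv^ 4 y) m)))
        (span-⊞ (span-⋆ leading (qs , λ _ → refl))
          (span-cong (⋆-comm p₃ leading (deriv^ 4 y)) (span-⋆ p₃ (lower , differential-equation))))
      where
      qs : Vec Poly 4
      qs = Vec.zipWith _⊕_ (Vec.map derivPoly ps) ([] ∷ p₀ ∷ p₁ ∷ p₂ ∷ [])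
      shift : ∀ a b c d → a + (b + (c + (d + 0ℚ))) ≡ (0ℚ + (a + (b + (c + 0ℚ)))) + d
      shift = solve-∀ ℚ-ring
      f′≗ : deriv f ≗ (linComb qs y ⊞ (p₃ ⋆ deriv^ 4 y))
      f′≗ m = begin
        deriv f m
          ≡⟨ deriv-cong f≗ m ⟩
        deriv (linComb ps y) m
          ≡⟨ linComb-deriv ps y m ⟩
        linComb (Vec.map derivPoly ps) y m + linComb ps (deriv y) m
          ≡⟨ cong (linComb (Vec.map derivPoly ps) y m +_)
               (shift ((p₀ ⋆ deriv y) m) ((p₁ ⋆ deriv^ 2 y) m) ((p₂ ⋆ deriv^ 3 y) m) ((p₃ ⋆ deriv^ 4 y) m)) ⟩
        linComb (Vec.map derivPoly ps) y m + (linComb ([] ∷ p₀ ∷ p₁ ∷ p₂ ∷ []) y m + (p₃ ⋆ deriv^ 4 y) m)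
          ≡⟨ sym (ℚP.+-assoc (linComb (Vec.map derivPoly ps) y m) _ _) ⟩
        linComb (Vec.map derivPoly ps) y m + linComb ([] ∷ p₀ ∷ p₁ ∷ p₂ ∷ []) y m + (p₃ ⋆ deriv^ 4 y) m
          ≡⟨ cong (_+ (p₃ ⋆ deriv^ 4 y) m) (sym (linComb-⊕ (Vec.map derivPoly ps) ([] ∷ p₀ ∷ p₁ ∷ p₂ ∷ []) y m)) ⟩
        linComb qs y m + (p₃ ⋆ deriv^ 4 y) m ∎
        where open ≡-Reasoning

    leading^ : ℕ → Poly
    leading^ zero    = 1ℚ ∷ []
    leading^ (suc k) = timesLeading (leading^ k)

    leading^-nonZero : ∀ k → NonZeroPoly (leading^ k)
    leading^-nonZero zero    = here (λ ())
    leading^-nonZero (suc k) = timesLeading-nonZero (leading^ k) (leading^-nonZero k)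

    one-⋆ : ∀ f → ((1ℚ ∷ []) ⋆ f) ≗ f
    one-⋆ f zero    = ℚP.*-identityˡ (f 0)
    one-⋆ f (suc m) = trans (ℚP.+-identityʳ _) (ℚP.*-identityˡ (f (suc m)))

    leading^-suc : ∀ k f → (leading^ (suc k) ⋆ f) ≗ (leading^ k ⋆ (leading ⋆ f))
    leading^-suc k f m = trans (timesLeading-⋆ (leading^ k) f m) (⋆-comm leading (leading^ k) f m)

    -- With L for `leading`: apply the induction hypothesis to L f and expand (L f)′ = L′ f + L f′.
    -- The part with L′ f is in the span by assumption and is subtracted, so no division by L
    -- occurs.
    span-leading^-deriv : ∀ k {f} → Span (leading^ k ⋆ f) → Span (leading^ (suc k) ⋆ deriv f)
    span-leading^-deriv zero {f} f∈ =
      span-cong (λ m → sym (trans (leading^-suc 0 (deriv f) m) (one-⋆ (leading ⋆ deriv f) m)))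
        (span-leading-deriv (span-cong (one-⋆ f) f∈))
    span-leading^-deriv (suc k) {f} f∈ =
      span-cong (λ m → sym (leading^-suc (suc k) (deriv f) m))
        (span-cancel
          (span-cong (λ m → trans (⋆-cong (leading^ (suc k)) (deriv-⋆ leading f) m)
                                  (⋆-⊞ (leading^ (suc k)) (derivPoly leading ⋆ f) (leading ⋆ deriv f) m))
            (span-leading^-deriv k (span-cong (leading^-suc k f) f∈)))
          (span-cong (⋆-comm (derivPoly leading) (leading^ (suc k)) f) (span-⋆ (derivPoly leading) f∈)))

    deriv^-suc : ∀ k f → deriv^ (suc k) f ≡ deriv (deriv^ k f)
    deriv^-suc zero    f = refl
    deriv^-suc (suc k) f = deriv^-suc k (deriv f)

    span-leading^ : ∀ k → Span (leading^ k ⋆ deriv^ k y)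
    span-leading^ zero    = ((1ℚ ∷ []) ∷ [] ∷ [] ∷ [] ∷ []) , λ m → sym (ℚP.+-identityʳ _)
    span-leading^ (suc k) rewrite deriv^-suc k y = span-leading^-deriv k (span-leading^ k)

    dFinite : DFinite y
    dFinite = 3 , λ k → leading^ k , leading^-nonZero k , span-leading^ k

-- Assembly of the three claims.

open import Data.Nat as ℕ using (ℕ; _≤_; _∸_)
open import Data.Integer using (ℤ; +_; _+_; _-_; _*_)
open import Data.Integer.Properties using (+-identityˡ)
open import Data.Integer.Tactic.RingSolver using (solve-∀)
import Data.Rational as ℚ
open import Data.Product using (_×_; _,_)
open import Relation.Binary.PropositionalEquality using (_≡_; refl; sym; trans; cong; cong₂; module ≡-Reasoning)
open Reflection using (walks≡constTerm)
open CoefficientRecurrence using (walks-recurrence)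
open Counting using (C-suc≡walks)
open DFiniteness using (fromℤ; fromℤ-+; fromℤ-*; Recurrence; dFinite)

C≡constTerm : (n : ℕ) → 1 ≤ n → + C n ≡ constTerm (laurentA ·L (laurentB ^L (n ∸ 1)))
C≡constTerm (ℕ.suc m) _ = trans (cong +_ (C-suc≡walks m)) (walks≡constTerm m)

C-recurrence : (n : ℕ) → (+ 9 * + n * (+ n + + 3)) * + C n
  - (+ 2 * (+ 5 * + n * + n + + 26 * + n + + 30)) * + C (ℕ.suc n)
  + ((+ n + + 4) * (+ n + + 5)) * + C (ℕ.suc (ℕ.suc n))
  ≡ + 0
-- The walk formula starts at C 1, so n = 0 is evaluated directly: the coefficient of C 0 is 0, and
-- with C 1 = 1, C 2 = 3 the rest is -60 + 60.
C-recurrence ℕ.zero = refl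
C-recurrence (ℕ.suc m) =
  substitute (+ ℕ.suc m) (C-suc≡walks m) (C-suc≡walks (ℕ.suc m)) (C-suc≡walks (ℕ.suc (ℕ.suc m)))
    (walks-recurrence m)
  where
  left : ℤ → ℕ → ℕ → ℕ → ℤ
  left n c₀ c₁ c₂ = (+ 9 * n * (n + + 3)) * + c₀ - (+ 2 * (+ 5 * n * n + + 26 * n + + 30)) * + c₁
                  + ((n + + 4) * (n + + 5)) * + c₂
  substitute : ∀ n {c₀ c₁ c₂ w₀ w₁ w₂} → c₀ ≡ w₀ → c₁ ≡ w₁ → c₂ ≡ w₂ →
    left n w₀ w₁ w₂ ≡ + 0 → left n c₀ c₁ c₂ ≡ + 0
  substitute n refl refl refl eq = eq

fromℤ-recurrence : ∀ n c₀ c₁ c₂ →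
  (+ 9 * n * (n + + 3)) * c₀ - (+ 2 * (+ 5 * n * n + + 26 * n + + 30)) * c₁ + ((n + + 4) * (n + + 5)) * c₂ ≡ + 0 →
  let t = fromℤ n in
  fromℕℚ 9 ℚ.* t ℚ.* (t ℚ.+ fromℕℚ 3) ℚ.* fromℤ c₀ ℚ.+ (t ℚ.+ fromℕℚ 4) ℚ.* (t ℚ.+ fromℕℚ 5) ℚ.* fromℤ c₂
  ≡ fromℕℚ 2 ℚ.* (fromℕℚ 5 ℚ.* t ℚ.* t ℚ.+ fromℕℚ 26 ℚ.* t ℚ.+ fromℕℚ 30) ℚ.* fromℤ c₁
fromℤ-recurrence n c₀ c₁ c₂ eq = begin
  fromℕℚ 9 ℚ.* t ℚ.* (t ℚ.+ fromℕℚ 3) ℚ.* fromℤ c₀ ℚ.+ (t ℚ.+ fromℕℚ 4) ℚ.* (t ℚ.+ fromℕℚ 5) ℚ.* fromℤ c₂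
    ≡⟨ sym (trans (fromℤ-+ (P * c₀) (R * c₂)) (cong₂ ℚ._+_
         (times P c₀ (times (+ 9 * n) (n + + 3) (fromℤ-* (+ 9) n) (fromℤ-+ n (+ 3))) refl)
         (times R c₂ (times (n + + 4) (n + + 5) (fromℤ-+ n (+ 4)) (fromℤ-+ n (+ 5))) refl))) ⟩
  fromℤ (P * c₀ + R * c₂)
    ≡⟨ cong fromℤ (trans (isolate (P * c₀) (Q * c₁) (R * c₂))
         (trans (cong (λ z → z + Q * c₁) eq) (+-identityˡ (Q * c₁)))) ⟩
  fromℤ (Q * c₁)
    ≡⟨ times Q c₁ (times (+ 2) Q′ refl (plus (Q″ + + 26 * n) (+ 30)
         (plus Q″ (+ 26 * n) (times (+ 5 * n) n (fromℤ-* (+ 5) n) refl) (fromℤ-* (+ 26) n)) refl)) refl ⟩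
  fromℕℚ 2 ℚ.* (fromℕℚ 5 ℚ.* t ℚ.* t ℚ.+ fromℕℚ 26 ℚ.* t ℚ.+ fromℕℚ 30) ℚ.* fromℤ c₁ ∎
  where
  open ≡-Reasoning
  t = fromℤ n
  P = + 9 * n * (n + + 3)
  Q″ = + 5 * n * n
  Q′ = Q″ + + 26 * n + + 30
  Q = + 2 * Q′
  R = (n + + 4) * (n + + 5)
  times : ∀ i j {u v} → fromℤ i ≡ u → fromℤ j ≡ v → fromℤ (i * j) ≡ u ℚ.* v
  times i j eq₁ eq₂ = trans (fromℤ-* i j) (cong₂ ℚ._*_ eq₁ eq₂)
  plus : ∀ i j {u v} → fromℤ i ≡ u → fromℤ j ≡ v → fromℤ (i + j) ≡ u ℚ.+ v
  plus i j eq₁ eq₂ = trans (fromℤ-+ i j) (cong₂ ℚ._+_ eq₁ eq₂)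
  isolate : ∀ a b c → a + c ≡ (a - b + c) + b
  isolate = solve-∀

genC-recurrence : Recurrence genC
genC-recurrence m =
  fromℤ-recurrence (+ m) (+ C m) (+ C (ℕ.suc m)) (+ C (ℕ.suc (ℕ.suc m))) (C-recurrence m)

theorem1p7 : ((n : ℕ) → 1 ≤ n → + C n ≡ constTerm (laurentA ·L (laurentB ^L (n ∸ 1))))
    × ((n : ℕ) → (+ 9 * + n * (+ n + + 3)) * + C n
    - (+ 2 * (+ 5 * + n * + n + + 26 * + n + + 30)) * + C (ℕ.suc n)
    + ((+ n + + 4) * (+ n + + 5)) * + C (ℕ.suc (ℕ.suc n))
    ≡ + 0)
    × DFinite genC
theorem1p7 = C≡constTerm , C-recurrence , dFinite genC genC-recurrence
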